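{- Let $n\ge2$ and let $z\in I_\infty$ be an involution with no descents greater than $n$ (i.e. $z(i)<z(i+1)$ for all $i>n$). Let $T=(t_1,\dots,t_k)$ be an $\mathsf{O}$-reduced tableau for $z$ with only one row, let $i_1<i_2<\cdots<i_k$ be the entries $\lceil t_1\rceil,\dots,\lceil t_k\rceil$ listed in increasing order, and set $\alpha^{\mathsf{O}}(T)=k\mathbf{e}_{i_1}+\mathbf{e}_{i_2}+\cdots+\mathbf{e}_{i_k}$. Then $\mathrm{BRF}^{\mathsf{O}}_n(T)\cong\mathrm{BRF}^{\mathsf{O}}_n(\alpha^{\mathsf{O}}(T))$ as $\mathfrak{q}^+_n$-crystals.
   Context: $\mathbf{e}_j$ is the weak composition with a $1$ in position $j$ and $0$ elsewhere. All notation for involutions, primed words, $\mathcal{R}^{\mathsf{O}}(z)$, $\mathrm{RF}^{\mathsf{O}}_n(z)$, its $\mathfrak{q}^+_n$-crystal operators, boundedness, $\mathrm{BRF}^{\mathsf{O}}_n(z)$, and $\mathrm{BRF}^{\mathsf{O}}_n(\alpha)$ is as follows. $S_\mathbb{Z}$ is the group of finitary permutations of $\mathbb{Z}$, generated by $s_i=(i\ i+1)$; $S_\infty,S_n$ the subgroups generated by $s_i$ ($i\ge1$), resp. $s_1,\dots,s_{n-1}$; $w_0$ longest in $S_n$; $\mathcal{R}(w)$ reduced words; $\circ$ the Demazure product ($v\circ w=vw$ when lengths add, $s_i\circ s_i=s_i$). $I_\mathbb{Z}$ involutions in $S_\mathbb{Z}$, $I_\infty=I_\mathbb{Z}\cap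 S_\infty$; $\mathcal{A}^{\mathsf{O}}(z)$ the minimal-length $w$ with $z=w^{ -1}\circ w$; $\mathrm{Cyc}(z)=\{(a,b):a<b=z(a)\}$. Primed letters: $m'=m-\tfrac12$, order $\cdots<1'<1<2'<2<\cdots$, $\lceil\cdot\rceil$ removes primes. For a primed word $i=i_1\cdots i_\ell$ with $\lceil i\rceil\in\mathcal{R}(w)$, $a_j=s_{\lceil i_\ell\rceil}\cdots s_{\lceil i_{j+1}\rceil}(\lceil i_j\rceil)$, $b_j=s_{\lceil i_\ell\rceil}\cdots s_{\lceil i_{j+1}\rceil}(\lceil i_j\rceil+1)$, $\mathrm{Marked}(i)=\{(a_j,b_j):i_j\text{ primed}\}$; $\mathcal{R}^{\mathsf{O}}(z)$ is the set of such $i$ with $w\in\mathcal{A}^{\mathsf{O}}(z)$ and $\mathrm{Marked}(i)\subseteq\mathrm{Cyc}(z)$. $\mathrm{RF}^{\mathsf{O}}_n(z)$: $n$-tuples of strictly decreasing primed words with concatenation in $\mathcal{R}^{\mathsf{O}}(z)$, weight $(\ell(a^1),\dots,\ell(a^n))$. Its $\mathfrak{q}^+_n$-operators ($e_i,f_i$ for $i\in[n-1]$ via the prime-aware pairing rule with prime swapping; $e_{\bar1},f_{\bar1}$ moving the larger maximal letter between the first two factors with prime swapping; $e_{1'},f_{1'}$ removing/adding the prime on $\max(a^1)$; and $e_{\bar i},e_{\underline i},e_{i'}$ and their $f$-versions obtained by conjugating with $\sigma_i$, $\sigma_{w_0}$) are exactly: pairing of $(u,v)$: letters $c$ of $v$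 taken right to left are paired with the largest unpaired $b\in u$ with $\lceil b\rceil<\lceil c\rceil$. $e_ia=\mathbf{0}$ if all letters of $a^{i+1}$ are paired; else $x$ = largest unpaired letter of $a^{i+1}$, $q\ge0$ minimal with $\lceil x\rceil+q\notin\lceil a^i\rceil$: remove $x$ from $a^{i+1}$, insert $x+q$ into $a^i$, swap primes on pairs $(b,c)$ with $\lceil x\rceil+q\ge\lceil c\rceil>\lceil x\rceil$. $f_ia=\mathbf{0}$ if all letters of $a^i$ are paired; else $y$ = smallest unpaired letter of $a^i$, $q\ge0$ minimal with $\lceil y\rceil-q\notin\lceil a^{i+1}\rceil$: remove $y$, insert $y-q$ into $a^{i+1}$, swap primes on pairs $(b,c)$ with $\lceil y\rceil>\lceil b\rceil\ge\lceil y\rceil-q$. (Swapping primes on two letters reverses both primes iff exactly one is primed.) $e_{\bar1}a=\mathbf{0}$ if $a^2=\emptyset$ or $\lceil\max a^2\rceil\le\lceil\max a^1\rceil$; else move $\max(a^2)$ to the start of $a^1$ and, if $a^1\ne\emptyset$, swap primes on the first two letters of the new first factor. $f_{\bar1}a=\mathbf{0}$ if $a^1=\emptyset$ or $\lceil\max a^1\rceil\le\lceil\max a^2\rceil$; else move $\max(a^1)$ to the start of $a^2$ giving $b$, and if $b^1\ne\emptyset$ swap primes on $\max(b^1)$ and $\max(b^2)$. $e_{1'}$ (resp. $f_{1'}$) removes (resp. adds) the prime on $\max(a^1)$ if $a^1\ne\emptyset$ and it is primed (resp. unprimed), else gives $\mathbf{0}$. With $\sigma_i(b)=f_i^kb$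 for $k=\mathrm{wt}(b)_i-\mathrm{wt}(b)_{i+1}\ge0$ and $e_i^{ -k}b$ otherwise: $e_{\bar i}=\sigma_{i-1}\sigma_ie_{\overline{i-1}}\sigma_i\sigma_{i-1}$, $e_{\underline i}=\sigma_{w_0}f_{\overline{n-i}}\sigma_{w_0}$, $f_{\underline i}=\sigma_{w_0}e_{\overline{n-i}}\sigma_{w_0}$, $e_{i'}=\sigma_{i-1}\cdots\sigma_1e_{1'}\sigma_1\cdots\sigma_{i-1}$, and similarly for $f$. Subsets carry the restricted structure (operators become $\mathbf{0}$ upon leaving). A $\mathfrak{q}^+_n$-crystal isomorphism is a weight-preserving bijection commuting with all $e_j,f_j$. One-row tableaux: a shifted tableau with one row is a sequence $T=(t_1,\dots,t_k)$ of elements of $\mathbb{Z}\sqcup\mathbb{Z}'$; it is an $\mathsf{O}$-reduced tableau for $z$ if $t_1$ is unprimed, $T$ is strictly increasing or strictly decreasing, and $t_1t_2\cdots t_k\in\mathcal{R}^{\mathsf{O}}(z)$. Orthogonal Coxeter–Knuth equivalence $\overset{\mathsf{O}}{\sim}$ on primed words is the transitive closure of: $\cdots ACB\cdots\sim\cdots CAB\cdots$ and $\cdots BCA\cdots\sim\cdots BAC\cdots$ for primed or unprimed $A,B,C$ with $\lceil A\rceil<\lceil B\rceil<\lceil C\rceil$; $\cdots aba\cdots\sim\cdots bab\cdots$, $\cdots a'b'a'\cdots\sim\cdots b'a'b'\cdots$, $\cdots a'ba\cdots\sim\cdots bab'\cdots$, $\cdots ab'a\cdots\sim\cdots ba'b\cdots$,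 $\cdots a'b'a\cdots\sim\cdots ba'b'\cdots$, $\cdots a'ba'\cdots\sim\cdots b'ab'\cdots$ for integers $|a-b|=1$; and, at the start of a word, $a\cdots\sim a'\cdots$, $ab\cdots\sim ba\cdots$, $ab'\cdots\sim ba'\cdots$, $a'b\cdots\sim b'a\cdots$, $a'b'\cdots\sim b'a'\cdots$ for integers $a,b$ (ellipses denote identical subwords). $\mathrm{RF}^{\mathsf{O}}_n(T)$ is the set of $a\in\mathrm{RF}^{\mathsf{O}}_n(z)$ with $a^1\cdots a^n\overset{\mathsf{O}}{\sim}t_1\cdots t_k$; $a$ is bounded if every letter $m$ of $a^i$ has $i\le\lceil m\rceil$; $\mathrm{BRF}^{\mathsf{O}}_n(z)$ is the set of bounded elements and $\mathrm{BRF}^{\mathsf{O}}_n(T)=\mathrm{RF}^{\mathsf{O}}_n(T)\cap\mathrm{BRF}^{\mathsf{O}}_n(z)$. For a symmetric weak composition $\alpha$ (i.e. $\lambda(\alpha)=\lambda(\alpha)^T$, $\lambda(\alpha)$ its sorted partition), let $u(\alpha)$ be the minimal-length $u\in S_\infty$ with $\alpha=u\lambda(\alpha)$ (acting by permuting positions), $w_\lambda\in S_\infty$ the unique permutation whose Rothe diagram $\{(i,w(j)):i<j,w(i)>w(j)\}$ equals $\{(i,j):j\le\lambda_i\}$, $\mathcal{B}=\mathrm{RF}^{\mathsf{O}}_n(w_{\lambda(\alpha)})$, $\mathfrak{D}_iX=\{b\in\mathcal{B}:e_i^kb\in X,\ k\ge0\}$, and $\mathrm{BRF}^{\mathsf{O}}_n(\alpha)=\mathfrak{D}_{i_1}\cdots\mathfrak{D}_{i_k}\mathrm{BRF}^{\mathsf{O}}_n(w_{\lambda(\alpha)})$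 for a reduced word $i_1\cdots i_k$ of $u(\alpha)$. -}

module Defs where

open import Data.Nat using (ℕ; zero; suc; _+_; _*_; _∸_; _≤_; _<_; _≡ᵇ_; _<ᵇ_; _≤ᵇ_)
open import Data.Bool using (Bool; true; false; if_then_else_; not; _∧_)
open import Data.List using (List; []; _∷_; _++_; [_]; map; length; reverse; concat; filterᵇ; foldr; foldl; replicate)
open import Data.Bool.ListAction using (any)
open import Data.List.Relation.Unary.All using (All)
open import Data.List.Relation.Unary.Linked using (Linked)
open import Data.Maybe using (Maybe; just; nothing; _>>=_)
open import Data.Product using (Σ; _×_; _,_; proj₁; proj₂)
open import Data.Sum using (_⊎_)
open import Data.Unit using (⊤)
open import Data.Empty using (⊥)
open import Relation.Binary.PropositionalEquality using (_≡_)
open import Relation.Binary.Construct.Closure.Equivalence using (EqClosure)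
open import Function.Bundles using (_⇔_)
open import Relation.Nullary using (¬_)

-- Permutations of positive integers (S_∞), given by words in s_i (i ≥ 1).
-- A word i₁ ⋯ iℓ denotes s_{i₁} ⋯ s_{iℓ}; position 0 is always fixed.

sw : ℕ → ℕ → ℕ
sw i x = if x ≡ᵇ i then suc i else (if x ≡ᵇ suc i then i else x)

act : List ℕ → ℕ → ℕ
act [] x = x
act (i ∷ is) x = sw i (act is x)

applyLR : List ℕ → ℕ → ℕ
applyLR [] x = x
applyLR (i ∷ is) x = applyLR is (sw i x)

Word : List ℕ → Set
Word = All (1 ≤_)

_≈ₚ_ : List ℕ → List ℕ → Set
u ≈ₚ v = ∀ x → act u x ≡ act v x

Reduced : List ℕ → Set
Reduced ws = Word ws × (∀ vs → Word vs → vs ≈ₚ ws → length ws ≤ length vs)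

-- Demazure product of the generators of a word (returns a word for it):
-- x ∘ s_i = x s_i if x(i) < x(i+1) (length goes up), and x otherwise.
demazure : List ℕ → List ℕ
demazure = foldl step []
  where
  step : List ℕ → ℕ → List ℕ
  step acc i = if act acc i <ᵇ act acc (suc i) then acc ++ [ i ] else acc

Involution : List ℕ → Set
Involution z = Word z × (∀ x → act z (act z x) ≡ x)

NoDescAbove : ℕ → List ℕ → Set
NoDescAbove n z = ∀ i → n < i → act z i < act z (suc i)

-- ws is a reduced word of some w ∈ A^O(z)
-- (for reduced ws, demazure (reverse ws ++ ws) represents w⁻¹ ∘ w)
IsAtomWord : List ℕ → List ℕ → Set
IsAtomWord z ws =
  Reduced ws × (demazure (reverse ws ++ ws) ≈ₚ z) ×
  (∀ vs → Reduced vs → demazure (reverse vs ++ vs) ≈ₚ z → length ws ≤ length vs)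

InCyc : List ℕ → ℕ → ℕ → Set
InCyc z a b = a < b × act z a ≡ b

-- Primed letters: (m , false) = m, (m , true) = m'.

PL : Set
PL = ℕ × Bool

ceil : PL → ℕ
ceil = proj₁

primed : PL → Bool
primed = proj₂

un pr : ℕ → PL
un m = m , false
pr m = m , true

-- twice the value (m' = m - 1/2); gives the order ⋯ < 1' < 1 < 2' < 2 < ⋯
key : PL → ℕ
key (m , false) = 2 * m
key (m , true) = 2 * m ∸ 1

_<ᴾ_ : PL → PL → Set
p <ᴾ q = key p < key q

_>ᴾ_ : PL → PL → Set
p >ᴾ q = key q < key p

StrictlyDecreasing StrictlyIncreasing : List PL → Set
StrictlyDecreasing = Linked _>ᴾ_
StrictlyIncreasing = Linked _<ᴾ_

MarkedOK : List ℕ → List PL → Set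
MarkedOK z [] = ⊤
MarkedOK z (p ∷ ps) =
  (primed p ≡ true →
     InCyc z (applyLR (map ceil ps) (ceil p)) (applyLR (map ceil ps) (suc (ceil p))))
  × MarkedOK z ps

InRO : List ℕ → List PL → Set
InRO z i = IsAtomWord z (map ceil i) × MarkedOK z i

-- Factorizations: lists of factors (factor i is the i-th entry, 1-indexed)

Elem : Set
Elem = List (List PL)

RF : ℕ → List ℕ → Elem → Set
RF n z a = length a ≡ n × All StrictlyDecreasing a × InRO z (concat a)

wt : Elem → List ℕ
wt = map length

BoundedFrom : ℕ → Elem → Set
BoundedFrom i [] = ⊤
BoundedFrom i (f ∷ fs) = All (λ m → i ≤ ceil m) f × BoundedFrom (suc i) fs

Bounded : Elem → Set
Bounded = BoundedFrom 1

Adj : ℕ → ℕ → Set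
Adj a b = suc a ≡ b ⊎ suc b ≡ a

data OStep : List PL → List PL → Set where
  acb : ∀ p s A B C → ceil A < ceil B → ceil B < ceil C →
        OStep (p ++ A ∷ C ∷ B ∷ s) (p ++ C ∷ A ∷ B ∷ s)
  bca : ∀ p s A B C → ceil A < ceil B → ceil B < ceil C →
        OStep (p ++ B ∷ C ∷ A ∷ s) (p ++ B ∷ A ∷ C ∷ s)
  br1 : ∀ p s a b → Adj a b → OStep (p ++ un a ∷ un b ∷ un a ∷ s) (p ++ un b ∷ un a ∷ un b ∷ s)
  br2 : ∀ p s a b → Adj a b → OStep (p ++ pr a ∷ pr b ∷ pr a ∷ s) (p ++ pr b ∷ pr a ∷ pr b ∷ s)
  br3 : ∀ p s a b → Adj a b → OStep (p ++ pr a ∷ un b ∷ un a ∷ s) (p ++ un b ∷ un a ∷ pr b ∷ s)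
  br4 : ∀ p s a b → Adj a b → OStep (p ++ un a ∷ pr b ∷ un a ∷ s) (p ++ un b ∷ pr a ∷ un b ∷ s)
  br5 : ∀ p s a b → Adj a b → OStep (p ++ pr a ∷ pr b ∷ un a ∷ s) (p ++ un b ∷ pr a ∷ pr b ∷ s)
  br6 : ∀ p s a b → Adj a b → OStep (p ++ pr a ∷ un b ∷ pr a ∷ s) (p ++ pr b ∷ un a ∷ pr b ∷ s)
  st1 : ∀ s a → OStep (un a ∷ s) (pr a ∷ s)
  st2 : ∀ s a b → OStep (un a ∷ un b ∷ s) (un b ∷ un a ∷ s)
  st3 : ∀ s a b → OStep (un a ∷ pr b ∷ s) (un b ∷ pr a ∷ s)
  st4 : ∀ s a b → OStep (pr a ∷ un b ∷ s) (pr b ∷ un a ∷ s)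
  st5 : ∀ s a b → OStep (pr a ∷ pr b ∷ s) (pr b ∷ pr a ∷ s)

_~O_ : List PL → List PL → Set
_~O_ = EqClosure OStep

OReducedRow : List ℕ → List PL → Set
OReducedRow z [] = ⊥
OReducedRow z (t ∷ ts) =
  primed t ≡ false ×
  (StrictlyIncreasing (t ∷ ts) ⊎ StrictlyDecreasing (t ∷ ts)) ×
  InRO z (t ∷ ts)

BRFT : ℕ → List ℕ → List PL → Elem → Set
BRFT n z T a = RF n z a × (concat a ~O T) × Bounded a

-- Crystal operators on raw factorizations (nothing = 𝟎)

at : ℕ → Elem → List PL          -- 0-indexed factor, default empty
at _ [] = []
at zero (x ∷ _) = x
at (suc k) (_ ∷ xs) = at k xs

upd : ℕ → List PL → Elem → Elem
upd _ _ [] = []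
upd zero y (_ ∷ xs) = y ∷ xs
upd (suc k) y (x ∷ xs) = x ∷ upd k y xs

elemℕ : ℕ → List ℕ → Bool
elemℕ m = any (λ c → m ≡ᵇ c)

-- first (= largest, in a decreasing word) b with ⌈b⌉ < c, removed
takeFirst : ℕ → List PL → Maybe (PL × List PL)
takeFirst c [] = nothing
takeFirst c (b ∷ bs) with ceil b <ᵇ c
... | true = just (b , bs)
... | false with takeFirst c bs
...   | nothing = nothing
...   | just (b' , r) = just (b' , b ∷ r)

record Pairing : Set where
  constructor mkP
  field
    pairs : List (PL × PL)
    unpU  : List PL
    unpV  : List PL

pairGo : List PL → List PL → Pairing
pairGo avail [] = mkP [] avail []
pairGo avail (c ∷ cs) with takeFirst (ceil c) avail
... | just (b , avail') with pairGo avail' cs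
...   | mkP ps uu uv = mkP ((b , c) ∷ ps) uu uv
pairGo avail (c ∷ cs) | nothing with pairGo avail cs
...   | mkP ps uu uv = mkP ps uu (c ∷ uv)

pairing : List PL → List PL → Pairing
pairing u v = pairGo u (reverse v)

maxL minL : List PL → Maybe PL
maxL [] = nothing
maxL (x ∷ xs) with maxL xs
... | nothing = just x
... | just y = if key y <ᵇ key x then just x else just y
minL [] = nothing
minL (x ∷ xs) with minL xs
... | nothing = just x
... | just y = if key x <ᵇ key y then just x else just y

gapUpF : ℕ → ℕ → List ℕ → ℕ
gapUpF zero m cs = 0
gapUpF (suc f) m cs = if elemℕ m cs then suc (gapUpF f (suc m) cs) else 0

gapUp : ℕ → List ℕ → ℕ
gapUp m cs = gapUpF (suc (length cs)) m cs

gapDownF : ℕ → ℕ → List ℕ → ℕ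
gapDownF zero m cs = 0
gapDownF (suc f) m cs = if elemℕ m cs then suc (gapDownF f (m ∸ 1) cs) else 0

gapDown : ℕ → List ℕ → ℕ
gapDown m cs = gapDownF (suc (length cs)) m cs

setPrime : ℕ → Bool → List PL → List PL
setPrime m p = map (λ x → if ceil x ≡ᵇ m then (m , p) else x)

swapAll : List (PL × PL) → List PL × List PL → List PL × List PL
swapAll [] uv = uv
swapAll ((b , c) ∷ ps) (u , v) =
  swapAll ps (setPrime (ceil b) (primed c) u , setPrime (ceil c) (primed b) v)

insertDec : PL → List PL → List PL
insertDec x [] = [ x ]
insertDec x (y ∷ ys) = if key y <ᵇ key x then x ∷ y ∷ ys else y ∷ insertDec x ys

removeC : ℕ → List PL → List PL
removeC m = filterᵇ (λ x → not (ceil x ≡ᵇ m))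

eOp : ℕ → Elem → Maybe Elem
eOp i a with pairing (at (i ∸ 1) a) (at i a)
... | mkP ps _ uv₀ with maxL uv₀
...   | nothing = nothing
...   | just x =
  let u   = at (i ∸ 1) a
      v   = at i a
      top = ceil x + gapUp (ceil x) (map ceil u)
      ps' = filterᵇ (λ bc → (ceil x <ᵇ ceil (proj₂ bc)) ∧ (ceil (proj₂ bc) ≤ᵇ top)) ps
      uv  = swapAll ps' (u , v)
  in just (upd (i ∸ 1) (insertDec (top , primed x) (proj₁ uv))
            (upd i (removeC (ceil x) (proj₂ uv)) a))

fOp : ℕ → Elem → Maybe Elem
fOp i a with pairing (at (i ∸ 1) a) (at i a)
... | mkP ps uu₀ _ with minL uu₀
...   | nothing = nothing
...   | just y =
  let u   = at (i ∸ 1) a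
      v   = at i a
      bot = ceil y ∸ gapDown (ceil y) (map ceil v)
      ps' = filterᵇ (λ bc → (bot ≤ᵇ ceil (proj₁ bc)) ∧ (ceil (proj₁ bc) <ᵇ ceil y)) ps
      uv  = swapAll ps' (u , v)
  in just (upd (i ∸ 1) (removeC (ceil y) (proj₁ uv))
            (upd i (insertDec (bot , primed y) (proj₂ uv)) a))

-- e_{1̄}, f_{1̄} (factors are decreasing, so the maximum is the first letter)
eBar1 : Elem → Maybe Elem
eBar1 a with at 0 a | at 1 a
... | _ | [] = nothing
... | [] | y ∷ v' = just (upd 0 [ y ] (upd 1 v' a))
... | x ∷ u' | y ∷ v' =
  if ceil y ≤ᵇ ceil x then nothing
  else just (upd 0 ((ceil y , primed x) ∷ (ceil x , primed y) ∷ u') (upd 1 v' a))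

fBar1-ok : PL → List PL → Bool
fBar1-ok x [] = true
fBar1-ok x (y ∷ _) = ceil y <ᵇ ceil x

fBar1-build : PL → List PL → List PL → Elem → Elem
fBar1-build x [] v a = upd 0 [] (upd 1 (x ∷ v) a)
fBar1-build x (x₂ ∷ u'') v a =
  upd 0 ((ceil x₂ , primed x) ∷ u'') (upd 1 ((ceil x , primed x₂) ∷ v) a)

fBar1-aux : List PL → List PL → Elem → Maybe Elem
fBar1-aux [] v a = nothing
fBar1-aux (x ∷ u') v a = if fBar1-ok x v then just (fBar1-build x u' v a) else nothing

fBar1 : Elem → Maybe Elem
fBar1 a = fBar1-aux (at 0 a) (at 1 a) a

ePrime1 : Elem → Maybe Elem
ePrime1 a with at 0 a
... | [] = nothing
... | (m , true) ∷ u' = just (upd 0 ((m , false) ∷ u') a)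
... | (m , false) ∷ u' = nothing

fPrime1 : Elem → Maybe Elem
fPrime1 a with at 0 a
... | [] = nothing
... | (m , false) ∷ u' = just (upd 0 ((m , true) ∷ u') a)
... | (m , true) ∷ u' = nothing

iterM : ℕ → (Elem → Maybe Elem) → Elem → Maybe Elem
iterM zero f a = just a
iterM (suc k) f a = f a >>= iterM k f

σ : ℕ → Elem → Maybe Elem
σ i a =
  let k = length (at (i ∸ 1) a)
      l = length (at i a)
  in if l ≤ᵇ k then iterM (k ∸ l) (fOp i) a else iterM (l ∸ k) (eOp i) a

_⊙_ : (Elem → Maybe Elem) → (Elem → Maybe Elem) → Elem → Maybe Elem
(g ⊙ f) a = f a >>= g

infixr 9 _⊙_

σWord : List ℕ → Elem → Maybe Elem
σWord [] = just
σWord (j ∷ js) = σ j ⊙ σWord js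

downFrom : ℕ → List ℕ
downFrom zero = []
downFrom (suc j) = suc j ∷ downFrom j

-- the reduced word 1 (2 1) (3 2 1) ⋯ (n-1 ⋯ 1) of w₀ ∈ S_n
w0word : ℕ → List ℕ
w0word zero = []
w0word (suc n) = w0word n ++ downFrom n

eBar fBar : ℕ → Elem → Maybe Elem
eBar zero = λ _ → nothing
eBar (suc zero) = eBar1
eBar (suc (suc k)) = σ (suc k) ⊙ σ (suc (suc k)) ⊙ eBar (suc k) ⊙ σ (suc (suc k)) ⊙ σ (suc k)
fBar zero = λ _ → nothing
fBar (suc zero) = fBar1
fBar (suc (suc k)) = σ (suc k) ⊙ σ (suc (suc k)) ⊙ fBar (suc k) ⊙ σ (suc (suc k)) ⊙ σ (suc k)

eUnder fUnder : ℕ → ℕ → Elem → Maybe Elem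
eUnder n i = σWord (w0word n) ⊙ fBar (n ∸ i) ⊙ σWord (w0word n)
fUnder n i = σWord (w0word n) ⊙ eBar (n ∸ i) ⊙ σWord (w0word n)

ePrime fPrime : ℕ → Elem → Maybe Elem
ePrime zero = λ _ → nothing
ePrime (suc zero) = ePrime1
ePrime (suc (suc k)) = σ (suc k) ⊙ ePrime (suc k) ⊙ σ (suc k)
fPrime zero = λ _ → nothing
fPrime (suc zero) = fPrime1
fPrime (suc (suc k)) = σ (suc k) ⊙ fPrime (suc k) ⊙ σ (suc k)

data Op : Set where
  eI fI eB fB eU fU eP fP : ℕ → Op

ValidOp : ℕ → Op → Set
ValidOp n (eI i) = 1 ≤ i × i < n
ValidOp n (fI i) = 1 ≤ i × i < n
ValidOp n (eB i) = 1 ≤ i × i < n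
ValidOp n (fB i) = 1 ≤ i × i < n
ValidOp n (eU i) = 1 ≤ i × i < n
ValidOp n (fU i) = 1 ≤ i × i < n
ValidOp n (eP i) = 1 ≤ i × i ≤ n
ValidOp n (fP i) = 1 ≤ i × i ≤ n

applyOp : ℕ → Op → Elem → Maybe Elem
applyOp n (eI i) = eOp i
applyOp n (fI i) = fOp i
applyOp n (eB i) = eBar i
applyOp n (fB i) = fBar i
applyOp n (eU i) = eUnder n i
applyOp n (fU i) = fUnder n i
applyOp n (eP i) = ePrime i
applyOp n (fP i) = fPrime i

-- Isomorphism of the restricted q⁺_n-crystal structures on X and Y
-- (an operator applied to an element of X gives 𝟎 if the result leaves X)

record CrystalIso (n : ℕ) (X Y : Elem → Set) : Set where
  field
    φ       : Elem → Elem
    maps    : ∀ b → X b → Y (φ b)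
    inj     : ∀ b c → X b → X c → φ b ≡ φ c → b ≡ c
    surj    : ∀ d → Y d → Σ Elem (λ b → X b × φ b ≡ d)
    wt-pres : ∀ b → X b → wt (φ b) ≡ wt b
    comm→   : ∀ o → ValidOp n o → ∀ b → X b → ∀ c →
              applyOp n o b ≡ just c → X c → applyOp n o (φ b) ≡ just (φ c)
    comm←   : ∀ o → ValidOp n o → ∀ b → X b → ∀ d →
              applyOp n o (φ b) ≡ just d → Y d →
              Σ Elem (λ c → applyOp n o b ≡ just c × X c × φ c ≡ d)

-- Weak compositions as lists (position j ≥ 1 is the (j-1)-th entry; zero beyond)

entry : List ℕ → ℕ → ℕ
entry [] _ = 0
entry (x ∷ xs) zero = 0
entry (x ∷ xs) (suc zero) = x
entry (x ∷ xs) (suc (suc j)) = entry xs (suc j)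

addC : List ℕ → List ℕ → List ℕ
addC [] ys = ys
addC (x ∷ xs) [] = x ∷ xs
addC (x ∷ xs) (y ∷ ys) = x + y ∷ addC xs ys

scaledE : ℕ → ℕ → List ℕ
scaledE c j = replicate (j ∸ 1) 0 ++ [ c ]

insertBy : (ℕ → ℕ → Bool) → ℕ → List ℕ → List ℕ
insertBy le x [] = [ x ]
insertBy le x (y ∷ ys) = if le x y then x ∷ y ∷ ys else y ∷ insertBy le x ys

sortAsc sortDesc : List ℕ → List ℕ
sortAsc = foldr (insertBy _≤ᵇ_) []
sortDesc = foldr (insertBy (λ x y → y ≤ᵇ x)) []

lam : List ℕ → List ℕ
lam = sortDesc

alphaO : List PL → List ℕ
alphaO T with sortAsc (map ceil T)
... | [] = []
... | i₁ ∷ is = addC (scaledE (length T) i₁) (foldr addC [] (map (scaledE 1) is))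

-- u ∈ S_∞ (word us) satisfies α = u λ(α), i.e. α_j = λ_{u⁻¹(j)}
IsPermuteTo : List ℕ → List ℕ → Set
IsPermuteTo α us = ∀ j → 1 ≤ j → entry α j ≡ entry (lam α) (applyLR us j)

-- us is a word of minimal length for u(α) (hence a reduced word of u(α))
IsReducedWordOfU : List ℕ → List ℕ → Set
IsReducedWordOfU α us =
  Word us × IsPermuteTo α us × (∀ vs → Word vs → IsPermuteTo α vs → length us ≤ length vs)

InRothe : List ℕ → ℕ → ℕ → Set
InRothe w i m = Σ ℕ (λ j → i < j × act w j < act w i × act w j ≡ m)

IsWLambda : List ℕ → List ℕ → Set
IsWLambda λ' w = Word w × (∀ i m → InRothe w i m ⇔ (1 ≤ i × 1 ≤ m × m ≤ entry λ' i))

𝔇 : ℕ → List ℕ → ℕ → (Elem → Set) → Elem → Set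
𝔇 n wl i X b = RF n wl b × Σ ℕ (λ k → Σ Elem (λ c → iterM k (eOp i) b ≡ just c × X c))

BRFα : ℕ → List ℕ → List ℕ → Elem → Set
BRFα n wl [] b = RF n wl b × Bounded b
BRFα n wl (i ∷ is) b = 𝔇 n wl i (BRFα n wl is) b

{-# OPTIONS --safe #-}

-- Write K for the length of T and J 1 < ... < J K for its entries. The words
-- orthogonally Coxeter-Knuth equivalent to T are those in which every letter after
-- the first extends an interval of ranks (i has the letter J i) by its upper or
-- lower neighbour; the prime of the first letter is free, and any other letter
-- carries a prime prescribed by the gap that it crosses. Hence an element of RF(T)
-- is a rank word, a factorization and one bit, and no operator looks at J or at the
-- prescribed primes. For J = id these are the factorizations of w_λ, a hook
-- permutation acting as the transposition (1 , K + 1), so that RF(T) ≅ RF(w_λ), and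
-- only boundedness remains. A reduced word of u(α) raises the sum of the images of
-- 1, ..., K by exactly 1 at each letter; accordingly, each Demazure operator 𝔇_i
-- turns "the letter of rank m is in a factor ≤ J′ m" into the same condition with
-- the value i of J′ replaced by i + 1.
module Submission where

open import Defs
open import Data.Bool using (Bool; true; false; if_then_else_; not; _∧_)
open import Data.Empty using (⊥; ⊥-elim)
open import Data.List using (List; []; _∷_; _++_; [_]; _∷ʳ_; map; length; reverse; concat; filterᵇ; foldr; foldl; replicate; applyUpTo)
open import Data.List.Membership.DecPropositional using (_∈?_)
open import Data.List.Membership.Propositional using (_∈_; _∉_; find; lose)
open import Data.List.Membership.Propositional.Properties using (∈-++⁺ˡ; ∈-++⁺ʳ; ∈-++⁻; ∈-map⁺; ∈-map⁻; ∈-∃++; ∈-applyUpTo⁺)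
open import Data.List.Properties using (++-assoc; ++-identityʳ; map-++; map-∘; map-cong; map-cong-local; map-id; map-id-local; length-++; length-map; length-reverse; reverse-++; reverse-map; reverse-involutive; unfold-reverse; applyUpTo-∷ʳ; map-applyUpTo; length-applyUpTo; ∷-injective; concat-map; concat-++)
open import Data.List.Relation.Binary.Permutation.Propositional as ↭ using (_↭_; ↭-refl; ↭-sym; ↭-trans; ↭-prep; ↭-reflexive; ↭⇒↭ₛ)
open import Data.List.Relation.Binary.Permutation.Propositional.Properties as ↭P using (shift; ↭-length; ∈-resp-↭; All-resp-↭; drop-∷)
import Data.List.Relation.Binary.Permutation.Setoid.Properties as ↭S
open import Data.List.Relation.Unary.All as All using (All; []; _∷_)
open import Data.List.Relation.Unary.All.Properties as AllP using (map⁺; map⁻; ++⁺; ++⁻; ++⁻ˡ; ++⁻ʳ; ∷ʳ⁺; ∷ʳ⁻)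
open import Data.List.Relation.Unary.AllPairs using (AllPairs; []; _∷_)
import Data.List.Relation.Unary.AllPairs.Properties as AllPairsP
open import Data.List.Relation.Unary.Any using (here; there; any?)
open import Data.List.Relation.Unary.Any.Properties using (reverse⁺)
open import Data.List.Relation.Unary.Linked using (Linked; []; [-]; _∷_)
open import Data.List.Relation.Unary.Linked.Properties using (Linked⇒AllPairs)
open import Data.List.Relation.Unary.Unique.Propositional using (Unique)
import Data.List.Relation.Unary.Unique.Propositional.Properties as UniqueP
open import Data.List.Reverse using ([]; _∶_∶ʳ_; reverseView)
open import Data.Maybe using (Maybe; just; nothing; _>>=_)
open import Data.Maybe.Properties using (just-injective)
open import Data.Nat using (ℕ; zero; suc; pred; _+_; _*_; _∸_; _≤_; _<_; _>_; _≡ᵇ_; _<ᵇ_; _≤ᵇ_; _⊔_; _⊓_; z≤n; s≤s; s≤s⁻¹; _≟_; _<?_; _≤?_; >-nonZero)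
open import Data.Nat.ListAction using (sum)
open import Data.Nat.ListAction.Properties using (sum-↭; sum-++)
open import Data.Nat.Properties
open import Data.Nat.Tactic.RingSolver using (solve-∀)
open import Data.Product using (Σ; ∃-syntax; _×_; _,_; proj₁; proj₂)
open import Data.Sum using (_⊎_; inj₁; inj₂)
open import Data.Unit using (⊤; tt)
open import Function using (_∘_; id; _⇔_; Equivalence; mk⇔)
open import Relation.Binary.Construct.Closure.Equivalence as Eq using ()
open import Relation.Binary.Construct.Closure.ReflexiveTransitive using (ε; _◅_; _◅◅_)
open import Relation.Binary.Construct.Closure.Symmetric using (fwd; bwd)
open import Relation.Binary.Definitions using (Tri; tri<; tri≈; tri>)
open import Relation.Binary.PropositionalEquality using (_≡_; _≢_; _≗_; refl; sym; trans; cong; cong₂; subst; subst₂; setoid; module ≡-Reasoning)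
open import Relation.Nullary as Nullary using (¬_; yes; no; contradiction)
open import Relation.Nullary.Decidable using (_×-dec_)

-- Why the operators are blind to `J` and to the primes: after a nonempty interval has been read, a
-- decreasing factor can use the upper neighbour at most once, for its first letter. So two
-- consecutive factors have at most one pair, and since letters never repeat, `eOp` and `fOp` swap
-- no primes. The barred operators do swap primes, but the swap only says that the gap between the
-- first two letters keeps its prime when the start moves across it. A gap may carry a prime only if
-- its entries differ by at least 2: if J g + 1 = J (g + 1), then z fixes J (g + 1), and no marked
-- pair can contain it. The two sides need opposite arguments. For T, the equivalence supplies the
-- class, and its words must be shown admissible for z. For w_λ no equivalence is given: every
-- admissible word must be recovered from its Demazure product. All of 1, ..., K occur in it,
-- minimality allows no further letter, and a letter read after both its neighbours would leave a
-- descent that the transposition does not have.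

≡ᵇ-true : ∀ n → (n ≡ᵇ n) ≡ true
≡ᵇ-true zero = refl
≡ᵇ-true (suc n) = ≡ᵇ-true n

≡ᵇ-false : ∀ {m n} → m ≢ n → (m ≡ᵇ n) ≡ false
≡ᵇ-false {zero} {zero} m≢n = contradiction refl m≢n
≡ᵇ-false {zero} {suc n} _ = refl
≡ᵇ-false {suc m} {zero} _ = refl
≡ᵇ-false {suc m} {suc n} m≢n = ≡ᵇ-false (m≢n ∘ cong suc)

<ᵇ-true : ∀ {m n} → m < n → (m <ᵇ n) ≡ true
<ᵇ-true {zero} (s≤s _) = refl
<ᵇ-true {suc m} (s≤s m<n) = <ᵇ-true m<n

<ᵇ-false : ∀ {m n} → n ≤ m → (m <ᵇ n) ≡ false
<ᵇ-false {_} {zero} z≤n = refl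
<ᵇ-false {suc m} {suc n} (s≤s n≤m) = <ᵇ-false n≤m

≤ᵇ-true : ∀ {m n} → m ≤ n → (m ≤ᵇ n) ≡ true
≤ᵇ-true {zero} _ = refl
≤ᵇ-true {suc m} m<n = <ᵇ-true m<n

≤ᵇ-false : ∀ {m n} → n < m → (m ≤ᵇ n) ≡ false
≤ᵇ-false {suc m} (s≤s n≤m) = <ᵇ-false n≤m

-- Adjacent transpositions and the permutations given by words.

data SwView (i : ℕ) : ℕ → Set where
  at₀ : SwView i i
  at₁ : SwView i (suc i)
  off : ∀ {x} → x ≢ i → x ≢ suc i → SwView i x

swView : ∀ i x → SwView i x
swView i x with x ≟ i | x ≟ suc i
... | yes refl | _ = at₀
... | no _ | yes refl = at₁
... | no p | no q = off p q

sw-at₀ : ∀ i → sw i i ≡ suc i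
sw-at₀ i rewrite ≡ᵇ-true i = refl

sw-at₁ : ∀ i → sw i (suc i) ≡ i
sw-at₁ i rewrite ≡ᵇ-false {suc i} {i} (λ e → 1+n≢n e) | ≡ᵇ-true i = refl

sw-off : ∀ {i x} → x ≢ i → x ≢ suc i → sw i x ≡ x
sw-off p q rewrite ≡ᵇ-false p | ≡ᵇ-false q = refl

sw-below : ∀ {i x} → x < i → sw i x ≡ x
sw-below x<i = sw-off (<⇒≢ x<i) (<⇒≢ (m<n⇒m<1+n x<i))

sw-above : ∀ {i x} → suc i < x → sw i x ≡ x
sw-above i<x = sw-off (>⇒≢ (<-trans (n<1+n _) i<x)) (>⇒≢ i<x)

sw-invol : ∀ i x → sw i (sw i x) ≡ x
sw-invol i x with swView i x
... | at₀ rewrite sw-at₀ i = sw-at₁ i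
... | at₁ rewrite sw-at₁ i = sw-at₀ i
... | off p q rewrite sw-off p q = sw-off p q

sw-inj : ∀ i {x y} → sw i x ≡ sw i y → x ≡ y
sw-inj i {x} {y} e = trans (sym (sw-invol i x)) (trans (cong (sw i) e) (sw-invol i y))

sw-preserves-≤ : ∀ {i j x} → j ≢ i → x ≤ i → sw j x ≤ i
sw-preserves-≤ {i} {j} {x} j≢i x≤i with swView j x
... | at₀ rewrite sw-at₀ j = ≤∧≢⇒< x≤i j≢i
... | at₁ rewrite sw-at₁ j = <⇒≤ x≤i
... | off p q rewrite sw-off p q = x≤i

sw-comm : ∀ {i j} x → suc i < j → sw i (sw j x) ≡ sw j (sw i x)
sw-comm {i} {j} x si<j with swView i x
... | at₀ rewrite sw-at₀ i | sw-below {j} {i} (<-trans (n<1+n i) si<j) | sw-at₀ i | sw-below si<j = refl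
... | at₁ rewrite sw-at₁ i | sw-below si<j | sw-at₁ i | sw-below {j} {i} (<-trans (n<1+n i) si<j) = refl
... | off p q rewrite sw-off p q with swView j x
...   | at₀ rewrite sw-at₀ j = sw-above (m<n⇒m<1+n si<j)
...   | at₁ rewrite sw-at₁ j = sw-above si<j
...   | off p′ q′ rewrite sw-off p′ q′ = sw-off p q

act-++ : ∀ u v x → act (u ++ v) x ≡ act u (act v x)
act-++ [] v x = refl
act-++ (i ∷ u) v x = cong (sw i) (act-++ u v x)

act-inj : ∀ w {x y} → act w x ≡ act w y → x ≡ y
act-inj [] e = e
act-inj (i ∷ w) e = act-inj w (sw-inj i e)

applyLR-++ : ∀ u v x → applyLR (u ++ v) x ≡ applyLR v (applyLR u x)
applyLR-++ [] v x = refl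
applyLR-++ (i ∷ u) v x = applyLR-++ u v (sw i x)

act-applyLR : ∀ w x → act w (applyLR w x) ≡ x
act-applyLR [] x = refl
act-applyLR (i ∷ w) x = trans (cong (sw i) (act-applyLR w (sw i x))) (sw-invol i x)

act-preserves-≤ : ∀ {i w x} → i ∉ w → x ≤ i → act w x ≤ i
act-preserves-≤ {w = []} _ x≤i = x≤i
act-preserves-≤ {w = j ∷ w} i∉ x≤i =
  sw-preserves-≤ (λ e → i∉ (here (sym e))) (act-preserves-≤ (i∉ ∘ there) x≤i)

applyLR-preserves-≤ : ∀ {i w x} → i ∉ w → x ≤ i → applyLR w x ≤ i
applyLR-preserves-≤ {w = []} _ x≤i = x≤i
applyLR-preserves-≤ {w = j ∷ w} i∉ x≤i =
  applyLR-preserves-≤ (i∉ ∘ there) (sw-preserves-≤ (λ e → i∉ (here (sym e))) x≤i)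

applyLR-fixes : ∀ {w x} → All (λ j → x ≢ j × x ≢ suc j) w → applyLR w x ≡ x
applyLR-fixes [] = refl
applyLR-fixes {j ∷ w} {x} ((p , q) ∷ a) = trans (cong (applyLR w) (sw-off p q)) (applyLR-fixes a)

-- The Demazure product in one-line notation.

-- A permutation in one-line notation g, followed by a Demazure step on the
-- right: the entries in positions i and i + 1 get sorted decreasingly.
infixl 6 _▹_
_▹_ : (ℕ → ℕ) → ℕ → ℕ → ℕ
(g ▹ i) x = if g i <ᵇ g (suc i) then g (sw i x) else g x

▹-asc : ∀ g i x → g i < g (suc i) → (g ▹ i) x ≡ g (sw i x)
▹-asc g i x lt rewrite <ᵇ-true lt = refl

▹-desc : ∀ g i x → g (suc i) ≤ g i → (g ▹ i) x ≡ g x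
▹-desc g i x le rewrite <ᵇ-false le = refl

▹-at₀ : ∀ g i → (g ▹ i) i ≡ g i ⊔ g (suc i)
▹-at₀ g i with g i <? g (suc i)
... | yes lt = trans (▹-asc g i i lt) (trans (cong g (sw-at₀ i)) (sym (m≤n⇒m⊔n≡n (<⇒≤ lt))))
... | no ge = trans (▹-desc g i i (≮⇒≥ ge)) (sym (m≥n⇒m⊔n≡m (≮⇒≥ ge)))

▹-at₁ : ∀ g i → (g ▹ i) (suc i) ≡ g i ⊓ g (suc i)
▹-at₁ g i with g i <? g (suc i)
... | yes lt = trans (▹-asc g i (suc i) lt) (trans (cong g (sw-at₁ i)) (sym (m≤n⇒m⊓n≡m (<⇒≤ lt))))
... | no ge = trans (▹-desc g i (suc i) (≮⇒≥ ge)) (sym (m≥n⇒m⊓n≡n (≮⇒≥ ge)))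

▹-off : ∀ g i {x} → x ≢ i → x ≢ suc i → (g ▹ i) x ≡ g x
▹-off g i {x} p q with g i <ᵇ g (suc i)
... | true = cong g (sw-off p q)
... | false = refl

▹-below : ∀ g i {x} → x < i → (g ▹ i) x ≡ g x
▹-below g i x<i = ▹-off g i (<⇒≢ x<i) (<⇒≢ (m<n⇒m<1+n x<i))

▹-above : ∀ g i {x} → suc i < x → (g ▹ i) x ≡ g x
▹-above g i i<x = ▹-off g i (>⇒≢ (<-trans (n<1+n i) i<x)) (>⇒≢ i<x)

▹-cong : ∀ {g h} i → g ≗ h → (g ▹ i) ≗ (h ▹ i)
▹-cong {g} {h} i e x rewrite e i | e (suc i) with h i <ᵇ h (suc i)
... | true = e (sw i x)
... | false = e x

▹-decreases : ∀ g i → (g ▹ i) (suc i) ≤ (g ▹ i) i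
▹-decreases g i rewrite ▹-at₀ g i | ▹-at₁ g i = m⊓n≤m⊔n (g i) (g (suc i))

▹-idem : ∀ g i → (g ▹ i ▹ i) ≗ (g ▹ i)
▹-idem g i x = ▹-desc (g ▹ i) i x (▹-decreases g i)

▹-agree : ∀ g h i → g i ≡ h i → g (suc i) ≡ h (suc i) → (g ▹ i) i ≡ (h ▹ i) i × (g ▹ i) (suc i) ≡ (h ▹ i) (suc i)
▹-agree g h i e₀ e₁ =
  trans (▹-at₀ g i) (trans (cong₂ _⊔_ e₀ e₁) (sym (▹-at₀ h i))) ,
  trans (▹-at₁ g i) (trans (cong₂ _⊓_ e₀ e₁) (sym (▹-at₁ h i)))

▹-comm : ∀ g {i j} → suc i < j → (g ▹ i ▹ j) ≗ (g ▹ j ▹ i)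
▹-comm g {i} {j} si<j x with swView i x | swView j x
... | at₀ | _ = trans (▹-below (g ▹ i) j i<j) (proj₁ (▹-agree g (g ▹ j) i (sym (▹-below g j i<j)) (sym (▹-below g j si<j))))
  where i<j = <-trans (n<1+n i) si<j
... | at₁ | _ = trans (▹-below (g ▹ i) j si<j) (proj₂ (▹-agree g (g ▹ j) i (sym (▹-below g j i<j)) (sym (▹-below g j si<j))))
  where i<j = <-trans (n<1+n i) si<j
... | off p q | at₀ = trans (proj₁ (▹-agree (g ▹ i) g j (▹-above g i si<j) (▹-above g i (m<n⇒m<1+n si<j)))) (sym (▹-above (g ▹ j) i si<j))
... | off p q | at₁ = trans (proj₂ (▹-agree (g ▹ i) g j (▹-above g i si<j) (▹-above g i (m<n⇒m<1+n si<j)))) (sym (▹-above (g ▹ j) i (m<n⇒m<1+n si<j)))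
... | off p q | off p′ q′ =
  trans (▹-off (g ▹ i) j p′ q′) (trans (▹-off g i p q) (sym (trans (▹-off (g ▹ j) i p q) (▹-off g j p′ q′))))

-- Both sides sort three consecutive entries decreasingly. In the middle position they give two
-- expressions for the median, which agree by distributivity of maximum and minimum.
▹-braid : ∀ g a → (g ▹ a ▹ suc a ▹ a) ≗ (g ▹ suc a ▹ a ▹ suc a)
▹-braid g a x with swView a x | swView (suc a) x
... | at₀ | _ = begin
  (g ▹ a ▹ suc a ▹ a) a                        ≡⟨ ▹-at₀ (g ▹ a ▹ suc a) a ⟩
  (g ▹ a ▹ suc a) a ⊔ (g ▹ a ▹ suc a) (suc a)  ≡⟨ cong₂ _⊔_ (trans (▹-below (g ▹ a) (suc a) (n<1+n a)) (▹-at₀ g a)) (trans (▹-at₀ (g ▹ a) (suc a)) (cong₂ _⊔_ (▹-at₁ g a) (▹-above g a (n<1+n (suc a))))) ⟩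
  (A ⊔ B) ⊔ ((A ⊓ B) ⊔ C)                      ≡⟨ ⊔-assoc (A ⊔ B) (A ⊓ B) C ⟨
  ((A ⊔ B) ⊔ (A ⊓ B)) ⊔ C                      ≡⟨ cong (_⊔ C) (m≥n⇒m⊔n≡m (m⊓n≤m⊔n A B)) ⟩
  (A ⊔ B) ⊔ C                                  ≡⟨ ⊔-assoc A B C ⟩
  A ⊔ (B ⊔ C)                                  ≡⟨ cong₂ _⊔_ (▹-below g (suc a) (n<1+n a)) (▹-at₀ g (suc a)) ⟨
  (g ▹ suc a) a ⊔ (g ▹ suc a) (suc a)          ≡⟨ ▹-at₀ (g ▹ suc a) a ⟨
  (g ▹ suc a ▹ a) a                            ≡⟨ ▹-below (g ▹ suc a ▹ a) (suc a) (n<1+n a) ⟨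
  (g ▹ suc a ▹ a ▹ suc a) a                    ∎
  where open ≡-Reasoning
        A = g a
        B = g (suc a)
        C = g (suc (suc a))
... | at₁ | _ = begin
  (g ▹ a ▹ suc a ▹ a) (suc a)                  ≡⟨ ▹-at₁ (g ▹ a ▹ suc a) a ⟩
  (g ▹ a ▹ suc a) a ⊓ (g ▹ a ▹ suc a) (suc a)  ≡⟨ cong₂ _⊓_ (trans (▹-below (g ▹ a) (suc a) (n<1+n a)) (▹-at₀ g a)) (trans (▹-at₀ (g ▹ a) (suc a)) (cong₂ _⊔_ (▹-at₁ g a) (▹-above g a (n<1+n (suc a))))) ⟩
  (A ⊔ B) ⊓ ((A ⊓ B) ⊔ C)                      ≡⟨ ⊓-distribˡ-⊔ (A ⊔ B) (A ⊓ B) C ⟩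
  ((A ⊔ B) ⊓ (A ⊓ B)) ⊔ ((A ⊔ B) ⊓ C)          ≡⟨ cong₂ _⊔_ (m≥n⇒m⊓n≡n (m⊓n≤m⊔n A B)) (⊓-distribʳ-⊔ C A B) ⟩
  (A ⊓ B) ⊔ ((A ⊓ C) ⊔ (B ⊓ C))                ≡⟨ ⊔-assoc (A ⊓ B) (A ⊓ C) (B ⊓ C) ⟨
  ((A ⊓ B) ⊔ (A ⊓ C)) ⊔ (B ⊓ C)                ≡⟨ cong (_⊔ (B ⊓ C)) (⊓-distribˡ-⊔ A B C) ⟨
  (A ⊓ (B ⊔ C)) ⊔ (B ⊓ C)                      ≡⟨ cong₂ _⊔_ (trans (▹-at₁ (g ▹ suc a) a) (cong₂ _⊓_ (▹-below g (suc a) (n<1+n a)) (▹-at₀ g (suc a)))) (trans (▹-above (g ▹ suc a) a (n<1+n (suc a))) (▹-at₁ g (suc a))) ⟨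
  (g ▹ suc a ▹ a) (suc a) ⊔ (g ▹ suc a ▹ a) (suc (suc a)) ≡⟨ ▹-at₀ (g ▹ suc a ▹ a) (suc a) ⟨
  (g ▹ suc a ▹ a ▹ suc a) (suc a)              ∎
  where open ≡-Reasoning
        A = g a
        B = g (suc a)
        C = g (suc (suc a))
... | off p q | at₀ = contradiction refl q
... | off p q | at₁ = begin
  (g ▹ a ▹ suc a ▹ a) (suc (suc a))            ≡⟨ ▹-off (g ▹ a ▹ suc a) a p q ⟩
  (g ▹ a ▹ suc a) (suc (suc a))                ≡⟨ ▹-at₁ (g ▹ a) (suc a) ⟩
  (g ▹ a) (suc a) ⊓ (g ▹ a) (suc (suc a))      ≡⟨ cong₂ _⊓_ (▹-at₁ g a) (▹-off g a p q) ⟩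
  (A ⊓ B) ⊓ C                                  ≡⟨ ⊓-assoc A B C ⟩
  A ⊓ (B ⊓ C)                                  ≡⟨ cong (A ⊓_) (m≥n⇒m⊓n≡n (m⊓n≤m⊔n B C)) ⟨
  A ⊓ ((B ⊔ C) ⊓ (B ⊓ C))                      ≡⟨ ⊓-assoc A (B ⊔ C) (B ⊓ C) ⟨
  (A ⊓ (B ⊔ C)) ⊓ (B ⊓ C)                      ≡⟨ cong₂ _⊓_ (trans (▹-at₁ (g ▹ suc a) a) (cong₂ _⊓_ (▹-below g (suc a) (n<1+n a)) (▹-at₀ g (suc a)))) (trans (▹-off (g ▹ suc a) a p q) (▹-at₁ g (suc a))) ⟨
  (g ▹ suc a ▹ a) (suc a) ⊓ (g ▹ suc a ▹ a) (suc (suc a)) ≡⟨ ▹-at₁ (g ▹ suc a ▹ a) (suc a) ⟨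
  (g ▹ suc a ▹ a ▹ suc a) (suc (suc a))        ∎
  where open ≡-Reasoning
        A = g a
        B = g (suc a)
        C = g (suc (suc a))
... | off p q | off p′ q′ = begin
  (g ▹ a ▹ suc a ▹ a) x  ≡⟨ ▹-off (g ▹ a ▹ suc a) a p q ⟩
  (g ▹ a ▹ suc a) x      ≡⟨ ▹-off (g ▹ a) (suc a) p′ q′ ⟩
  (g ▹ a) x              ≡⟨ ▹-off g a p q ⟩
  g x                    ≡⟨ ▹-off g (suc a) p′ q′ ⟨
  (g ▹ suc a) x          ≡⟨ ▹-off (g ▹ suc a) a p q ⟨
  (g ▹ suc a ▹ a) x      ≡⟨ ▹-off (g ▹ suc a ▹ a) (suc a) p′ q′ ⟨
  (g ▹ suc a ▹ a ▹ suc a) x ∎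
  where open ≡-Reasoning

infixl 6 _▹▹_
_▹▹_ : (ℕ → ℕ) → List ℕ → ℕ → ℕ
g ▹▹ [] = g
g ▹▹ (i ∷ w) = (g ▹ i) ▹▹ w

▹▹-cong : ∀ {g h} w → g ≗ h → (g ▹▹ w) ≗ (h ▹▹ w)
▹▹-cong [] e = e
▹▹-cong (i ∷ w) e = ▹▹-cong w (▹-cong i e)

▹▹-++ : ∀ g u v → g ▹▹ (u ++ v) ≡ g ▹▹ u ▹▹ v
▹▹-++ g [] v = refl
▹▹-++ g (i ∷ u) v = ▹▹-++ (g ▹ i) u v

▹▹-preserves-≤ : ∀ {g i w x} → i ∉ w → (∀ {y} → y ≤ i → g y ≤ i) → x ≤ i → (g ▹▹ w) x ≤ i
▹▹-preserves-≤ {w = []} _ G x≤i = G x≤i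
▹▹-preserves-≤ {g} {i} {j ∷ w} i∉ G = ▹▹-preserves-≤ {w = w} (i∉ ∘ there) G′
  where
  G′ : ∀ {y} → y ≤ i → (g ▹ j) y ≤ i
  G′ {y} y≤i with g j <ᵇ g (suc j)
  ... | true = G (sw-preserves-≤ (λ e → i∉ (here (sym e))) y≤i)
  ... | false = G y≤i

▹▹-fixes : ∀ {g w x} → All (λ j → x ≢ j × x ≢ suc j) w → (g ▹▹ w) x ≡ g x
▹▹-fixes [] = refl
▹▹-fixes {g} {j ∷ w} ((p , q) ∷ a) = trans (▹▹-fixes a) (▹-off g j p q)

-- Only the letters i - 1 and i + 1 touch exactly one of the positions i and i + 1; the letter i
-- itself can only create a descent there.
▹▹-descent : ∀ {g i w} → All (λ j → i ≢ suc j × suc i ≢ j) w → g (suc i) ≤ g i →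
  (g ▹▹ w) (suc i) ≤ (g ▹▹ w) i
▹▹-descent [] d = d
▹▹-descent {g} {i} {j ∷ w} ((p , q) ∷ a) d = ▹▹-descent a d′
  where
  d′ : (g ▹ j) (suc i) ≤ (g ▹ j) i
  d′ with i ≟ j
  ... | yes refl = ▹-decreases g i
  ... | no i≢j = subst₂ _≤_ (sym (▹-off g j q (i≢j ∘ suc-injective))) (sym (▹-off g j i≢j p)) d

-- The step of `demazure` is local to its definition and has no name here. Quantifying over every
-- `f` with the same defining equation lets unification supply it.
foldl-demazure : ∀ (f : List ℕ → ℕ → List ℕ) →
  (∀ acc i → f acc i ≡ (if act acc i <ᵇ act acc (suc i) then acc ++ [ i ] else acc)) →
  ∀ acc w → act (foldl f acc w) ≗ (act acc ▹▹ w)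
foldl-demazure f hf acc [] x = refl
foldl-demazure f hf acc (i ∷ w) x =
  trans (foldl-demazure f hf (f acc i) w x) (▹▹-cong w step x)
  where
  step : act (f acc i) ≗ (act acc ▹ i)
  step y rewrite hf acc i with act acc i <ᵇ act acc (suc i)
  ... | true = act-++ acc [ i ] y
  ... | false = refl

act-demazure : ∀ w → act (demazure w) ≗ (id ▹▹ w)
act-demazure = foldl-demazure _ (λ _ _ → refl) []

-- The involution of a word, computed along the palindrome `reverse w ++ w`.

w⁻¹∘w : List ℕ → ℕ → ℕ
w⁻¹∘w w = id ▹▹ (reverse w ++ w)

Commuting : ℕ → ℕ → Set
Commuting a b = suc a < b ⊎ suc b < a

▹▹-comm : ∀ g u v {a b} → Commuting a b → (g ▹▹ (u ++ a ∷ b ∷ v)) ≗ (g ▹▹ (u ++ b ∷ a ∷ v))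
▹▹-comm g [] v (inj₁ lt) = ▹▹-cong v (▹-comm g lt)
▹▹-comm g [] v (inj₂ lt) x = sym (▹▹-cong v (▹-comm g lt) x)
▹▹-comm g (i ∷ u) v c = ▹▹-comm (g ▹ i) u v c

reverse-swap : ∀ {A : Set} (p s : List A) a b → reverse (p ++ a ∷ b ∷ s) ≡ reverse s ++ b ∷ a ∷ reverse p
reverse-swap p s a b = begin
  reverse (p ++ a ∷ b ∷ s)                    ≡⟨ reverse-++ p (a ∷ b ∷ s) ⟩
  reverse (a ∷ b ∷ s) ++ reverse p            ≡⟨ cong (_++ reverse p) (reverse-++ (a ∷ b ∷ []) s) ⟩
  (reverse s ++ b ∷ a ∷ []) ++ reverse p      ≡⟨ ++-assoc (reverse s) (b ∷ a ∷ []) (reverse p) ⟩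
  reverse s ++ b ∷ a ∷ reverse p              ∎
  where open ≡-Reasoning

w⁻¹∘w-comm : ∀ p s {a b} → Commuting a b → w⁻¹∘w (p ++ a ∷ b ∷ s) ≗ w⁻¹∘w (p ++ b ∷ a ∷ s)
w⁻¹∘w-comm p s {a} {b} c x = begin
  (id ▹▹ (reverse (p ++ a ∷ b ∷ s) ++ p ++ a ∷ b ∷ s)) x
    ≡⟨ cong (λ l → (id ▹▹ l) x) (trans (cong (_++ p ++ a ∷ b ∷ s) (reverse-swap p s a b)) (++-assoc (reverse s) _ _)) ⟩
  (id ▹▹ (reverse s ++ b ∷ a ∷ reverse p ++ p ++ a ∷ b ∷ s)) x
    ≡⟨ ▹▹-comm id (reverse s) _ c x ⟨
  (id ▹▹ (reverse s ++ a ∷ b ∷ reverse p ++ p ++ a ∷ b ∷ s)) x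
    ≡⟨ cong (λ l → (id ▹▹ l) x) (trans (sym (++-assoc (reverse s) _ _)) (trans (cong (_++ p ++ a ∷ b ∷ s) (sym (reverse-swap p s b a))) (sym (++-assoc (reverse (p ++ b ∷ a ∷ s)) p _)))) ⟩
  (id ▹▹ ((reverse (p ++ b ∷ a ∷ s) ++ p) ++ a ∷ b ∷ s)) x
    ≡⟨ ▹▹-comm id (reverse (p ++ b ∷ a ∷ s) ++ p) s c x ⟩
  (id ▹▹ ((reverse (p ++ b ∷ a ∷ s) ++ p) ++ b ∷ a ∷ s)) x
    ≡⟨ cong (λ l → (id ▹▹ l) x) (++-assoc (reverse (p ++ b ∷ a ∷ s)) p _) ⟩
  (id ▹▹ (reverse (p ++ b ∷ a ∷ s) ++ p ++ b ∷ a ∷ s)) x ∎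
  where open ≡-Reasoning

-- The first two letters of a word form the centre of its palindrome. Idempotence shortens the
-- centre to b a b, so that even neighbouring letters may be exchanged, by the braid relation.
▹-baab : ∀ g {a b} → a < b → (g ▹ b ▹ a ▹ a ▹ b) ≗ (g ▹ a ▹ b ▹ b ▹ a)
▹-baab g {a} {b} a<b x with suc a ≟ b
... | yes refl = begin
  (g ▹ b ▹ a ▹ a ▹ b) x  ≡⟨ ▹-cong b (▹-idem (g ▹ b) a) x ⟩
  (g ▹ b ▹ a ▹ b) x      ≡⟨ ▹-braid g a x ⟨
  (g ▹ a ▹ b ▹ a) x      ≡⟨ ▹-cong a (▹-idem (g ▹ a) b) x ⟨
  (g ▹ a ▹ b ▹ b ▹ a) x  ∎
  where open ≡-Reasoning
... | no sa≢b = begin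
  (g ▹ b ▹ a ▹ a ▹ b) x  ≡⟨ ▹-comm (g ▹ b ▹ a) lt x ⟩
  (g ▹ b ▹ a ▹ b ▹ a) x  ≡⟨ ▹-cong a (▹-cong b (▹-comm g lt)) x ⟨
  (g ▹ a ▹ b ▹ b ▹ a) x  ∎
  where open ≡-Reasoning
        lt = ≤∧≢⇒< a<b sa≢b

w⁻¹∘w-first : ∀ s {a b} → a < b → w⁻¹∘w (a ∷ b ∷ s) ≗ w⁻¹∘w (b ∷ a ∷ s)
w⁻¹∘w-first s {a} {b} a<b x = begin
  (id ▹▹ (reverse (a ∷ b ∷ s) ++ a ∷ b ∷ s)) x
    ≡⟨ cong (λ f → f x) (expand a b) ⟩
  ((g ▹ b ▹ a ▹ a ▹ b) ▹▹ s) x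
    ≡⟨ ▹▹-cong s (▹-baab g a<b) x ⟩
  ((g ▹ a ▹ b ▹ b ▹ a) ▹▹ s) x
    ≡⟨ cong (λ f → f x) (expand b a) ⟨
  (id ▹▹ (reverse (b ∷ a ∷ s) ++ b ∷ a ∷ s)) x ∎
  where
  open ≡-Reasoning
  g = id ▹▹ reverse s
  expand : ∀ a b → id ▹▹ (reverse (a ∷ b ∷ s) ++ a ∷ b ∷ s) ≡ (g ▹ b ▹ a ▹ a ▹ b) ▹▹ s
  expand a b = trans (cong (λ l → id ▹▹ (l ++ a ∷ b ∷ s)) (reverse-swap [] s a b))
    (trans (cong (id ▹▹_) (++-assoc (reverse s) (b ∷ a ∷ []) (a ∷ b ∷ s)))
           (▹▹-++ id (reverse s) (b ∷ a ∷ a ∷ b ∷ s)))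

w⁻¹∘w-∷ʳ : ∀ w c → w⁻¹∘w (w ∷ʳ c) ≡ (id ▹ c ▹▹ (reverse w ++ w)) ▹ c
w⁻¹∘w-∷ʳ w c = begin
  id ▹▹ (reverse (w ∷ʳ c) ++ w ∷ʳ c)     ≡⟨ cong (λ l → id ▹▹ (l ++ w ∷ʳ c)) (reverse-++ w [ c ]) ⟩
  id ▹ c ▹▹ (reverse w ++ w ∷ʳ c)        ≡⟨ cong (id ▹ c ▹▹_) (++-assoc (reverse w) w [ c ]) ⟨
  id ▹ c ▹▹ ((reverse w ++ w) ∷ʳ c)      ≡⟨ ▹▹-++ (id ▹ c) (reverse w ++ w) [ c ] ⟩
  (id ▹ c ▹▹ (reverse w ++ w)) ▹ c       ∎
  where open ≡-Reasoning

sw-mono-below : ∀ {c u v} → u < v → v ≤ c → sw c u < sw c v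
sw-mono-below {c} {u} {v} u<v v≤c with swView c v
... | at₀ rewrite sw-at₀ c | sw-below u<v = m<n⇒m<1+n u<v
... | at₁ = contradiction v≤c 1+n≰n
... | off p q rewrite sw-off p q | sw-below (<-≤-trans u<v v≤c) = u<v

-- The steps along w compare only values at most c, and `sw c` respects the order of these. So
-- multiplication by s_c on the left passes through the whole word.
▹▹-conj : ∀ {c g} w → All (_< c) w → (∀ {y} → y ≤ c → g y ≤ c) →
  ((sw c ∘ g) ▹▹ w) ≗ (sw c ∘ (g ▹▹ w))
▹▹-conj [] _ _ x = refl
▹▹-conj {c} {g} (j ∷ w) (j<c ∷ a) G x =
  trans (▹▹-cong w step x) (▹▹-conj w a G′ x)
  where
  step : ((sw c ∘ g) ▹ j) ≗ (sw c ∘ (g ▹ j))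
  step y with g j <? g (suc j)
  ... | yes lt = trans (▹-asc (sw c ∘ g) j y (sw-mono-below lt (G j<c))) (cong (sw c) (sym (▹-asc g j y lt)))
  ... | no ge = trans (▹-desc (sw c ∘ g) j y le) (cong (sw c) (sym (▹-desc g j y (≮⇒≥ ge))))
    where
    le : sw c (g (suc j)) ≤ sw c (g j)
    le with g (suc j) ≟ g j
    ... | yes e = ≤-reflexive (cong (sw c) e)
    ... | no ne = <⇒≤ (sw-mono-below (≤∧≢⇒< (≮⇒≥ ge) ne) (G (<⇒≤ j<c)))
  G′ : ∀ {y} → y ≤ c → (g ▹ j) y ≤ c
  G′ {y} y≤c with g j <ᵇ g (suc j)
  ... | true = G (sw-preserves-≤ (<⇒≢ j<c) y≤c)
  ... | false = G y≤c

id▹ : ∀ c → (id ▹ c) ≗ sw c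
id▹ c x = ▹-asc id c x (n<1+n c)

All-reverse : ∀ {A : Set} {Q : A → Set} w → All Q w → All Q (reverse w)
All-reverse [] [] = []
All-reverse (x ∷ w) (q ∷ a) rewrite unfold-reverse x w = ∷ʳ⁺ (All-reverse w a) q

w⁻¹∘w-conj : ∀ w {c} → All (_< c) w → w⁻¹∘w (w ∷ʳ c) ≗ ((sw c ∘ w⁻¹∘w w) ▹ c)
w⁻¹∘w-conj w {c} a x rewrite w⁻¹∘w-∷ʳ w c =
  ▹-cong c (λ y → trans (▹▹-cong (reverse w ++ w) (id▹ c) y)
    (▹▹-conj (reverse w ++ w) (++⁺ (All-reverse w a) a) (λ le → le) y)) x

w⁻¹∘w-last : ∀ w c → w⁻¹∘w (w ∷ʳ c) (suc c) ≤ w⁻¹∘w (w ∷ʳ c) c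
w⁻¹∘w-last w c rewrite w⁻¹∘w-∷ʳ w c = ▹-decreases (id ▹ c ▹▹ (reverse w ++ w)) c

-- Words without repeated letters are reduced.

∈-remove : ∀ {A : Set} {x : A} {ys} → x ∈ ys → ∃[ zs ] ys ↭ x ∷ zs
∈-remove {x = x} x∈ with ∈-∃++ x∈
... | us , vs , refl = us ++ vs , shift x us vs

Unique⊆⇒↭ : ∀ {A : Set} {xs ys : List A} → Unique xs → (∀ {x} → x ∈ xs → x ∈ ys) → ∃[ zs ] ys ↭ xs ++ zs
Unique⊆⇒↭ {ys = ys} [] _ = ys , ↭-refl
Unique⊆⇒↭ {xs = x ∷ xs} (x∉ ∷ u) sub with ∈-remove (sub (here refl))
... | ys′ , p with Unique⊆⇒↭ u sub′
  where
  sub′ : ∀ {y} → y ∈ xs → y ∈ ys′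
  sub′ y∈ with ∈-resp-↭ p (sub (there y∈))
  ... | here refl = contradiction refl (All.lookup x∉ y∈)
  ... | there y∈′ = y∈′
... | zs , q = zs , ↭-trans p (↭-prep x q)

Unique⊆⇒length≤ : ∀ {A : Set} {xs ys : List A} → Unique xs → (∀ {x} → x ∈ xs → x ∈ ys) → length xs ≤ length ys
Unique⊆⇒length≤ {xs = xs} u sub with Unique⊆⇒↭ u sub
... | zs , p rewrite ↭-length p | length-++ xs {zs} = m≤m+n (length xs) (length zs)

Unique⇒once : ∀ {A : Set} p {x : A} {s} → Unique (p ++ x ∷ s) → x ∉ p × x ∉ s
Unique⇒once [] (x∉ ∷ _) = (λ ()) , λ x∈ → All.lookup x∉ x∈ refl
Unique⇒once (y ∷ p) {x} (y∉ ∷ u) with Unique⇒once p u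
... | x∉p , x∉s = (λ { (here refl) → All.lookup y∉ (∈-++⁺ʳ p (here refl)) refl ; (there x∈) → x∉p x∈ }) , x∉s

-- A letter i occurring exactly once makes the permutation move some x ≤ i
-- above i, which no word avoiding i can do.
Unique⇒Reduced : ∀ w → Unique w → Word w → Reduced w
Unique⇒Reduced w u wd = wd , λ vs _ e → Unique⊆⇒length≤ u (λ i∈ → letters vs e i∈)
  where
  letters : ∀ vs → vs ≈ₚ w → ∀ {i} → i ∈ w → i ∈ vs
  letters vs e {i} i∈ with _∈?_ _≟_ i vs
  ... | yes i∈vs = i∈vs
  ... | no i∉vs with ∈-∃++ i∈
  ...   | p , s , refl with Unique⇒once p u
  ...     | i∉p , i∉s = ⊥-elim (i∉-act p i∉p (subst (_≤ i) eq (act-preserves-≤ i∉vs x≤i)))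
    where
    x : ℕ
    x = applyLR s i
    x≤i : x ≤ i
    x≤i = applyLR-preserves-≤ i∉s ≤-refl
    eq : act vs x ≡ act p (suc i)
    eq = trans (e x) (trans (act-++ p (i ∷ s) x) (cong (act p) (trans (cong (sw i) (act-applyLR s i)) (sw-at₀ i))))
    i∉-act : ∀ p → i ∉ p → ¬ (act p (suc i) ≤ i)
    i∉-act p i∉p le = 1+n≰n (subst (_≤ i) (applyLR-act p (suc i)) (applyLR-preserves-≤ i∉p le))
      where
      applyLR-act : ∀ p x → applyLR p (act p x) ≡ x
      applyLR-act [] x = refl
      applyLR-act (j ∷ p) x = trans (cong (applyLR p) (sw-invol j (act p x))) (applyLR-act p x)

-- Rank words and the moves that connect them.

-- A word of ranks read from an interval [l, r) to [l′, r′): every letter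
-- extends the interval by its upper (U) or lower (D) neighbour.
data Path : ℕ → ℕ → List ℕ → ℕ → ℕ → Set where
  []  : ∀ {l r} → Path l r [] l r
  U∷_ : ∀ {l r w l′ r′} → Path l (suc r) w l′ r′ → Path l r (r ∷ w) l′ r′
  D∷_ : ∀ {l r w l′ r′} → Path l r w l′ r′ → Path (suc l) r (l ∷ w) l′ r′

infixr 5 U∷_ D∷_

data Full (k : ℕ) : List ℕ → Set where
  full : ∀ {a s} → Path a (suc a) s 1 (suc k) → Full k (a ∷ s)

Path-++⁺ : ∀ {l r u l′ r′ v l″ r″} → Path l r u l′ r′ → Path l′ r′ v l″ r″ → Path l r (u ++ v) l″ r″
Path-++⁺ [] q = q
Path-++⁺ (U∷ p) q = U∷ Path-++⁺ p q
Path-++⁺ (D∷ p) q = D∷ Path-++⁺ p q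

Path-++⁻ : ∀ {l r} u {v l″ r″} → Path l r (u ++ v) l″ r″ → ∃[ l′ ] ∃[ r′ ] Path l r u l′ r′ × Path l′ r′ v l″ r″
Path-++⁻ [] q = _ , _ , [] , q
Path-++⁻ (_ ∷ u) (U∷ q) with Path-++⁻ u q
... | _ , _ , p , p′ = _ , _ , U∷ p , p′
Path-++⁻ (_ ∷ u) (D∷ q) with Path-++⁻ u q
... | _ , _ , p , p′ = _ , _ , D∷ p , p′

Path-l≥ : ∀ {l r w l′ r′} → Path l r w l′ r′ → l′ ≤ l
Path-l≥ [] = ≤-refl
Path-l≥ (U∷ p) = Path-l≥ p
Path-l≥ (D∷ p) = m≤n⇒m≤1+n (Path-l≥ p)

Path-r≤ : ∀ {l r w l′ r′} → Path l r w l′ r′ → r ≤ r′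
Path-r≤ [] = ≤-refl
Path-r≤ (U∷ p) = <⇒≤ (Path-r≤ p)
Path-r≤ (D∷ p) = Path-r≤ p

In : ℕ → ℕ → ℕ → Set
In l r x = l ≤ x × x < r

Path-range : ∀ {l r w l′ r′} → l ≤ r → Path l r w l′ r′ → All (In l′ r′) w
Path-range l≤r [] = []
Path-range l≤r (U∷ p) = (≤-trans (Path-l≥ p) l≤r , Path-r≤ p) ∷ Path-range (m≤n⇒m≤1+n l≤r) p
Path-range l≤r (D∷ p) = (Path-l≥ p , ≤-trans l≤r (Path-r≤ p)) ∷ Path-range (<⇒≤ l≤r) p

Path-outside : ∀ {l r w l′ r′} → Path l r w l′ r′ → All (λ x → x < l ⊎ r ≤ x) w
Path-outside [] = []
Path-outside (U∷ p) = inj₂ ≤-refl ∷ All.map (λ { (inj₁ lt) → inj₁ lt ; (inj₂ le) → inj₂ (<⇒≤ le) }) (Path-outside p)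
Path-outside (D∷ p) = inj₁ (n<1+n _) ∷ All.map (λ { (inj₁ lt) → inj₁ (m<n⇒m<1+n lt) ; (inj₂ le) → inj₂ le }) (Path-outside p)

Path-head : ∀ {l r x w l′ r′} → Path l r (x ∷ w) l′ r′ → x ≡ r ⊎ suc x ≡ l
Path-head (U∷ p) = inj₁ refl
Path-head (D∷ p) = inj₂ refl

Path-Unique : ∀ {l r w l′ r′} → l ≤ r → Path l r w l′ r′ → Unique w
Path-Unique l≤r [] = []
Path-Unique l≤r (U∷ p) =
  All.map (λ { (inj₁ lt) refl → <⇒≱ lt l≤r ; (inj₂ le) refl → 1+n≰n le }) (Path-outside p) ∷ Path-Unique (m≤n⇒m≤1+n l≤r) p
Path-Unique l≤r (D∷ p) =
  All.map (λ { (inj₁ lt) refl → n≮n _ lt ; (inj₂ le) refl → <⇒≱ l≤r le }) (Path-outside p) ∷ Path-Unique (<⇒≤ l≤r) p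

Full-range : ∀ {k w} → Full k w → All (In 1 (suc k)) w
Full-range (full p) = (Path-l≥ p , Path-r≤ p) ∷ Path-range (n≤1+n _) p

Full-Unique : ∀ {k w} → Full k w → Unique w
Full-Unique (full p) = Path-Unique ≤-refl (U∷ p)

-- Starting from an empty interval makes the first letter an ordinary step, so that splitting a path
-- also covers an empty prefix.
Full⇒Path : ∀ {k w} → Full k w → ∃[ a ] Path a a w 1 (suc k)
Full⇒Path (full p) = _ , U∷ p

Path⇒Full : ∀ {k a x w} → Path a a (x ∷ w) 1 (suc k) → Full k (x ∷ w)
Path⇒Full (U∷ p) = full p
Path⇒Full (D∷ p) = full p

Path-≤ : ∀ {l r w l′ r′} → l ≤ r → Path l r w l′ r′ → l′ ≤ r′
Path-≤ l≤r p = ≤-trans (Path-l≥ p) (≤-trans l≤r (Path-r≤ p))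

Full-split : ∀ {k} b p {w} → Full k (b ∷ p ++ w) →
  ∃[ l ] ∃[ r ] l < r × Path b (suc b) p l r × All (In l r) (b ∷ p) × Path l r w 1 (suc k)
Full-split b p (full q) with Path-++⁻ p q
... | l , r , q₁ , q₂ = l , r , ≤-<-trans (Path-l≥ q₁) (Path-r≤ q₁) , q₁ ,
  (Path-l≥ q₁ , Path-r≤ q₁) ∷ Path-range (n≤1+n _) q₁ , q₂

Full-join : ∀ {k b p l r w} → Path b (suc b) p l r → Path l r w 1 (suc k) → Full k (b ∷ p ++ w)
Full-join q₁ q₂ = full (Path-++⁺ q₁ q₂)

-- Two steps in the same direction read neighbouring ranks, which do not commute; a step up and a
-- step down act on different ends of the interval.
Path-swap : ∀ {l r x y s l′ r′} → l < r → Commuting x y → Path l r (x ∷ y ∷ s) l′ r′ → Path l r (y ∷ x ∷ s) l′ r′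
Path-swap l<r (inj₁ lt) (U∷ U∷ p) = contradiction lt (n≮n _)
Path-swap l<r (inj₂ lt) (U∷ U∷ p) = contradiction (<-trans (n<1+n _) (<-trans (n<1+n _) lt)) (n≮n _)
Path-swap l<r c (U∷ D∷ p) = D∷ U∷ p
Path-swap l<r c (D∷ U∷ p) = U∷ D∷ p
Path-swap l<r (inj₁ lt) (D∷ D∷ p) = contradiction (<-trans (n<1+n _) (<-trans (n<1+n _) lt)) (n≮n _)
Path-swap l<r (inj₂ lt) (D∷ D∷ p) = contradiction lt (n≮n _)

Full-comm : ∀ {k} p b {x y s} → Commuting x y → Full k (p ++ b ∷ x ∷ y ∷ s) → Full k (p ++ b ∷ y ∷ x ∷ s)
Full-comm [] b c (full q) = full (Path-swap (n<1+n _) c q)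
Full-comm (b′ ∷ p) b {x} {y} {s} c f with Full-split b′ (p ∷ʳ b) (subst (λ l → Full _ (b′ ∷ l)) (sym (++-assoc p [ b ] (x ∷ y ∷ s))) f)
... | l , r , l<r , q₁ , _ , q₂ = subst (λ l → Full _ (b′ ∷ l)) (++-assoc p [ b ] (y ∷ x ∷ s)) (Full-join q₁ (Path-swap l<r c q₂))

data Adjacent : ℕ → ℕ → Set where
  up   : ∀ {a} → Adjacent a (suc a)
  down : ∀ {a} → Adjacent (suc a) a

Full-first : ∀ {k a b s} → Full k (a ∷ b ∷ s) → Adjacent a b × Full k (b ∷ a ∷ s) × All (λ m → (m < a × m < b) ⊎ (a < m × b < m)) s
Full-first (full (U∷ p)) = up , full (D∷ p) ,
  All.map (λ { (inj₁ lt) → inj₁ (lt , m<n⇒m<1+n lt) ; (inj₂ le) → inj₂ (<-trans (n<1+n _) le , le) }) (Path-outside p)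
Full-first (full (D∷ p)) = down , full (U∷ p) ,
  All.map (λ { (inj₁ lt) → inj₁ (m<n⇒m<1+n lt , lt) ; (inj₂ le) → inj₂ (le , <-trans (n<1+n _) le) }) (Path-outside p)

ups : ℕ → List ℕ
ups = applyUpTo suc

-- Reading the letter a just below the interval can be postponed or
-- anticipated, as long as one letter b remains in front of it.
pull-down : ∀ (Q : List ℕ → Set) →
  (∀ p b {x y} s → x < b → b < y → Q (p ++ b ∷ x ∷ y ∷ s) → Q (p ++ b ∷ y ∷ x ∷ s)) →
  ∀ {a r s k} → 1 ≤ a → Path (suc a) r s 1 (suc k) →
  ∃[ s′ ] Path a r s′ 1 (suc k) × (∀ p b → a < b → b < r → Q (p ++ b ∷ a ∷ s′) → Q (p ++ b ∷ s))
pull-down Q sw₁ () []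
pull-down Q sw₁ 1≤a (D∷ q) = _ , q , λ p b _ _ h → h
pull-down Q sw₁ {a} {r} 1≤a (U∷ q) with pull-down Q sw₁ 1≤a q
... | s′ , q′ , f = r ∷ s′ , U∷ q′ , λ p b a<b b<r h →
  subst Q (++-assoc p [ b ] _)
    (f (p ∷ʳ b) r (<-trans a<b b<r) (n<1+n r)
      (subst Q (sym (++-assoc p [ b ] _)) (sw₁ p b s′ a<b b<r h)))

applyUpTo-cong : ∀ {A : Set} {f g : ℕ → A} n → (∀ {i} → i < n → f i ≡ g i) → applyUpTo f n ≡ applyUpTo g n
applyUpTo-cong zero e = refl
applyUpTo-cong (suc n) e = cong₂ _∷_ (e (s≤s z≤n)) (applyUpTo-cong n (e ∘ s≤s))

Path-up : ∀ {r s k} → Path 1 r s 1 (suc k) → ∃[ d ] s ≡ applyUpTo (_+ r) d × d + r ≡ suc k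
Path-up [] = 0 , refl , refl
Path-up {r} (U∷ p) with Path-up p
... | d , refl , e = suc d , cong (r ∷_) (applyUpTo-cong d (λ {i} _ → +-suc i r)) , trans (sym (+-suc d r)) e
Path-up (D∷ p) = contradiction (Path-l≥ p) λ ()

-- The two closure conditions are the Coxeter-Knuth relation BAC ~ BCA and the exchange of the first
-- two letters, in terms of ranks. To lower the first letter, its lower neighbour is pulled to the
-- second place and exchanged with it; a word that starts with 1 can only be 1 2 ... k.
Full-induction : ∀ {k} (Q : List ℕ → Set) →
  (∀ p b {x y} s → x < b → b < y → Q (p ++ b ∷ x ∷ y ∷ s) → Q (p ++ b ∷ y ∷ x ∷ s)) →
  (∀ a s → Full k (a ∷ suc a ∷ s) → Q (a ∷ suc a ∷ s) → Q (suc a ∷ a ∷ s)) →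
  Q (ups k) → ∀ {w} → Full k w → Q w
Full-induction {k} Q sw₁ sw₂ base (full {a} p) = go a p
  where
  go : ∀ a {s} → Path a (suc a) s 1 (suc k) → Q (a ∷ s)
  go zero p = contradiction (Path-l≥ p) λ ()
  go (suc zero) p with Path-up p
  ... | d , refl , e = subst Q eq base
    where
    eq : ups k ≡ 1 ∷ applyUpTo (_+ 2) d
    eq = trans (cong ups (suc-injective (trans (sym e) (+-comm d 2)))) (cong (1 ∷_) (applyUpTo-cong d (λ {i} _ → +-comm 2 i)))
  go (suc (suc a)) p =
    let s′ , q , f = pull-down Q sw₁ (s≤s z≤n) p
    in f [] (suc (suc a)) (n<1+n _) (n<1+n _) (sw₂ (suc a) s′ (full (U∷ q)) (go (suc a) (U∷ q)))

-- Primed words from rank words, and their closure under the equivalence.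

-- Letters: with start rank m₀ and prime p₀ on the first letter, the letter of
-- rank m carries the prime of the gap crossed on the way from m₀ to m, where
-- P g belongs to the gap between ranks g and g + 1.
abstract
  prime : (ℕ → Bool) → Bool → ℕ → ℕ → Bool
  prime P p₀ m₀ m = if m <ᵇ m₀ then P m else (if m₀ <ᵇ m then P (pred m) else p₀)

  prime-below : ∀ {P p₀ m₀ m} → m < m₀ → prime P p₀ m₀ m ≡ P m
  prime-below lt rewrite <ᵇ-true lt = refl

  prime-above : ∀ {P p₀ m₀ m} → m₀ < m → prime P p₀ m₀ m ≡ P (pred m)
  prime-above lt rewrite <ᵇ-false (<⇒≤ lt) | <ᵇ-true lt = refl

  prime-start : ∀ {P p₀} m → prime P p₀ m m ≡ p₀
  prime-start m rewrite <ᵇ-false (≤-refl {m}) = refl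

letter : (ℕ → ℕ) → (ℕ → Bool) → Bool → ℕ → ℕ → PL
letter J P p₀ m₀ m = J m , prime P p₀ m₀ m

letter-moved-start : ∀ {J P p₀ a b m} → (m < a × m < b) ⊎ (a < m × b < m) → letter J P p₀ a m ≡ letter J P p₀ b m
letter-moved-start (inj₁ (p , q)) = cong (_ ,_) (trans (prime-below p) (sym (prime-below q)))
letter-moved-start (inj₂ (p , q)) = cong (_ ,_) (trans (prime-above p) (sym (prime-above q)))

hd : List ℕ → ℕ
hd [] = 0
hd (x ∷ _) = x

word : (ℕ → ℕ) → (ℕ → Bool) → Bool → List ℕ → List PL
word J P p₀ w = map (letter J P p₀ (hd w)) w

prime-gap : ∀ {P p₀ a b} → Adjacent a b → prime P p₀ a b ≡ prime P p₀ b a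
prime-gap (up {a}) = trans (prime-above (n<1+n a)) (sym (prime-below (n<1+n a)))
prime-gap (down {a}) = trans (prime-below (n<1+n a)) (sym (prime-above (n<1+n a)))

-- The second letter crosses the same gap in both words, only in opposite directions, hence the
-- common prime `q`. Every later letter lies on the same side of both starts, hence the common rest
-- `t`.
word-first : ∀ {k J P p₀ a b s} → Full k (a ∷ b ∷ s) →
  ∃[ q ] ∃[ t ] word J P p₀ (a ∷ b ∷ s) ≡ (J a , p₀) ∷ (J b , q) ∷ t × word J P p₀ (b ∷ a ∷ s) ≡ (J b , p₀) ∷ (J a , q) ∷ t
word-first {J = J} {a = a} {b} f with Full-first f
... | adj , _ , out = _ , _ ,
  cong₂ _∷_ (cong (_ ,_) (prime-start a)) refl ,
  cong₂ _∷_ (cong (_ ,_) (prime-start b))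
    (cong₂ _∷_ (cong (_ ,_) (sym (prime-gap adj))) (map-cong-local (All.map (sym ∘ letter-moved-start {J}) out)))

map-ceil-word : ∀ {J P p₀} w → map ceil (word J P p₀ w) ≡ map J w
map-ceil-word w = sym (map-∘ w)

Mono : (ℕ → ℕ) → Set
Mono J = ∀ {m n} → m < n → J m < J n

Mono-reflect : ∀ {J} → Mono J → ∀ {m n} → J m < J n → m < n
Mono-reflect {J} mono {m} {n} lt with <-cmp m n
... | tri< m<n _ _ = m<n
... | tri≈ _ refl _ = contradiction lt (n≮n _)
... | tri> _ _ n<m = contradiction (mono n<m) (<⇒≯ lt)

Mono-inj : ∀ {J} → Mono J → ∀ {m n} → J m ≡ J n → m ≡ n
Mono-inj mono {m} {n} e with <-cmp m n
... | tri< m<n _ _ = contradiction e (<⇒≢ (mono m<n))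
... | tri≈ _ refl _ = refl
... | tri> _ _ n<m = contradiction e (>⇒≢ (mono n<m))

-- The class of a one-row tableau under orthogonal Coxeter–Knuth equivalence.
data Class (J : ℕ → ℕ) (P : ℕ → Bool) (k : ℕ) : List PL → Set where
  class : ∀ p₀ {w} → Full k w → Class J P k (word J P p₀ w)

map-split : ∀ {A B : Set} (f : A → B) w x {y} → map f w ≡ x ++ y → ∃[ u ] ∃[ v ] w ≡ u ++ v × map f u ≡ x × map f v ≡ y
map-split f w [] e = [] , w , refl , refl , e
map-split f (a ∷ w) (b ∷ x) e with ∷-injective e
... | e₁ , e₂ with map-split f w x e₂
...   | u , v , refl , e₃ , e₄ = a ∷ u , v , refl , cong₂ _∷_ e₁ e₃ , e₄

map-∷ : ∀ {A B : Set} (f : A → B) w {b y} → map f w ≡ b ∷ y → ∃[ a ] ∃[ v ] w ≡ a ∷ v × f a ≡ b × map f v ≡ y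
map-∷ f (a ∷ v) e with ∷-injective e
... | e₁ , e₂ = a , v , refl , e₁ , e₂

Full-next : ∀ {k} p {x s} → Full k (p ++ x ∷ s) → ∃[ l ] ∃[ r ] All (In l r) p × (x ≡ r ⊎ suc x ≡ l)
Full-next [] {x} f = x , x , [] , inj₁ refl
Full-next (b ∷ p) f with Full-split b p f
... | l , r , _ , _ , ins , q = l , r , ins , Path-head q

-- The ranks read so far form an interval, so no new rank lies between two of them.
Full-convex : ∀ {k} p {x s a c} → Full k (p ++ x ∷ s) → a ∈ p → c ∈ p → a ≤ x → x ≤ c → ⊥
Full-convex p f a∈ c∈ a≤x x≤c with Full-next p f
... | l , r , ins , inj₁ refl = <⇒≱ (proj₂ (All.lookup ins c∈)) x≤c
... | l , r , ins , inj₂ refl = <⇒≱ (proj₁ (All.lookup ins a∈)) a≤x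

Mono-reflect-≤ : ∀ {J} → Mono J → ∀ {m n} → J m ≤ J n → m ≤ n
Mono-reflect-≤ mono {m} {n} le = ≮⇒≥ (λ n<m → <⇒≱ (mono n<m) le)

-- This excludes the relation `acb` and all braid relations at once: on each of their sides the
-- third letter lies weakly between the first two.
class-extremal : ∀ {J P k} → Mono J → ∀ p {A C B s} → Class J P k (p ++ A ∷ C ∷ B ∷ s) →
  ¬ (ceil A ≤ ceil B × ceil B ≤ ceil C) × ¬ (ceil C ≤ ceil B × ceil B ≤ ceil A)
class-extremal {J} {P} {k} mono p {A} {C} {B} {s} cl = go cl refl
  where
  go : ∀ {v} → Class J P k v → v ≡ p ++ A ∷ C ∷ B ∷ s →
    ¬ (ceil A ≤ ceil B × ceil B ≤ ceil C) × ¬ (ceil C ≤ ceil B × ceil B ≤ ceil A)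
  go (class p₀ {w} f) e with map-split _ w p e
  ... | u , v , refl , _ , e₁ with map-∷ _ v e₁
  ...   | a , v₁ , refl , refl , e₂ with map-∷ _ v₁ e₂
  ...     | c , v₂ , refl , refl , e₃ with map-∷ _ v₂ e₃
  ...       | b , v₃ , refl , refl , _ =
    (λ (le₁ , le₂) → Full-convex (u ++ a ∷ c ∷ []) f′ a∈ c∈ (Mono-reflect-≤ mono le₁) (Mono-reflect-≤ mono le₂)) ,
    (λ (le₁ , le₂) → Full-convex (u ++ a ∷ c ∷ []) f′ c∈ a∈ (Mono-reflect-≤ mono le₁) (Mono-reflect-≤ mono le₂))
    where
    f′ = subst (Full k) (sym (++-assoc u (a ∷ c ∷ []) (b ∷ v₃))) f
    a∈ = ∈-++⁺ʳ u (here refl)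
    c∈ = ∈-++⁺ʳ u (there (here refl))

hd-++ : ∀ u {b s t} → hd (u ++ b ∷ s) ≡ hd (u ++ b ∷ t)
hd-++ [] = refl
hd-++ (_ ∷ _) = refl

class-comm : ∀ {J P k} → Mono J → ∀ p {B X Y s} →
  (ceil X < ceil B × ceil B < ceil Y) ⊎ (ceil Y < ceil B × ceil B < ceil X) →
  Class J P k (p ++ B ∷ X ∷ Y ∷ s) → Class J P k (p ++ B ∷ Y ∷ X ∷ s)
class-comm {J} {P} {k} mono p {B} {X} {Y} {s} h cl = go cl refl
  where
  go : ∀ {v} → Class J P k v → v ≡ p ++ B ∷ X ∷ Y ∷ s → Class J P k (p ++ B ∷ Y ∷ X ∷ s)
  go (class p₀ {w} f) e with map-split _ w p e
  ... | u , v , refl , refl , e₁ with map-∷ _ v e₁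
  ...   | b , v₁ , refl , refl , e₂ with map-∷ _ v₁ e₂
  ...     | x , v₂ , refl , refl , e₃ with map-∷ _ v₂ e₃
  ...       | y , v₃ , refl , refl , refl =
    subst (Class J P k) eq (class p₀ (Full-comm u b (c h) f))
    where
    c : (J x < J b × J b < J y) ⊎ (J y < J b × J b < J x) → Commuting x y
    c (inj₁ (p , q)) = inj₁ (≤-<-trans (Mono-reflect mono p) (Mono-reflect mono q))
    c (inj₂ (p , q)) = inj₂ (≤-<-trans (Mono-reflect mono p) (Mono-reflect mono q))
    L = letter J P p₀ (hd (u ++ b ∷ x ∷ y ∷ v₃))
    eq : word J P p₀ (u ++ b ∷ y ∷ x ∷ v₃) ≡ map L u ++ L b ∷ L y ∷ L x ∷ map L v₃
    eq = trans (cong (λ m → map (letter J P p₀ m) (u ++ b ∷ y ∷ x ∷ v₃)) (hd-++ u)) (map-++ L u _)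

word-toggle : ∀ {k J P a s} p q → Full k (a ∷ s) →
  ∃[ t ] word J P p (a ∷ s) ≡ (J a , p) ∷ t × word J P q (a ∷ s) ≡ (J a , q) ∷ t
word-toggle {J = J} {P} {a} {s} p q (full f) = _ ,
  cong₂ _∷_ (cong (_ ,_) (prime-start a)) refl ,
  cong₂ _∷_ (cong (_ ,_) (prime-start a)) (map-cong-local (All.map tail (Path-outside f)))
  where
  tail : ∀ {m} → m < a ⊎ a < m → letter J P q a m ≡ letter J P p a m
  tail (inj₁ lt) = cong (_ ,_) (trans (prime-below lt) (sym (prime-below lt)))
  tail (inj₂ lt) = cong (_ ,_) (trans (prime-above lt) (sym (prime-above lt)))

class-toggle : ∀ {J P k c p s} q → Class J P k ((c , p) ∷ s) → Class J P k ((c , q) ∷ s)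
class-toggle {J} {P} {k} {c} {p} {s} q cl = go cl refl
  where
  go : ∀ {v} → Class J P k v → v ≡ (c , p) ∷ s → Class J P k ((c , q) ∷ s)
  go (class p₀ f@(full _)) e with word-toggle {J = J} {P} p₀ q f
  ... | t , e₁ , e₂ with ∷-injective (trans (sym e₁) e)
  ...   | refl , refl = subst (Class J P k) e₂ (class q f)

class-first : ∀ {J P k x y p q s} → Class J P k ((x , p) ∷ (y , q) ∷ s) → Class J P k ((y , p) ∷ (x , q) ∷ s)
class-first {J} {P} {k} {x} {y} {p} {q} {s} cl = go cl refl
  where
  go : ∀ {v} → Class J P k v → v ≡ (x , p) ∷ (y , q) ∷ s → Class J P k ((y , p) ∷ (x , q) ∷ s)
  go (class p₀ f@(full (U∷ _))) e with word-first {J = J} {P} {p₀} f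
  ... | q′ , t , e₁ , e₂ with trans (sym e₁) e
  ...   | refl = subst (Class J P k) e₂ (class p₀ (proj₁ (proj₂ (Full-first f))))
  go (class p₀ f@(full (D∷ _))) e with word-first {J = J} {P} {p₀} f
  ... | q′ , t , e₁ , e₂ with trans (sym e₁) e
  ...   | refl = subst (Class J P k) e₂ (class p₀ (proj₁ (proj₂ (Full-first f))))

class-OStep : ∀ {J P k v w} → Mono J → OStep v w → (Class J P k v → Class J P k w) × (Class J P k w → Class J P k v)
class-OStep {J} {P} {k} mono = λ where
    (acb p s A B C A<B B<C) →
      (λ c → ⊥-elim (proj₁ (class-extremal mono p c) (<⇒≤ A<B , <⇒≤ B<C))) ,
      (λ c → ⊥-elim (proj₂ (class-extremal mono p c) (<⇒≤ A<B , <⇒≤ B<C)))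
    (bca p s A B C A<B B<C) → class-comm mono p (inj₂ (A<B , B<C)) , class-comm mono p (inj₁ (A<B , B<C))
    (br1 p s a b adj) → no-repeat adj p , no-repeat (swapAdj adj) p
    (br2 p s a b adj) → no-repeat adj p , no-repeat (swapAdj adj) p
    (br3 p s a b adj) → no-repeat adj p , no-repeat (swapAdj adj) p
    (br4 p s a b adj) → no-repeat adj p , no-repeat (swapAdj adj) p
    (br5 p s a b adj) → no-repeat adj p , no-repeat (swapAdj adj) p
    (br6 p s a b adj) → no-repeat adj p , no-repeat (swapAdj adj) p
    (st1 s a) → class-toggle true , class-toggle false
    (st2 s a b) → class-first , class-first
    (st3 s a b) → class-first , class-first
    (st4 s a b) → class-first , class-first
    (st5 s a b) → class-first , class-first
  where
  swapAdj : ∀ {a b} → Adj a b → Adj b a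
  swapAdj (inj₁ e) = inj₂ e
  swapAdj (inj₂ e) = inj₁ e
  no-repeat : ∀ {a b p₁ p₂ p₃ s w} → Adj a b → ∀ p → Class J P k (p ++ (a , p₁) ∷ (b , p₂) ∷ (a , p₃) ∷ s) → Class J P k w
  no-repeat {a} {b} (inj₁ refl) p c = ⊥-elim (proj₁ (class-extremal mono p c) (≤-refl , n≤1+n a))
  no-repeat {a} {b} (inj₂ refl) p c = ⊥-elim (proj₂ (class-extremal mono p c) (n≤1+n b , ≤-refl))

class-~O : ∀ {J P k v w} → Mono J → v ~O w → Class J P k w → Class J P k v
class-~O mono ε c = c
class-~O mono (fwd s ◅ r) c = proj₂ (class-OStep mono s) (class-~O mono r c)
class-~O mono (bwd s ◅ r) c = proj₁ (class-OStep mono s) (class-~O mono r c)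

OStep-first : ∀ {a b} p q {s} → OStep ((a , p) ∷ (b , q) ∷ s) ((b , p) ∷ (a , q) ∷ s)
OStep-first false false = st2 _ _ _
OStep-first false true = st3 _ _ _
OStep-first true false = st4 _ _ _
OStep-first true true = st5 _ _ _

word-++ : ∀ J P p₀ p {b s} t → word J P p₀ (p ++ b ∷ s) ≡
  map (letter J P p₀ (hd (p ++ b ∷ t))) p ++ map (letter J P p₀ (hd (p ++ b ∷ t))) (b ∷ s)
word-++ J P p₀ p {b} {s} t = trans (cong (λ m → map (letter J P p₀ m) (p ++ b ∷ s)) (hd-++ p)) (map-++ _ p (b ∷ s))

word-~O-ups : ∀ {J P k p₀ w} → Mono J → Full k w → word J P p₀ w ~O word J P p₀ (ups k)
word-~O-ups {J} {P} {k} {p₀} mono = Full-induction (λ w → word J P p₀ w ~O word J P p₀ (ups k)) sw₁ sw₂ ε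
  where
  sw₁ : ∀ p b {x y} s → x < b → b < y →
    word J P p₀ (p ++ b ∷ x ∷ y ∷ s) ~O word J P p₀ (ups k) → word J P p₀ (p ++ b ∷ y ∷ x ∷ s) ~O word J P p₀ (ups k)
  sw₁ p b {x} {y} s x<b b<y h rewrite word-++ J P p₀ p {b} {x ∷ y ∷ s} [] | word-++ J P p₀ p {b} {y ∷ x ∷ s} [] =
    fwd (bca _ _ _ _ _ (mono x<b) (mono b<y)) ◅ h
  sw₂ : ∀ a s → Full k (a ∷ suc a ∷ s) →
    word J P p₀ (a ∷ suc a ∷ s) ~O word J P p₀ (ups k) → word J P p₀ (suc a ∷ a ∷ s) ~O word J P p₀ (ups k)
  sw₂ a s f h with word-first {J = J} {P} {p₀} f
  ... | q , t , e₁ , e₂ rewrite e₁ | e₂ = bwd (OStep-first p₀ q) ◅ h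

word-~O-toggle : ∀ {J P k w} p q → Full k w → word J P p w ~O word J P q w
word-~O-toggle false false f = ε
word-~O-toggle {J} {P} false true f@(full _) with word-toggle {J = J} {P} false true f
... | t , e₁ , e₂ rewrite e₁ | e₂ = fwd (st1 _ _) ◅ ε
word-~O-toggle {J} {P} true false f@(full _) with word-toggle {J = J} {P} true false f
... | t , e₁ , e₂ rewrite e₁ | e₂ = bwd (st1 _ _) ◅ ε
word-~O-toggle true true f = ε

~O-sym : ∀ {v w} → v ~O w → w ~O v
~O-sym = Eq.symmetric OStep

class-connected : ∀ {J P k v w} → Mono J → Class J P k v → Class J P k w → v ~O w
class-connected mono (class p f) (class q g) =
  word-~O-ups mono f ◅◅ ~O-sym (word-~O-ups mono g) ◅◅ word-~O-toggle p q g

-- Marked pairs under the moves on words.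

-- `MarkedOK` with an arbitrary relation in place of the cycles of z, so that marked pairs can be
-- followed while the involution grows letter by letter.
Marks : (ℕ → ℕ → Set) → List PL → Set
Marks R [] = ⊤
Marks R (p ∷ ps) =
  (primed p ≡ true → R (applyLR (map ceil ps) (ceil p)) (applyLR (map ceil ps) (suc (ceil p)))) × Marks R ps

MarkedOK⇒Marks : ∀ {z} ps → MarkedOK z ps → Marks (InCyc z) ps
MarkedOK⇒Marks [] _ = tt
MarkedOK⇒Marks (p ∷ ps) (h , m) = h , MarkedOK⇒Marks ps m

Marks⇒MarkedOK : ∀ {z} ps → Marks (InCyc z) ps → MarkedOK z ps
Marks⇒MarkedOK [] _ = tt
Marks⇒MarkedOK (p ∷ ps) (h , m) = h , Marks⇒MarkedOK ps m

Marks-∷ʳ : ∀ {R R′ : ℕ → ℕ → Set} ps {c q} → Marks R ps →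
  (∀ {a b} → R a b → R′ (sw c a) (sw c b)) → (q ≡ true → R′ c (suc c)) → Marks R′ (ps ∷ʳ (c , q))
Marks-∷ʳ [] _ f g = g , tt
Marks-∷ʳ {R} {R′} (p ∷ ps) {c} {q} (h , m) f g =
  (λ e → subst₂ R′ (sym (eq (ceil p))) (sym (eq (suc (ceil p)))) (f (h e))) , Marks-∷ʳ ps m f g
  where
  eq : ∀ x → applyLR (map ceil (ps ∷ʳ (c , q))) x ≡ sw c (applyLR (map ceil ps) x)
  eq x = trans (cong (λ l → applyLR l x) (map-++ ceil ps [ (c , q) ])) (applyLR-++ (map ceil ps) [ c ] x)

Marks-map : ∀ {R R′ : ℕ → ℕ → Set} ps → (∀ {a b} → R a b → R′ a b) → Marks R ps → Marks R′ ps
Marks-map [] f _ = tt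
Marks-map (p ∷ ps) f (h , m) = f ∘ h , Marks-map ps f m

Marks-++ : ∀ {R} ps {x s} → Marks R (ps ++ x ∷ s) → primed x ≡ true →
  R (applyLR (map ceil s) (ceil x)) (applyLR (map ceil s) (suc (ceil x)))
Marks-++ [] (h , _) = h
Marks-++ (_ ∷ ps) (_ , m) = Marks-++ ps m

-- Removing primes only removes marked pairs, so the condition needs checking only for the words
-- with as many primes as possible.
Marks-unprime : ∀ {R} {L L′ : ℕ → PL} {ws} → All (λ m → ceil (L m) ≡ ceil (L′ m) × (primed (L m) ≡ true → primed (L′ m) ≡ true)) ws →
  Marks R (map L′ ws) → Marks R (map L ws)
Marks-unprime [] _ = tt
Marks-unprime {R} {L} {L′} {x ∷ ws} ((e , i) ∷ a) (h , m) =
  (λ pr → subst₂ R (eq e) (eq (cong suc e)) (h (i pr))) , Marks-unprime a m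
  where
  ceils : map ceil (map L ws) ≡ map ceil (map L′ ws)
  ceils = trans (sym (map-∘ ws)) (trans (map-cong-local (All.map proj₁ a)) (map-∘ ws))
  eq : ∀ {x y} → x ≡ y → applyLR (map ceil (map L′ ws)) y ≡ applyLR (map ceil (map L ws)) x
  eq refl = cong (λ l → applyLR l _) (sym ceils)

Commuting-sym : ∀ {a b} → Commuting a b → Commuting b a
Commuting-sym (inj₁ lt) = inj₂ lt
Commuting-sym (inj₂ lt) = inj₁ lt

Commuting⇒sw : ∀ {a b} → Commuting a b → sw b a ≡ a × sw b (suc a) ≡ suc a
Commuting⇒sw (inj₁ lt) = sw-below (<-trans (n<1+n _) lt) , sw-below lt
Commuting⇒sw (inj₂ lt) = sw-above lt , sw-above (m<n⇒m<1+n lt)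

applyLR-comm : ∀ p s {a b} x → Commuting a b → applyLR (p ++ a ∷ b ∷ s) x ≡ applyLR (p ++ b ∷ a ∷ s) x
applyLR-comm [] s x (inj₁ lt) = cong (applyLR s) (sym (sw-comm x lt))
applyLR-comm [] s x (inj₂ lt) = cong (applyLR s) (sw-comm x lt)
applyLR-comm (i ∷ p) s x c = applyLR-comm p s (sw i x) c

Marks-comm : ∀ {R} p {x y s} → Commuting (ceil x) (ceil y) → Marks R (p ++ x ∷ y ∷ s) → Marks R (p ++ y ∷ x ∷ s)
Marks-comm {R} [] {x} {y} {s} c (hx , hy , m) =
  (λ e → subst₂ R (cong A (sym (proj₁ cy))) (cong A (sym (proj₂ cy))) (hy e)) ,
  (λ e → subst₂ R (cong A (proj₁ cx)) (cong A (proj₂ cx)) (hx e)) , m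
  where
  A = applyLR (map ceil s)
  cx = Commuting⇒sw c
  cy = Commuting⇒sw (Commuting-sym c)
Marks-comm {R} (q ∷ p) {x} {y} {s} c (h , m) =
  (λ e → subst₂ R (eq (ceil q)) (eq (suc (ceil q))) (h e)) , Marks-comm p c m
  where
  eq : ∀ t → applyLR (map ceil (p ++ x ∷ y ∷ s)) t ≡ applyLR (map ceil (p ++ y ∷ x ∷ s)) t
  eq t rewrite map-++ ceil p (x ∷ y ∷ s) | map-++ ceil p (y ∷ x ∷ s) = applyLR-comm (map ceil p) (map ceil s) t c

-- Commuting letters keep their pairs. If b = a + 1, the first letter marks, up to the action of s,
-- the pair (a , a + 2) in both orders: s_b takes (a , a + 1) to it, and s_a takes (a + 1 , a + 2)
-- to it.
Marks-first : ∀ {R a b q s} → a < b → (q ≡ false → suc a ≡ b) → (q ≡ true → suc a < b) →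
  Marks R ((a , true) ∷ (b , q) ∷ s) → Marks R ((b , true) ∷ (a , q) ∷ s)
Marks-first {q = true} a<b _ g m = Marks-comm [] (inj₁ (g refl)) m
Marks-first {R} {a} {b} {false} {s} a<b g _ (h , _ , m) with g refl
... | refl =
  (λ _ → subst₂ R (cong A (trans (sw-below (n<1+n a)) (sym (sw-at₁ a))))
                  (cong A (trans (sw-at₀ (suc a)) (sym (sw-above (n<1+n (suc a)))))) (h refl)) ,
  (λ ()) , m
  where A = applyLR (map ceil s)

-- The involution of the word J 1, ..., J k and its cycles.

ups-∷ʳ : ∀ k → ups (suc k) ≡ ups k ∷ʳ suc k
ups-∷ʳ k = sym (applyUpTo-∷ʳ suc k)

ups-range : ∀ k → All (In 1 (suc k)) (ups k)
ups-range zero = []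
ups-range (suc k) = subst (All _) (sym (ups-∷ʳ k)) (∷ʳ⁺ (All.map (λ (p , q) → p , m<n⇒m<1+n q) (ups-range k)) (s≤s z≤n , ≤-refl))

Mono-≤ : ∀ {J} → Mono J → ∀ {m n} → m ≤ n → J m ≤ J n
Mono-≤ mono {m} {n} m≤n with m ≟ n
... | yes refl = ≤-refl
... | no m≢n = <⇒≤ (mono (≤∧≢⇒< m≤n m≢n))

Mono-≥id : ∀ {J} → Mono J → ∀ m → m ≤ J m
Mono-≥id mono zero = z≤n
Mono-≥id mono (suc m) = ≤-<-trans (Mono-≥id mono m) (mono (n<1+n m))

map-ups-∷ʳ : ∀ {A : Set} (f : ℕ → A) k → map f (ups (suc k)) ≡ map f (ups k) ∷ʳ f (suc k)
map-ups-∷ʳ f k = trans (cong (map f) (ups-∷ʳ k)) (map-++ f (ups k) [ suc k ])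

abstract
  w⁻¹∘w-ups : (ℕ → ℕ) → ℕ → ℕ → ℕ
  w⁻¹∘w-ups J k = w⁻¹∘w (map J (ups k))

  w⁻¹∘w-ups-def : ∀ J k → w⁻¹∘w-ups J k ≡ w⁻¹∘w (map J (ups k))
  w⁻¹∘w-ups-def J k = refl

w⁻¹∘w-ups-suc : ∀ {J} → Mono J → ∀ k → w⁻¹∘w-ups J (suc k) ≗ ((sw (J (suc k)) ∘ w⁻¹∘w-ups J k) ▹ J (suc k))
w⁻¹∘w-ups-suc {J} mono k x = begin
  w⁻¹∘w-ups J (suc k) x                                      ≡⟨ cong (λ f → f x) (w⁻¹∘w-ups-def J (suc k)) ⟩
  w⁻¹∘w (map J (ups (suc k))) x                              ≡⟨ cong (λ l → w⁻¹∘w l x) (map-ups-∷ʳ J k) ⟩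
  w⁻¹∘w (map J (ups k) ∷ʳ J (suc k)) x                       ≡⟨ w⁻¹∘w-conj (map J (ups k)) (map⁺ (All.map (mono ∘ proj₂) (ups-range k))) x ⟩
  ((sw (J (suc k)) ∘ w⁻¹∘w (map J (ups k))) ▹ J (suc k)) x   ≡⟨ cong (λ f → ((sw (J (suc k)) ∘ f) ▹ J (suc k)) x) (w⁻¹∘w-ups-def J k) ⟨
  ((sw (J (suc k)) ∘ w⁻¹∘w-ups J k) ▹ J (suc k)) x           ∎
  where open ≡-Reasoning

w⁻¹∘w-ups-above : ∀ {J} → Mono J → ∀ k {x} → k ≡ 0 ⊎ suc (J k) < x → w⁻¹∘w-ups J k x ≡ x
w⁻¹∘w-ups-above {J} mono zero {x} _ = cong (λ f → f x) (w⁻¹∘w-ups-def J zero)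
w⁻¹∘w-ups-above mono (suc k) (inj₁ ())
w⁻¹∘w-ups-above {J} mono (suc k) {x} (inj₂ lt) = trans (cong (λ f → f x) (w⁻¹∘w-ups-def J (suc k))) (
  ▹▹-fixes (++⁺ (All-reverse _ fixed) fixed))
  where
  fixed : All (λ j → x ≢ j × x ≢ suc j) (map J (ups (suc k)))
  fixed = map⁺ (All.map (λ { (_ , s≤s m≤) →
    let sJm<x = ≤-<-trans (s≤s (Mono-≤ mono m≤)) lt
    in >⇒≢ (<-trans (n<1+n _) sJm<x) , >⇒≢ sJm<x }) (ups-range (suc k)))

-- The next letter c = J (k + 1) changes the involution in one of two ways: after a gap it
-- multiplies it by s_c, in a run it conjugates it by s_c.
data Step (J : ℕ → ℕ) (k : ℕ) : Set where
  gap : k ≡ 0 ⊎ suc (J k) < J (suc k) → Step J k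
  run : 1 ≤ k → suc (J k) ≡ J (suc k) → Step J k

step? : ∀ {J} → Mono J → ∀ k → Step J k
step? mono zero = gap (inj₁ refl)
step? {J} mono (suc k) with suc (J (suc k)) ≟ J (suc (suc k))
... | yes e = run (s≤s z≤n) e
... | no ne = gap (inj₂ (≤∧≢⇒< (mono (n<1+n _)) ne))

above-suc : ∀ {J} → Mono J → ∀ k → k ≡ 0 ⊎ suc (J k) < suc (J (suc k))
above-suc mono zero = inj₁ refl
above-suc mono (suc k) = inj₂ (s≤s (mono (n<1+n _)))

w⁻¹∘w-gap : ∀ {J} → Mono J → ∀ k → k ≡ 0 ⊎ suc (J k) < J (suc k) →
  w⁻¹∘w-ups J (suc k) ≗ (sw (J (suc k)) ∘ w⁻¹∘w-ups J k)
w⁻¹∘w-gap {J} mono k g x = trans (w⁻¹∘w-ups-suc mono k x) (▹-desc (sw c ∘ w⁻¹∘w-ups J k) c x le)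
  where
  c = J (suc k)
  le : sw c (w⁻¹∘w-ups J k (suc c)) ≤ sw c (w⁻¹∘w-ups J k c)
  le rewrite w⁻¹∘w-ups-above mono k g | w⁻¹∘w-ups-above mono k (above-suc mono k) | sw-at₀ c | sw-at₁ c = n≤1+n c

-- Declared ahead because it and `w⁻¹∘w-run` depend on each other: a run conjugates as soon as the
-- involution sends c = J k + 1 below c, and after the conjugation the same holds one entry further.
w⁻¹∘w-last-≤ : ∀ {J} → Mono J → ∀ k → 1 ≤ k → w⁻¹∘w-ups J k (suc (J k)) ≤ J k

w⁻¹∘w-run : ∀ {J} → Mono J → ∀ k → 1 ≤ k → suc (J k) ≡ J (suc k) →
  ∀ x → w⁻¹∘w-ups J (suc k) x ≡ sw (J (suc k)) (w⁻¹∘w-ups J k (sw (J (suc k)) x))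
w⁻¹∘w-run {J} mono k 1≤k e x = trans (w⁻¹∘w-ups-suc mono k x) (▹-asc (sw c ∘ w⁻¹∘w-ups J k) c x lt)
  where
  c = J (suc k)
  yc<c : w⁻¹∘w-ups J k c < c
  yc<c = subst (λ d → w⁻¹∘w-ups J k d < d) e (s≤s (w⁻¹∘w-last-≤ mono k 1≤k))
  lt : sw c (w⁻¹∘w-ups J k c) < sw c (w⁻¹∘w-ups J k (suc c))
  lt rewrite w⁻¹∘w-ups-above mono k (above-suc mono k) | sw-at₁ c | sw-below yc<c = yc<c

w⁻¹∘w-last-≤ {J} mono (suc k) _ with step? mono k
... | gap g rewrite w⁻¹∘w-gap mono k g (suc (J (suc k))) | w⁻¹∘w-ups-above mono k (above-suc mono k) =
  ≤-reflexive (sw-at₁ (J (suc k)))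
... | run 1≤k e rewrite w⁻¹∘w-run mono k 1≤k e (suc (J (suc k))) | sw-at₁ (J (suc k)) =
  subst (_≤ c) (sym (sw-below yc<c)) (<⇒≤ yc<c)
  where
  c = J (suc k)
  yc<c : w⁻¹∘w-ups J k c < c
  yc<c = subst (λ d → w⁻¹∘w-ups J k d < d) e (s≤s (w⁻¹∘w-last-≤ mono k 1≤k))

w⁻¹∘w-step-fixed : ∀ {J} → Mono J → ∀ k {x} → x < J (suc k) → w⁻¹∘w-ups J k x ≡ x → w⁻¹∘w-ups J (suc k) x ≡ x
w⁻¹∘w-step-fixed mono k {x} x<c e with step? mono k
... | gap g rewrite w⁻¹∘w-gap mono k g x | e = sw-below x<c
... | run 1≤k r rewrite w⁻¹∘w-run mono k 1≤k r x | sw-below x<c | e = sw-below x<c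

-- Conjugation by s_c carries the fixed point c + 1 to c = J (g + 1), and the later, larger letters
-- leave it fixed. This is why a gap between consecutive entries admits no prime.
w⁻¹∘w-run-fixed : ∀ {J} → Mono J → ∀ {g} → 1 ≤ g → suc (J g) ≡ J (suc g) → ∀ {k} → g < k →
  w⁻¹∘w-ups J k (J (suc g)) ≡ J (suc g)
w⁻¹∘w-run-fixed {J} mono {g} 1≤g e {suc k} (s≤s g≤k) with g ≟ k
... | yes refl rewrite w⁻¹∘w-run mono g 1≤g e (J (suc g)) | sw-at₀ (J (suc g)) | w⁻¹∘w-ups-above mono g (above-suc mono g) =
  sw-at₁ (J (suc g))
... | no g≢k = w⁻¹∘w-step-fixed mono k (mono (s≤s g<k)) (w⁻¹∘w-run-fixed mono 1≤g e g<k)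
  where g<k = ≤∧≢⇒< g≤k g≢k

-- The bound on b makes the notion stable: it gives b ≤ c for the next letter c, and s_c respects
-- the order of such a pair.
CycUpTo : (ℕ → ℕ) → ℕ → ℕ → ℕ → Set
CycUpTo J k a b = a < b × b ≤ suc (J k) × w⁻¹∘w-ups J k a ≡ b

CycUpTo-suc : ∀ {J} → Mono J → ∀ k {a b} → CycUpTo J k a b → CycUpTo J (suc k) (sw (J (suc k)) a) (sw (J (suc k)) b)
CycUpTo-suc {J} mono k {a} {b} (a<b , b≤ , e) = sw-mono-below a<b b≤c , b′≤ , e′
  where
  c = J (suc k)
  b≤c : b ≤ c
  b≤c = ≤-trans b≤ (mono (n<1+n k))
  b′≤ : sw c b ≤ suc c
  b′≤ = sw-preserves-≤ (<⇒≢ (n<1+n c)) (m≤n⇒m≤1+n b≤c)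
  e′ : w⁻¹∘w-ups J (suc k) (sw c a) ≡ sw c b
  e′ with step? mono k
  ... | gap g rewrite sw-below {c} (<-≤-trans a<b b≤c) | w⁻¹∘w-gap mono k g a | e = refl
  ... | run 1≤k r rewrite w⁻¹∘w-run mono k 1≤k r (sw c a) | sw-invol c a | e = refl

elig : (ℕ → ℕ) → ℕ → Bool
elig J g = not (suc (J g) ≡ᵇ J (suc g))

elig-true : ∀ {J g} → elig J g ≡ true → suc (J g) ≢ J (suc g)
elig-true {J} {g} e r rewrite r | ≡ᵇ-true (J (suc g)) = contradiction e λ ()

elig-false : ∀ {J g} → elig J g ≡ false → suc (J g) ≡ J (suc g)
elig-false {J} {g} e with suc (J g) ≟ J (suc g)
... | yes r = r
... | no r rewrite ≡ᵇ-false r = contradiction e λ ()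

elig-intro : ∀ {J g} → suc (J g) ≢ J (suc g) → elig J g ≡ true
elig-intro r rewrite ≡ᵇ-false r = refl

-- An entry c after a gap multiplies the involution by s_c at the fixed points c and c + 1, which
-- adds exactly the cycle that its prime marks. A later letter moves cycles and marked pairs alike.
Marks-ups : ∀ {J} → Mono J → ∀ k → Marks (CycUpTo J k) (map (letter J (elig J) true 1) (ups k))
Marks-ups mono zero = tt
Marks-ups {J} mono (suc k) = subst (Marks (CycUpTo J (suc k))) (sym (map-ups-∷ʳ (letter J (elig J) true 1) k))
  (Marks-∷ʳ (map (letter J (elig J) true 1) (ups k)) (Marks-ups mono k) (CycUpTo-suc mono k) (λ e → new (gapped k e)))
  where
  c = J (suc k)
  gapped : ∀ k → prime (elig J) true 1 (suc k) ≡ true → k ≡ 0 ⊎ suc (J k) < J (suc k)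
  gapped zero _ = inj₁ refl
  gapped (suc k) e = inj₂ (≤∧≢⇒< (mono (n<1+n _)) (elig-true {J} (trans (sym (prime-above (s≤s (s≤s z≤n)))) e)))
  new : k ≡ 0 ⊎ suc (J k) < J (suc k) → CycUpTo J (suc k) c (suc c)
  new g = n<1+n c , ≤-refl , trans (w⁻¹∘w-gap mono k g c) (trans (cong (sw c) (w⁻¹∘w-ups-above mono k g)) (sw-at₀ c))

-- The extreme case, with the first letter and every eligible gap primed; the other words follow by
-- removing primes.
Marks-Full : ∀ {J k f} → Mono J → f ≗ w⁻¹∘w-ups J k → ∀ {w} → Full k w →
  Marks (λ a b → a < b × f a ≡ b) (word J (elig J) true w)
Marks-Full {J} {k} {f} mono feq = Full-induction (λ w → Marks R (word J (elig J) true w)) sw₁ sw₂ base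
  where
  R : ℕ → ℕ → Set
  R a b = a < b × f a ≡ b
  base : Marks R (word J (elig J) true (ups k))
  base = start k (Marks-map (map (letter J (elig J) true 1) (ups k)) (λ (a<b , _ , e) → a<b , trans (feq _) e) (Marks-ups mono k))
    where
    start : ∀ k → Marks R (map (letter J (elig J) true 1) (ups k)) → Marks R (word J (elig J) true (ups k))
    start zero m = m
    start (suc k) m = m
  sw₁ : ∀ p b {x y} s → x < b → b < y →
    Marks R (word J (elig J) true (p ++ b ∷ x ∷ y ∷ s)) → Marks R (word J (elig J) true (p ++ b ∷ y ∷ x ∷ s))
  sw₁ p b {x} {y} s x<b b<y m
    rewrite sym (++-assoc p [ b ] (x ∷ y ∷ s)) | sym (++-assoc p [ b ] (y ∷ x ∷ s)) =
    subst (Marks R) (sym (trans (cong (λ h → map (letter J (elig J) true h) ((p ∷ʳ b) ++ y ∷ x ∷ s)) heq) (map-++ L (p ∷ʳ b) (y ∷ x ∷ s))))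
      (Marks-comm (map L (p ∷ʳ b)) (inj₁ (≤-<-trans (mono x<b) (mono b<y)))
        (subst (Marks R) (map-++ L (p ∷ʳ b) (x ∷ y ∷ s)) m))
    where
    L = letter J (elig J) true (hd ((p ∷ʳ b) ++ x ∷ y ∷ s))
    heq : hd ((p ∷ʳ b) ++ y ∷ x ∷ s) ≡ hd ((p ∷ʳ b) ++ x ∷ y ∷ s)
    heq rewrite ++-assoc p [ b ] (x ∷ y ∷ s) | ++-assoc p [ b ] (y ∷ x ∷ s) = hd-++ p
  sw₂ : ∀ a s → Full k (a ∷ suc a ∷ s) →
    Marks R (word J (elig J) true (a ∷ suc a ∷ s)) → Marks R (word J (elig J) true (suc a ∷ a ∷ s))
  sw₂ a s fl m with word-first {J = J} {elig J} {true} fl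
  ... | q , t , e₁ , e₂ = subst (Marks R) (sym e₂) (Marks-first (mono (n<1+n a))
      (λ qf → elig-false {J} (trans qe qf))
      (λ qt → ≤∧≢⇒< (mono (n<1+n a)) (elig-true {J} (trans qe qt)))
      (subst (Marks R) e₁ m))
    where
    qe : elig J a ≡ q
    qe = trans (sym (prime-above (n<1+n a))) (cong primed (proj₁ (∷-injective (proj₂ (∷-injective e₁)))))

Gapped : (ℕ → ℕ) → (ℕ → Bool) → ℕ → Set
Gapped J P k = ∀ {g} → 1 ≤ g → g < k → P g ≡ true → suc (J g) ≢ J (suc g)

w⁻¹∘w-Full : ∀ {J k} → Mono J → ∀ {w} → Full k w → w⁻¹∘w (map J w) ≗ w⁻¹∘w-ups J k
w⁻¹∘w-Full {J} {k} mono = Full-induction (λ w → w⁻¹∘w (map J w) ≗ w⁻¹∘w-ups J k)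
  (λ p b {x} {y} s x<b b<y h t → trans (sw₁ p b s x<b b<y t) (h t))
  (λ a s _ h t → trans (sym (w⁻¹∘w-first (map J s) (mono (n<1+n a)) t)) (h t))
  (λ t → cong (λ f → f t) (sym (w⁻¹∘w-ups-def J k)))
  where
  sw₁ : ∀ p b {x y} s → x < b → b < y → w⁻¹∘w (map J (p ++ b ∷ y ∷ x ∷ s)) ≗ w⁻¹∘w (map J (p ++ b ∷ x ∷ y ∷ s))
  sw₁ p b {x} {y} s x<b b<y t
    rewrite sym (++-assoc p [ b ] (x ∷ y ∷ s)) | sym (++-assoc p [ b ] (y ∷ x ∷ s))
          | map-++ J (p ∷ʳ b) (y ∷ x ∷ s) | map-++ J (p ∷ʳ b) (x ∷ y ∷ s) =
    w⁻¹∘w-comm (map J (p ∷ʳ b)) (map J s) (inj₂ (≤-<-trans (mono x<b) (mono b<y))) t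

Full-length : ∀ {k w} → Full k w → length w ≡ k
Full-length {k} = Full-induction (λ w → length w ≡ k)
  (λ p b {x} {y} s _ _ h → trans (len p b s) h) (λ _ _ _ h → h) (length-applyUpTo suc k)
  where
  len : ∀ p b {x y} s → length (p ++ b ∷ y ∷ x ∷ s) ≡ length (p ++ b ∷ x ∷ y ∷ s)
  len p b {x} {y} s rewrite length-++ p {b ∷ y ∷ x ∷ s} | length-++ p {b ∷ x ∷ y ∷ s} = refl

Full-Reduced : ∀ {J k w} → Mono J → Full k w → Reduced (map J w)
Full-Reduced {J} mono f = Unique⇒Reduced _ (UniqueP.map⁺ (Mono-inj mono) (Full-Unique f))
  (map⁺ (All.map (λ (1≤m , _) → ≤-trans 1≤m (Mono-≥id mono _)) (Full-range f)))

Shortest : List ℕ → ℕ → Set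
Shortest z k = ∀ vs → Reduced vs → demazure (reverse vs ++ vs) ≈ₚ z → k ≤ length vs

class-InRO : ∀ {z J P k} → Mono J → act z ≗ w⁻¹∘w-ups J k → Shortest z k → Gapped J P k →
  ∀ {v} → Class J P k v → InRO z v
class-InRO {z} {J} {P} {k} mono ze short gapped (class p₀ {w} f@(full {a} {s} path)) =
  subst (IsAtomWord z) (sym (map-ceil-word {J} {P} {p₀} w))
    (Full-Reduced mono f ,
     (λ x → trans (act-demazure (reverse (map J w) ++ map J w) x) (trans (w⁻¹∘w-Full mono f x) (sym (ze x)))) ,
     (λ vs r e → subst (_≤ length vs) (sym (trans (length-map J w) (Full-length f))) (short vs r e))) ,
  Marks⇒MarkedOK _ (Marks-unprime {L = letter J P p₀ a} {letter J (elig J) true a} (All.map weaken (Full-range f)) (Marks-Full mono ze f))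
  where
  1≤a = Path-l≥ path
  a≤k = Path-r≤ path
  -- A prime prescribed by P sits at a gap that is crossed inside 1, ..., k, where `gapped` makes it
  -- eligible; the first letter is primed in the extreme word anyway.
  weaken : ∀ {m} → In 1 (suc k) m → J m ≡ J m × (prime P p₀ a m ≡ true → prime (elig J) true a m ≡ true)
  weaken {m} (1≤m , m≤k) = refl , λ e → go m 1≤m m≤k e (<-cmp m a)
    where
    go : ∀ m → 1 ≤ m → m < suc k → prime P p₀ a m ≡ true → Tri (m < a) (m ≡ a) (m > a) → prime (elig J) true a m ≡ true
    go m 1≤m m≤k e (tri< m<a _ _) = trans (prime-below m<a) (elig-intro {J} (gapped 1≤m (<-≤-trans m<a (s≤s⁻¹ a≤k)) (trans (sym (prime-below m<a)) e)))
    go m 1≤m m≤k e (tri≈ _ refl _) = prime-start a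
    go (suc m) 1≤m m≤k e (tri> _ _ a<m) = trans (prime-above a<m) (elig-intro {J} (gapped (≤-trans 1≤a (s≤s⁻¹ a<m)) (s≤s⁻¹ m≤k) (trans (sym (prime-above a<m)) e)))

-- The rank function and the primes of gaps of a one-row tableau.

key-mono : ∀ {a b} → ceil a < ceil b → key a < key b
key-mono {m , p} {n , q} m<n = ≤-<-trans (key≤ m p) (<-≤-trans (s≤s ≤-refl) (≤-trans lt (key≥ n q)))
  where
  key≤ : ∀ m p → key (m , p) ≤ 2 * m
  key≤ m false = ≤-refl
  key≤ m true = m∸n≤m (2 * m) 1
  key≥ : ∀ n q → 2 * n ∸ 1 ≤ key (n , q)
  key≥ n false = m∸n≤m (2 * n) 1
  key≥ n true = ≤-refl
  lt : suc (2 * m) ≤ 2 * n ∸ 1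
  lt = ≤-trans (≤-reflexive (cong (_∸ 1) (sym (*-suc 2 m)))) (∸-monoˡ-≤ 1 (*-monoʳ-≤ 2 m<n))

key-reflect : ∀ {a b} → key a < key b → ceil a ≢ ceil b → ceil a < ceil b
key-reflect {a} {b} lt ne with <-cmp (ceil a) (ceil b)
... | tri< p _ _ = p
... | tri≈ _ e _ = contradiction e ne
... | tri> _ _ p = contradiction lt (<⇒≯ (key-mono {b} {a} p))

-- The order on primed letters allows m′ next to m. Reducedness forbids this, so a strict row stays
-- strict after its primes are removed.
NoRepeat : List ℕ → Set
NoRepeat ws = ∀ p i s → ws ≢ p ++ i ∷ i ∷ s

Reduced⇒NoRepeat : ∀ {ws} → Reduced ws → NoRepeat ws
Reduced⇒NoRepeat (wd , short) p i s refl =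
  1+n≰n (≤-trans (n≤1+n _) (subst₂ _≤_ len (length-++ p) (short (p ++ s) wd′ eq)))
  where
  wd′ : Word (p ++ s)
  wd′ with ++⁻ p wd
  ... | a , _ ∷ _ ∷ b = ++⁺ a b
  eq : (p ++ s) ≈ₚ (p ++ i ∷ i ∷ s)
  eq x = trans (act-++ p s x) (trans (cong (act p) (sym (sw-invol i (act s x)))) (sym (act-++ p (i ∷ i ∷ s) x)))
  len : length (p ++ i ∷ i ∷ s) ≡ suc (suc (length p + length s))
  len = trans (length-++ p) (trans (+-suc (length p) _) (cong suc (+-suc (length p) _)))

NoRepeat-tail : ∀ {x ws} → NoRepeat (x ∷ ws) → NoRepeat ws
NoRepeat-tail {x} h p i s e = h (x ∷ p) i s (cong (x ∷_) e)

ceil-increasing : ∀ {T} → StrictlyIncreasing T → NoRepeat (map ceil T) → Linked _<_ (map ceil T)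
ceil-increasing [] _ = []
ceil-increasing [-] _ = [-]
ceil-increasing {x ∷ y ∷ T} (lt ∷ l) h =
  key-reflect {x} {y} lt (λ e → h [] (ceil x) (map ceil T) (cong (λ c → ceil x ∷ c ∷ map ceil T) (sym e))) ∷ ceil-increasing l (NoRepeat-tail h)

ceil-decreasing : ∀ {T} → StrictlyDecreasing T → NoRepeat (map ceil T) → Linked _>_ (map ceil T)
ceil-decreasing [] _ = []
ceil-decreasing [-] _ = [-]
ceil-decreasing {x ∷ y ∷ T} (lt ∷ l) h =
  key-reflect {y} {x} lt (λ e → h [] (ceil x) (map ceil T) (cong (λ c → ceil x ∷ c ∷ map ceil T) e)) ∷ ceil-decreasing l (NoRepeat-tail h)

Linked-∷ʳ : ∀ {A : Set} {R : A → A → Set} xs {x y} → Linked R (xs ∷ʳ x) → R x y → Linked R (xs ∷ʳ x ∷ʳ y)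
Linked-∷ʳ [] _ r = r ∷ [-]
Linked-∷ʳ (_ ∷ []) (r′ ∷ _) r = r′ ∷ r ∷ [-]
Linked-∷ʳ (_ ∷ x ∷ xs) (r′ ∷ l) r = r′ ∷ Linked-∷ʳ (x ∷ xs) l r

Linked-reverse : ∀ {A : Set} {R : A → A → Set} {xs} → Linked R xs → Linked (λ x y → R y x) (reverse xs)
Linked-reverse [] = []
Linked-reverse [-] = [-]
Linked-reverse {R = R} {x ∷ y ∷ xs} (r ∷ l) =
  subst (Linked _) (sym (trans (unfold-reverse x (y ∷ xs)) (cong (_∷ʳ x) (unfold-reverse y xs))))
    (Linked-∷ʳ (reverse xs) (subst (Linked _) (unfold-reverse y xs) (Linked-reverse l)) r)

sortAsc-increasing : ∀ {xs} → Linked _<_ xs → sortAsc xs ≡ xs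
sortAsc-increasing [] = refl
sortAsc-increasing [-] = refl
sortAsc-increasing (lt ∷ l) rewrite sortAsc-increasing l | ≤ᵇ-true (<⇒≤ lt) = refl

sortAsc-decreasing : ∀ {xs} → Linked _>_ xs → sortAsc xs ≡ reverse xs
sortAsc-decreasing l = go (Linked⇒AllPairs (λ p q → <-trans q p) l)
  where
  insert-max : ∀ {x} ys → All (_< x) ys → insertBy _≤ᵇ_ x ys ≡ ys ∷ʳ x
  insert-max [] [] = refl
  insert-max (y ∷ ys) (lt ∷ a) rewrite ≤ᵇ-false lt = cong (y ∷_) (insert-max ys a)
  go : ∀ {xs} → AllPairs _>_ xs → sortAsc xs ≡ reverse xs
  go [] = refl
  go {x ∷ xs} (a ∷ ps) rewrite go ps = trans (insert-max (reverse xs) (All-reverse xs a)) (sym (unfold-reverse x xs))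

-- The m-th entry (m ≥ 1) of an increasing list; d is put in position 0, and the
-- list is continued by consecutive numbers, so that the function is increasing.
ext : ℕ → List ℕ → ℕ → ℕ
ext d js zero = d
ext d [] (suc m) = ext (suc d) [] m
ext d (j ∷ js) (suc m) = ext j js m

Mono-step : ∀ {J} → (∀ m → J m < J (suc m)) → Mono J
Mono-step {J} h {m} {suc n} (s≤s m≤n) with m ≟ n
... | yes refl = h m
... | no m≢n = <-trans (Mono-step {J} h (≤∧≢⇒< m≤n m≢n)) (h n)

ext-Mono : ∀ {d js} → Linked _<_ (d ∷ js) → Mono (ext d js)
ext-Mono l = Mono-step (go l)
  where
  go : ∀ {d js} → Linked _<_ (d ∷ js) → ∀ m → ext d js m < ext d js (suc m)
  go {d} {[]} _ zero = n<1+n d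
  go {d} {[]} _ (suc m) = go {suc d} {[]} [-] m
  go {d} {j ∷ js} (lt ∷ _) zero = lt
  go {d} {j ∷ js} (_ ∷ l) (suc m) = go l m

map-ext : ∀ d js → map (ext d js) (ups (length js)) ≡ js
map-ext d js = trans (map-applyUpTo suc (ext d js) (length js)) (go d js)
  where
  go : ∀ d js → applyUpTo (ext d js ∘ suc) (length js) ≡ js
  go d [] = refl
  go d (j ∷ js) = cong (j ∷_) (go j js)

primedAt : List PL → ℕ → Bool
primedAt [] _ = false
primedAt (x ∷ _) zero = primed x
primedAt (_ ∷ xs) (suc m) = primedAt xs m

primedAt-last : ∀ xs t → primedAt (xs ∷ʳ t) (length xs) ≡ primed t
primedAt-last [] t = refl
primedAt-last (_ ∷ xs) t = primedAt-last xs t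

applyUpTo-letters : ∀ d T → applyUpTo (λ i → ext d (map ceil T) (suc i) , primedAt T i) (length T) ≡ T
applyUpTo-letters d [] = refl
applyUpTo-letters d ((c , p) ∷ T) = cong ((c , p) ∷_) (applyUpTo-letters c T)

downs : ℕ → List ℕ
downs k = reverse (ups k)

downs-suc : ∀ k → downs (suc k) ≡ suc k ∷ downs k
downs-suc k = trans (cong reverse (ups-∷ʳ k)) (reverse-++ (ups k) [ suc k ])

Full-ups : ∀ k → Full (suc k) (ups (suc k))
Full-ups zero = full []
Full-ups (suc k) = subst (Full (suc (suc k))) (sym (ups-∷ʳ (suc k))) (snoc (Full-ups k))
  where
  snoc : ∀ {k w} → Full k w → Full (suc k) (w ∷ʳ suc k)
  snoc (full p) = full (Path-++⁺ p (U∷ []))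

Full-downs : ∀ k → Full (suc k) (downs (suc k))
Full-downs k = subst (Full (suc k)) (sym (downs-suc k)) (full (go k))
  where
  go : ∀ a {r} → Path (suc a) r (downs a) 1 r
  go zero = []
  go (suc a) {r} = subst (λ w → Path (suc (suc a)) r w 1 r) (sym (downs-suc a)) (D∷ go a)

-- The parameter k is the length of the tail of T, so K = k + 1. All that is used of T later is
-- collected here, whether its row increases or decreases.
record Row (z : List ℕ) (T : List PL) (k : ℕ) : Set where
  field
    J       : ℕ → ℕ
    P       : ℕ → Bool
    mono    : Mono J
    inClass : Class J P (suc k) T
    entries : sortAsc (map ceil T) ≡ map J (ups (suc k))
    z-eq    : act z ≗ w⁻¹∘w-ups J (suc k)
    gapped  : Gapped J P (suc k)
    short   : Shortest z (suc k)

ups-split : ∀ {g k} → g < k → ∃[ s ] ups k ≡ ups g ++ suc g ∷ s × All (suc g <_) s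
ups-split {g} {suc k} (s≤s g≤k) with g ≟ k
... | yes refl = [] , ups-∷ʳ g , []
... | no g≢k with ups-split (≤∧≢⇒< g≤k g≢k)
...   | s , e , a = s ∷ʳ suc k , trans (ups-∷ʳ k) (trans (cong (_∷ʳ suc k) e) (++-assoc (ups g) (suc g ∷ s) [ suc k ])) ,
  ∷ʳ⁺ a (s≤s (≤∧≢⇒< g≤k g≢k))

module RowData {z : List ℕ} {k : ℕ} {J : ℕ → ℕ} {P : ℕ → Bool} (mono : Mono J) {w : List ℕ} (f : Full (suc k) w)
  (inRO : InRO z (word J P false w)) where

  z-eq : act z ≗ w⁻¹∘w-ups J (suc k)
  z-eq x = trans (sym (proj₁ (proj₂ (proj₁ inRO)) x))
    (trans (cong (λ v → act (demazure (reverse v ++ v)) x) (map-ceil-word {J} {P} {false} w))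
      (trans (act-demazure (reverse (map J w) ++ map J w) x) (w⁻¹∘w-Full mono f x)))

  len : length (word J P false w) ≡ suc k
  len = trans (length-map _ w) (Full-length f)

  short : Shortest z (suc k)
  short vs r e = ≤-trans (≤-reflexive (sym (trans (length-map ceil (word J P false w)) len))) (proj₂ (proj₂ (proj₁ inRO)) vs r e)

  marks : Marks (InCyc z) (word J P false w)
  marks = MarkedOK⇒Marks _ (proj₂ inRO)

  mark-at : ∀ p {m s} → w ≡ p ++ m ∷ s → prime P false (hd w) m ≡ true →
    InCyc z (applyLR (map J s) (J m)) (applyLR (map J s) (suc (J m)))
  mark-at p {m} {s} refl e =
    subst (λ l → InCyc z (applyLR l (J m)) (applyLR l (suc (J m)))) (sym (map-∘ s))
      (Marks-++ (map L p) (subst (Marks (InCyc z)) (map-++ L p (m ∷ s)) marks) e)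
    where L = letter J P false (hd (p ++ m ∷ s))

row-increasing : ∀ {z t ts} → primed t ≡ false → StrictlyIncreasing (t ∷ ts) → InRO z (t ∷ ts) → Row z (t ∷ ts) (length ts)
row-increasing {z} {t} {ts} unp inc inRO = record
  { J = J ; P = P ; mono = mono ; inClass = subst (Class J P (suc k)) word≡T (class false f)
  ; entries = trans (sortAsc-increasing inc′) (trans (sym (map-ext 0 js)) (cong (λ n → map J (ups (suc n))) (length-map ceil ts)))
  ; z-eq = z-eq ; gapped = gapped ; short = short }
  where
  T = t ∷ ts
  k = length ts
  js = map ceil T
  J = ext 0 js
  -- Rank g + 1 has index g in T, and an increasing row reaches it across the gap g.
  P = primedAt T
  f = Full-ups k
  inc′ = ceil-increasing inc (Reduced⇒NoRepeat (proj₁ (proj₁ inRO)))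
  positive : Linked _<_ (0 ∷ js)
  positive with proj₁ (proj₁ (proj₁ inRO))
  ... | 1≤t ∷ _ = 1≤t ∷ inc′
  mono : Mono J
  mono = ext-Mono positive
  word≡T : word J P false (ups (suc k)) ≡ T
  word≡T = trans (map-applyUpTo suc (letter J P false 1) (suc k))
    (trans (applyUpTo-cong (suc k) (λ {i} _ → cong (J (suc i) ,_) (pr-eq i))) (applyUpTo-letters 0 T))
    where
    pr-eq : ∀ i → prime P false 1 (suc i) ≡ P i
    pr-eq zero = trans (prime-start 1) (sym unp)
    pr-eq (suc i) = prime-above (s≤s (s≤s z≤n))
  open RowData {z} {k} {J} {P} mono f (subst (InRO z) (sym word≡T) inRO)
  -- A prime on J (g + 1) marks a pair that begins with J (g + 1), as the later letters are larger.
  -- In a run z fixes this number, and the pair would be degenerate.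
  gapped : Gapped J P (suc k)
  gapped {g} 1≤g g<k Pg e with ups-split g<k
  ... | s , ups≡ , above with mark-at (ups g) ups≡ (trans (prime-above (s≤s 1≤g)) Pg)
  ...   | a<b , za≡b = n≮n _ (subst₂ _<_ fix za≡b′ a<b)
    where
    t′ = J (suc g)
    fix : applyLR (map J s) t′ ≡ t′
    fix = applyLR-fixes (map⁺ (All.map (λ lt → <⇒≢ (mono lt) , <⇒≢ (m<n⇒m<1+n (mono lt))) above))
    za≡b′ : applyLR (map J s) (suc t′) ≡ t′
    za≡b′ = trans (sym za≡b) (trans (cong (act z) fix) (trans (z-eq t′) (w⁻¹∘w-run-fixed mono 1≤g e g<k)))

row-decreasing : ∀ {z t ts} → Involution z → primed t ≡ false → StrictlyDecreasing (t ∷ ts) → InRO z (t ∷ ts) → Row z (t ∷ ts) (length ts)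
row-decreasing {z} {t} {ts} inv unp dec inRO = record
  { J = J ; P = P ; mono = mono ; inClass = subst (Class J P (suc k)) word≡T (class false f)
  ; entries = trans (sortAsc-decreasing dec′) (trans (sym js≡) (trans (sym (map-ext 0 js)) (cong (λ n → map J (ups n)) lenjs)))
  ; z-eq = z-eq ; gapped = gapped ; short = short }
  where
  T = t ∷ ts
  T′ = reverse T
  k = length ts
  js = map ceil T′
  J = ext 0 js
  P : ℕ → Bool
  -- A decreasing row crosses the gap g on its way down to rank g, which has index g - 1 in the
  -- reversed row.
  P g = primedAt T′ (pred g)
  f = Full-downs k
  dec′ = ceil-decreasing dec (Reduced⇒NoRepeat (proj₁ (proj₁ inRO)))
  js≡ : js ≡ reverse (map ceil T)
  js≡ = reverse-map ceil T
  lenT′ : length T′ ≡ suc k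
  lenT′ = length-reverse T
  lenjs : length js ≡ suc k
  lenjs = trans (length-map ceil T′) lenT′
  positive : ∀ js → All (1 ≤_) js → Linked _<_ js → Linked _<_ (0 ∷ js)
  positive [] _ _ = [-]
  positive (j ∷ js) (1≤j ∷ _) l = 1≤j ∷ l
  mono : Mono J
  mono = ext-Mono (positive js (subst (All (1 ≤_)) (sym js≡) (All-reverse _ (proj₁ (proj₁ (proj₁ inRO)))))
    (subst (Linked _<_) (sym js≡) (Linked-reverse dec′)))
  L = letter J P false (suc k)
  map≡T′ : map L (ups (suc k)) ≡ T′
  map≡T′ = trans (map-applyUpTo suc L (suc k))
    (trans (applyUpTo-cong (suc k) (λ {i} i<k → cong (J (suc i) ,_) (pr-eq i i<k)))
      (trans (cong (applyUpTo _) (sym lenT′)) (applyUpTo-letters 0 T′)))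
    where
    last : primedAt T′ k ≡ false
    last = trans (cong₂ primedAt (unfold-reverse t ts) (sym (length-reverse ts))) (trans (primedAt-last (reverse ts) t) unp)
    pr-eq : ∀ i → i < suc k → prime P false (suc k) (suc i) ≡ primedAt T′ i
    pr-eq i (s≤s i≤k) with i ≟ k
    ... | yes refl = trans (prime-start (suc i)) (sym last)
    ... | no i≢k = prime-below (s≤s (≤∧≢⇒< i≤k i≢k))
  hd≡ : hd (downs (suc k)) ≡ suc k
  hd≡ = cong hd (downs-suc k)
  word≡T : word J P false (downs (suc k)) ≡ T
  word≡T = begin
    map (letter J P false (hd (downs (suc k)))) (downs (suc k)) ≡⟨ cong (λ h → map (letter J P false h) (downs (suc k))) hd≡ ⟩
    map L (reverse (ups (suc k)))     ≡⟨ reverse-map L (ups (suc k)) ⟩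
    reverse (map L (ups (suc k)))     ≡⟨ cong reverse map≡T′ ⟩
    reverse (reverse T)               ≡⟨ reverse-involutive T ⟩
    T                                 ∎
    where open ≡-Reasoning
  open RowData {z} {k} {J} {P} mono f (subst (InRO z) (sym word≡T) inRO)
  downs-split : ∀ {g} → 1 ≤ g → g < suc k → ∃[ p ] downs (suc k) ≡ p ++ g ∷ downs (pred g)
  downs-split {suc g} _ g<k with ups-split (<⇒≤ g<k)
  ... | s , e , _ = reverse s , trans (cong reverse e) (trans (reverse-++ (ups g) (suc g ∷ s))
    (trans (cong (_++ downs g) (unfold-reverse (suc g) s)) (++-assoc (reverse s) [ suc g ] (downs g))))
  -- Here the upper end of the marked pair is the fixed point J (g + 1) = J g + 1; since z is an
  -- involution, the lower end would have to be the same number.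
  gapped : Gapped J P (suc k)
  gapped {g} 1≤g g<k Pg e with downs-split 1≤g g<k
  ... | p , downs≡ with mark-at p downs≡ (trans (prime-below (subst (g <_) (sym hd≡) g<k)) Pg)
  ...   | a<b , za≡b = <⇒≢ a<b (sym b≡a)
    where
    b = applyLR (map J (downs (pred g))) (suc (J g))
    below : All (_< g) (downs (pred g))
    below = All-reverse _ (All.map (λ (_ , lt) → <-≤-trans lt (≤-reflexive (suc-pred g {{>-nonZero 1≤g}}))) (ups-range (pred g)))
    fix : b ≡ suc (J g)
    fix = applyLR-fixes (map⁺ (All.map (λ lt → >⇒≢ (m<n⇒m<1+n (mono lt)) , >⇒≢ (s≤s (mono lt))) below))
    b≡a : b ≡ applyLR (map J (downs (pred g))) (J g)
    b≡a = begin
      b                ≡⟨ trans fix e ⟩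
      J (suc g)        ≡⟨ w⁻¹∘w-run-fixed mono 1≤g e g<k ⟨
      w⁻¹∘w-ups J (suc k) (J (suc g)) ≡⟨ z-eq (J (suc g)) ⟨
      act z (J (suc g)) ≡⟨ cong (act z) (trans fix e) ⟨
      act z b          ≡⟨ cong (act z) za≡b ⟨
      act z (act z _)  ≡⟨ proj₂ inv _ ⟩
      _                ∎
      where open ≡-Reasoning

row : ∀ {z t ts} → Involution z → OReducedRow z (t ∷ ts) → Row z (t ∷ ts) (length ts)
row inv (unp , inj₁ inc , inRO) = row-increasing unp inc inRO
row inv (unp , inj₂ dec , inRO) = row-decreasing inv unp dec inRO

-- The largest entry is the last letter of a word for z, and a last letter leaves a descent of z.
row-bound : ∀ {n z T k} → NoDescAbove n z → (R : Row z T k) → Row.J R (suc k) ≤ n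
row-bound {n} {z} {T} {k} nd R = ≮⇒≥ λ n<J → <⇒≱ (nd (J (suc k)) n<J)
  (subst₂ _≤_ (sym (eq (suc (J (suc k))))) (sym (eq (J (suc k)))) (w⁻¹∘w-last (map J (ups k)) (J (suc k))))
  where
  open Row R
  eq : ∀ x → act z x ≡ w⁻¹∘w (map J (ups k) ∷ʳ J (suc k)) x
  eq x = trans (z-eq x) (trans (cong (λ f → f x) (w⁻¹∘w-ups-def J (suc k))) (cong (λ l → w⁻¹∘w l x) (map-ups-∷ʳ J k)))

-- The hook permutation and all of its admissible words.

LongTransposition : ℕ → (ℕ → ℕ) → Set
LongTransposition K f = f 1 ≡ suc K × f (suc K) ≡ 1 × (∀ {x} → x ≢ 1 → x ≢ suc K → f x ≡ x)

LongTransposition-≗ : ∀ {K f g} → LongTransposition K f → LongTransposition K g → f ≗ g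
LongTransposition-≗ {K} (f₁ , f₂ , f₃) (g₁ , g₂ , g₃) x with x ≟ 1 | x ≟ suc K
... | yes refl | _ = trans f₁ (sym g₁)
... | no _ | yes refl = trans f₂ (sym g₂)
... | no p | no q = trans (f₃ p q) (sym (g₃ p q))

id-Mono : Mono id
id-Mono lt = lt

-- For J = id every entry after the first continues a run, and conjugation by s_c turns (1 , c) into
-- (1 , c + 1).
w⁻¹∘w-ups-id : ∀ k → LongTransposition (suc k) (w⁻¹∘w-ups id (suc k))
w⁻¹∘w-ups-id zero =
  trans (eq 1) (sw-at₀ 1) , trans (eq 2) (sw-at₁ 1) , λ {x} p q → trans (eq x) (sw-off p q)
  where
  eq : ∀ x → w⁻¹∘w-ups id 1 x ≡ sw 1 x
  eq x = trans (w⁻¹∘w-gap id-Mono 0 (inj₁ refl) x) (cong (sw 1) (w⁻¹∘w-ups-above id-Mono 0 (inj₁ refl)))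
w⁻¹∘w-ups-id (suc k) with w⁻¹∘w-ups-id k
... | f₁ , f₂ , f₃ = at-1 , at-top , λ {x} → other {x}
  where
  c = suc (suc k)
  y = w⁻¹∘w-ups id (suc k)
  eq : ∀ x → w⁻¹∘w-ups id c x ≡ sw c (y (sw c x))
  eq = w⁻¹∘w-run id-Mono (suc k) (s≤s z≤n) refl
  1<c : 1 < c
  1<c = s≤s (s≤s z≤n)
  at-1 : w⁻¹∘w-ups id c 1 ≡ suc c
  at-1 = trans (eq 1) (trans (cong (sw c ∘ y) (sw-below 1<c)) (trans (cong (sw c) f₁) (sw-at₀ c)))
  at-top : w⁻¹∘w-ups id c (suc c) ≡ 1
  at-top = trans (eq (suc c)) (trans (cong (sw c ∘ y) (sw-at₁ c)) (trans (cong (sw c) f₂) (sw-below 1<c)))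
  other : ∀ {x} → x ≢ 1 → x ≢ suc c → w⁻¹∘w-ups id c x ≡ x
  other {x} p q with x ≟ c
  ... | yes refl = trans (eq c) (trans (cong (sw c ∘ y) (sw-at₀ c)) (trans (cong (sw c) (f₃ (λ ()) (>⇒≢ (n<1+n c)))) (sw-at₁ c)))
  ... | no r = trans (eq x) (trans (cong (sw c ∘ y) (sw-off r q)) (trans (cong (sw c) (f₃ p r)) (sw-off r q)))

act-0 : ∀ {w} → Word w → act w 0 ≡ 0
act-0 [] = refl
act-0 (1≤i ∷ wd) rewrite act-0 wd = sw-below 1≤i

Hook : List ℕ → ℕ → Set
Hook λ′ K = entry λ′ 1 ≡ K × (∀ {i} → 2 ≤ i → i ≤ K → entry λ′ i ≡ 1) × (∀ {i} → K < i → 2 ≤ i → entry λ′ i ≡ 0)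

-- The first row of the diagram gives w 1 = K + 1, the rows 2, ..., K with one box force fixed
-- points, the value 1 is left for position K + 1, and the empty rows beyond force fixed points
-- again.
wλ-hook : ∀ {λ′ wl K} → 1 ≤ K → Hook λ′ K → IsWLambda λ′ wl → LongTransposition K (act wl)
wλ-hook {λ′} {wl} {K} 1≤K (h₁ , h₂ , h₃) (wd , rothe) = w1 , w-top , λ {x} → other {x}
  where
  w = act wl
  w⁻¹ = applyLR wl
  row⇒ : ∀ {i j} → i < j → w j < w i → w j ≤ entry λ′ i
  row⇒ {i} {j} i<j lt = proj₂ (proj₂ (Equivalence.to (rothe i (w j)) (j , i<j , lt , refl)))
  row⇐ : ∀ {i m} → 1 ≤ i → 1 ≤ m → m ≤ entry λ′ i → m < w i
  row⇐ {i} {m} 1≤i 1≤m le with Equivalence.from (rothe i m) (1≤i , 1≤m , le)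
  ... | j , _ , lt , refl = lt
  w≢0 : ∀ {i} → 1 ≤ i → 1 ≤ w i
  w≢0 {i} 1≤i with w i in e
  ... | zero = contradiction (act-inj wl {i} {0} (trans e (sym (act-0 wd)))) (>⇒≢ 1≤i)
  ... | suc _ = s≤s z≤n
  w1 : w 1 ≡ suc K
  w1 with <-cmp (w 1) (suc K)
  ... | tri≈ _ e _ = e
  ... | tri< lt _ _ = contradiction (row⇐ {1} {K} ≤-refl 1≤K (≤-reflexive (sym h₁))) (≤⇒≯ (s≤s⁻¹ lt))
  ... | tri> _ _ gt = contradiction (subst₂ _≤_ (act-applyLR wl (suc K)) h₁ (row⇒ {1} 1<j (subst (_< w 1) (sym (act-applyLR wl (suc K))) gt))) 1+n≰n
    where
    j = w⁻¹ (suc K)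
    1<j : 1 < j
    1<j with j in e
    ... | zero = contradiction (trans (sym (act-0 wd)) (trans (cong w (sym e)) (act-applyLR wl (suc K)))) λ ()
    ... | suc zero = contradiction (trans (cong w (sym e)) (act-applyLR wl (suc K))) (>⇒≢ gt)
    ... | suc (suc _) = s≤s (s≤s z≤n)
  entry≤1 : ∀ {i} → 2 ≤ i → entry λ′ i ≤ 1
  entry≤1 {i} 2≤i with i ≤? K
  ... | yes le = ≤-reflexive (h₂ 2≤i le)
  ... | no gt = ≤-trans (≤-reflexive (h₃ (≰⇒> gt) 2≤i)) z≤n
  -- If the value i is still to come, then w i > i would put the column i ≥ 2 into row i of the
  -- diagram, which has at most one box.
  core : ∀ {i} → 2 ≤ i → (∀ {j} → j < i → w j ≢ i) → w i ≡ i ⊎ w i < i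
  core {i} 2≤i h with <-cmp (w i) i
  ... | tri< lt _ _ = inj₂ lt
  ... | tri≈ _ e _ = inj₁ e
  ... | tri> _ _ gt with <-cmp (w⁻¹ i) i
  ...   | tri< lt _ _ = contradiction (act-applyLR wl i) (h lt)
  ...   | tri≈ _ e _ = inj₁ (trans (cong w (sym e)) (act-applyLR wl i))
  ...   | tri> _ _ lt = contradiction
    (≤-trans (subst (_≤ entry λ′ i) (act-applyLR wl i) (row⇒ lt (subst (_< w i) (sym (act-applyLR wl i)) gt))) (entry≤1 2≤i)) (<⇒≱ 2≤i)
  -- Strong induction with bound b. A value below i is impossible: 2, ..., i - 1 are taken by
  -- earlier positions, and the box in row i says 1 < w i.
  lower : ∀ b {i} → i < b → 2 ≤ i → i ≤ K → w i ≡ i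
  lower (suc b) {i} (s≤s i≤b) 2≤i i≤K with core 2≤i miss
    where
    miss : ∀ {j} → j < i → w j ≢ i
    miss {zero} _ e = contradiction (trans (sym (act-0 wd)) e) (<⇒≢ (<⇒≤ 2≤i))
    miss {suc zero} _ e = contradiction (trans (sym w1) e) (>⇒≢ (s≤s i≤K))
    miss {suc (suc j)} j<i e =
      <⇒≢ j<i (trans (sym (lower b (<-≤-trans j<i i≤b) (s≤s (s≤s z≤n)) (≤-trans (<⇒≤ j<i) i≤K))) e)
  ... | inj₁ e = e
  ... | inj₂ lt with w i in e | w≢0 {i} (<⇒≤ 2≤i)
  ...   | suc zero | _ = contradiction (subst (1 <_) e (row⇐ {i} {1} (<⇒≤ 2≤i) ≤-refl (≤-reflexive (sym (h₂ 2≤i i≤K))))) (n≮n 1)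
  ...   | suc (suc m) | _ = contradiction (act-inj wl {i} {suc (suc m)}
    (trans e (sym (lower b (<-≤-trans lt i≤b) (s≤s (s≤s z≤n)) (≤-trans (<⇒≤ lt) i≤K))))) (>⇒≢ lt)
  w-top : w (suc K) ≡ 1
  w-top with <-cmp (w⁻¹ 1) (suc K)
  ... | tri≈ _ e _ = trans (cong w (sym e)) (act-applyLR wl 1)
  ... | tri> _ _ gt with w (suc K) ≟ 1
  ...   | yes e = e
  ...   | no ne = contradiction
    (≤-trans (subst (_≤ entry λ′ (suc K)) (act-applyLR wl 1) (row⇒ gt (subst (_< w (suc K)) (sym (act-applyLR wl 1)) (≤∧≢⇒< (w≢0 (s≤s z≤n)) (ne ∘ sym))))) (≤-reflexive (h₃ (n<1+n K) (s≤s 1≤K)))) λ ()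
  w-top | tri< lt _ _ = absurd (w⁻¹ 1) lt (act-applyLR wl 1)
    where
    absurd : ∀ j → j < suc K → w j ≡ 1 → w (suc K) ≡ 1
    absurd zero _ e = contradiction (trans (sym (act-0 wd)) e) λ ()
    absurd (suc zero) _ e = contradiction (suc-injective (trans (sym w1) e)) (>⇒≢ 1≤K)
    absurd (suc (suc j)) j<K e = contradiction (trans (sym (lower _ (n<1+n _) (s≤s (s≤s z≤n)) (s≤s⁻¹ j<K))) e) λ ()
  upper : ∀ b {i} → i < b → suc K < i → w i ≡ i
  upper (suc b) {i} (s≤s i≤b) K<i with core (≤-trans (s≤s (s≤s z≤n)) K<i) (λ {j} lt e → miss j lt e)
    where
    below : ∀ j → 2 ≤ j → j < i → j ≢ suc K → w j ≡ j
    below j 2≤j j<i ne with <-cmp j (suc K)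
    ... | tri< lt _ _ = lower (suc j) (n<1+n j) 2≤j (s≤s⁻¹ lt)
    ... | tri≈ _ e _ = contradiction e ne
    ... | tri> _ _ gt = upper b (<-≤-trans j<i i≤b) gt
    miss : ∀ j → j < i → w j ≢ i
    miss zero _ e = contradiction (trans (sym (act-0 wd)) e) (<⇒≢ (<-trans (s≤s z≤n) K<i))
    miss (suc zero) _ e = contradiction (trans (sym w1) e) (<⇒≢ K<i)
    miss j@(suc (suc _)) j<i e with j ≟ suc K
    ... | yes refl = contradiction (trans (sym w-top) e) (<⇒≢ (≤-<-trans (s≤s z≤n) K<i))
    ... | no ne = contradiction (trans (sym (below j (s≤s (s≤s z≤n)) j<i ne)) e) (<⇒≢ j<i)
  ... | inj₁ e = e
  ... | inj₂ lt = absurd (w i) refl lt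
    where
    absurd : ∀ m → w i ≡ m → m < i → w i ≡ i
    absurd zero e _ = contradiction (subst (1 ≤_) e (w≢0 (<⇒≤ (≤-<-trans 1≤K (<-trans (n<1+n K) K<i))))) λ ()
    absurd (suc zero) e _ = contradiction (act-inj wl (trans e (sym w-top))) (>⇒≢ K<i)
    absurd m@(suc (suc _)) e m<i with <-cmp m (suc K)
    ... | tri< m<K _ _ = contradiction (act-inj wl (trans e (sym (lower _ (n<1+n m) (s≤s (s≤s z≤n)) (s≤s⁻¹ m<K))))) (>⇒≢ m<i)
    ... | tri≈ _ m≡K _ = contradiction (act-inj wl (trans e (trans m≡K (sym w1)))) (>⇒≢ (≤-<-trans 1≤K (<-trans (n<1+n K) K<i)))
    ... | tri> _ _ K<m = contradiction (act-inj wl (trans e (sym (upper b (<-≤-trans m<i i≤b) K<m)))) (>⇒≢ m<i)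
  other : ∀ {x} → x ≢ 1 → x ≢ suc K → w x ≡ x
  other {zero} _ _ = act-0 wd
  other {suc zero} p _ = contradiction refl p
  other {x@(suc (suc _))} p q with <-cmp x (suc K)
  ... | tri< lt _ _ = lower _ (n<1+n x) (s≤s (s≤s z≤n)) (s≤s⁻¹ lt)
  ... | tri≈ _ e _ = contradiction e q
  ... | tri> _ _ gt = upper _ (n<1+n x) gt

Unique-resp-↭ : ∀ {A : Set} {xs ys : List A} → xs ↭ ys → Unique xs → Unique ys
Unique-resp-↭ {A} p = ↭S.Unique-resp-↭ (setoid A) (↭⇒↭ₛ p)

Unique-++ˡ : ∀ {A : Set} (p : List A) {s} → Unique (p ++ s) → Unique p
Unique-++ˡ [] _ = []
Unique-++ˡ (x ∷ p) (a ∷ u) = ++⁻ˡ p a ∷ Unique-++ˡ p u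

-- No letter is read after both of its neighbours. This local form of "every prefix is an interval"
-- can be tested on descents of the involution.
NoValley : List ℕ → Set
NoValley ws = ∀ p {x s} → ws ≡ p ++ suc x ∷ s → x ∈ p → suc (suc x) ∈ p → ⊥

NoValley-init : ∀ ws {c} → NoValley (ws ∷ʳ c) → NoValley ws
NoValley-init ws {c} h p {x} {s} refl = h p (++-assoc p (suc x ∷ s) [ c ])

-- The last letter must be an end of the interval, for otherwise both of its neighbours precede it.
-- Removing it leaves a shorter interval.
NoValley⇒Path : ∀ d l ws → Unique ws → All (In l (suc d + l)) ws → (∀ {x} → In l (suc d + l) x → x ∈ ws) → NoValley ws →
  ∃[ a ] ∃[ s ] ws ≡ a ∷ s × Path a (suc a) s l (suc d + l)
NoValley⇒Path d l ws u ins all nv with reverseView ws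
NoValley⇒Path d l _ u ins all nv | [] with all {l} (≤-refl , s≤s (m≤n+m l d))
... | ()
NoValley⇒Path zero l _ u ins all nv | [] ∶ _ ∶ʳ c with ins
... | (l≤c , s≤s c≤l) ∷ [] with ≤-antisym l≤c c≤l
...   | refl = l , [] , refl , []
NoValley⇒Path zero l _ u ins all nv | (y ∷ ws) ∶ _ ∶ʳ c with ins | ∷ʳ⁻ {xs = y ∷ ws} ins
... | (l≤y , s≤s y≤l) ∷ _ | _ , (l≤c , s≤s c≤l) =
  contradiction (here (≤-antisym (≤-trans c≤l l≤y) (≤-trans y≤l l≤c))) (proj₁ (Unique⇒once (y ∷ ws) u))
NoValley⇒Path (suc d) l _ u ins all nv | ws ∶ _ ∶ʳ c with Unique⇒once ws u | ∷ʳ⁻ {xs = ws} ins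
... | c∉ , _ | ins′ , (l≤c , c<r) with l ≟ c | suc d + l ≟ c
...   | yes refl | _ = let a , s , e , p = NoValley⇒Path d (suc l) ws (Unique-++ˡ ws u) ins″ all′ (NoValley-init ws nv)
                       in a , s ∷ʳ l , cong (_∷ʳ l) e , subst (λ r → Path a (suc a) (s ∷ʳ l) l r) (+-suc (suc d) l) (Path-++⁺ p (D∷ []))
  where
  ins″ : All (In (suc l) (suc d + suc l)) ws
  ins″ = All.tabulate λ {x} x∈ → ≤∧≢⇒< (proj₁ (All.lookup ins′ x∈)) (λ { refl → c∉ x∈ }) ,
    subst (x <_) (sym (+-suc (suc d) l)) (proj₂ (All.lookup ins′ x∈))
  all′ : ∀ {x} → In (suc l) (suc d + suc l) x → x ∈ ws
  all′ {x} (l<x , x<r) with ∈-++⁻ ws (all (<⇒≤ l<x , subst (x <_) (+-suc (suc d) l) x<r))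
  ... | inj₁ x∈ = x∈
  ... | inj₂ (here refl) = contradiction l<x (n≮n l)
...   | no _ | yes refl = let a , s , e , p = NoValley⇒Path d l ws (Unique-++ˡ ws u) ins″ all′ (NoValley-init ws nv)
                          in a , s ∷ʳ c , cong (_∷ʳ c) e , Path-++⁺ p (U∷ [])
  where
  ins″ : All (In l (suc d + l)) ws
  ins″ = All.tabulate λ {x} x∈ → proj₁ (All.lookup ins′ x∈) ,
    ≤∧≢⇒< (s≤s⁻¹ (proj₂ (All.lookup ins′ x∈))) (λ { refl → c∉ x∈ })
  all′ : ∀ {x} → In l (suc d + l) x → x ∈ ws
  all′ {x} (l≤x , x<r) with ∈-++⁻ ws (all (l≤x , m<n⇒m<1+n x<r))
  ... | inj₁ x∈ = x∈
  ... | inj₂ (here refl) = contradiction x<r (n≮n _)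
...   | no l≢c | no r≢c = ⊥-elim (valley c refl (≤∧≢⇒< l≤c l≢c))
  where
  valley : ∀ c′ → c′ ≡ c → l < c′ → ⊥
  valley (suc c′) refl l<c = nv ws refl (other ≤-refl (s≤s⁻¹ l<c) (<-trans (n<1+n c′) c<r) (<⇒≢ (n<1+n c′)))
    (other ≤-refl (<⇒≤ (<-trans l<c (n<1+n _))) (s≤s (≤∧≢⇒< (s≤s⁻¹ c<r) (r≢c ∘ sym))) (>⇒≢ (n<1+n _)))
    where
    other : ∀ {x y} → x ≤ y → l ≤ x → x < suc (suc d) + l → x ≢ suc c′ → x ∈ ws
    other _ l≤x x<r x≢c with ∈-++⁻ ws (all (l≤x , x<r))
    ... | inj₁ x∈ = x∈
    ... | inj₂ (here refl) = contradiction refl x≢c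

-- Without the letter x nothing passes from the positions up to x to values above x, yet 1 is sent
-- to K + 1.
w⁻¹∘w-letters : ∀ {ws K} → LongTransposition K (w⁻¹∘w ws) → ∀ {x} → In 1 (suc K) x → x ∈ ws
w⁻¹∘w-letters {ws} {K} (e , _) {x} (1≤x , s≤s x≤K) with _∈?_ _≟_ x ws
... | yes x∈ = x∈
... | no x∉ = contradiction (▹▹-preserves-≤ {id} {x} {reverse ws ++ ws} {1} x∉′ id 1≤x) (<⇒≱ (subst (x <_) (sym e) (s≤s x≤K)))
  where
  x∉′ : x ∉ reverse ws ++ ws
  x∉′ x∈ with ∈-++⁻ (reverse ws) x∈
  ... | inj₁ x∈r = x∉ (∈-reverse x∈r)
    where
    ∈-reverse : x ∈ reverse ws → x ∈ ws
    ∈-reverse x∈r = subst (x ∈_) (reverse-involutive ws) (reverse⁺ x∈r)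
  ... | inj₂ x∈w = x∉ x∈w

-- Reading x + 1 leaves a descent at the positions x + 1 and x + 2. If x and x + 2 came earlier, no
-- later letter destroys it, although the long transposition fixes both positions.
NoValley-long : ∀ {ws K} → LongTransposition K (w⁻¹∘w ws) → Unique ws → All (In 1 (suc K)) ws → NoValley ws
NoValley-long {ws} {K} (_ , _ , fix) u ins p {x} {s} refl x∈ x+2∈ =
  <⇒≱ (n<1+n (suc x)) (subst₂ _≤_ (fix (λ ()) (<⇒≢ x+2<K)) (fix (λ { refl → n≮n _ (proj₁ (All.lookup ins (∈-++⁺ˡ x∈))) }) (<⇒≢ (<-trans (n<1+n _) x+2<K))) desc)
  where
  x+2<K : suc (suc x) < suc K
  x+2<K = proj₂ (All.lookup ins (∈-++⁺ˡ x+2∈))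
  g = id ▹▹ (reverse (p ++ suc x ∷ s) ++ p)
  apart : All (λ j → suc x ≢ suc j × suc (suc x) ≢ j) s
  apart = All.tabulate λ {j} j∈ →
    (λ { refl → disjoint x∈ j∈ }) , (λ { refl → disjoint x+2∈ j∈ })
    where
    disjoint : ∀ {y} → y ∈ p → y ∈ s → ⊥
    disjoint {y} y∈p y∈s with ∈-∃++ y∈s
    ... | s₁ , s₂ , refl = proj₁ (Unique⇒once (p ++ suc x ∷ s₁) (subst Unique (sym (++-assoc p (suc x ∷ s₁) (y ∷ s₂))) u)) (∈-++⁺ˡ y∈p)
  split : w⁻¹∘w (p ++ suc x ∷ s) ≡ g ▹ suc x ▹▹ s
  split = trans (cong (id ▹▹_) (sym (++-assoc (reverse (p ++ suc x ∷ s)) p (suc x ∷ s))))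
    (▹▹-++ id (reverse (p ++ suc x ∷ s) ++ p) (suc x ∷ s))
  desc : w⁻¹∘w (p ++ suc x ∷ s) (suc (suc x)) ≤ w⁻¹∘w (p ++ suc x ∷ s) (suc x)
  desc = subst (λ f → f (suc (suc x)) ≤ f (suc x)) (sym split) (▹▹-descent apart (▹-decreases g (suc x)))

noPrime : ℕ → Bool
noPrime _ = false

prime-noPrime : ∀ {p₀ m₀ m} → m ≢ m₀ → prime noPrime p₀ m₀ m ≡ false
prime-noPrime {p₀} {m₀} {m} ne with <-cmp m m₀
... | tri< lt _ _ = prime-below lt
... | tri≈ _ e _ = contradiction e ne
... | tri> _ _ gt = prime-above gt

-- Only the first letter can be primed: the only cycle is (1 , K + 1), whereas a
-- later letter x = r is marked by (r , _) and x = l - 1 by (_ , l), with 1 < l < K + 1.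
long-unprimed : ∀ {z K l r} i → LongTransposition K (act z) → 1 ≤ l → l < r → Path l r (map ceil i) 1 (suc K) → MarkedOK z i →
  All (λ x → primed x ≡ false) i
long-unprimed [] _ _ _ _ _ = []
long-unprimed {z} {K} ((_ , true) ∷ i) lt@(e₁ , e₂ , e₃) 1≤l l<r (U∷_ {l} {r} p) (h , m) with h refl
... | a<b , za≡b = contradiction a<b (≤⇒≯ b≤a)
  where
  fixed : applyLR (map ceil i) r ≡ r
  fixed = applyLR-fixes (All.map (λ { (inj₁ x<l) → >⇒≢ (<-trans x<l l<r) , >⇒≢ (≤-<-trans x<l l<r) ; (inj₂ r<x) → <⇒≢ r<x , <⇒≢ (m<n⇒m<1+n r<x) }) (Path-outside p))
  1<r : 1 < r
  1<r = ≤-<-trans 1≤l l<r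
  zr≤r : act z r ≤ r
  zr≤r with r ≟ suc K
  ... | yes refl = ≤-trans (≤-reflexive e₂) (<⇒≤ 1<r)
  ... | no ne = ≤-reflexive (e₃ (>⇒≢ 1<r) ne)
  b≤a : applyLR (map ceil i) (suc r) ≤ applyLR (map ceil i) r
  b≤a = subst₂ _≤_ (trans (cong (act z) (sym fixed)) za≡b) (sym fixed) zr≤r
long-unprimed {z} {K} ((_ , true) ∷ i) lt@(e₁ , e₂ , e₃) 1≤l l<r (D∷_ {l} {r} p) (h , m) with h refl
... | a<b , za≡b = contradiction (suc-injective (trans (sym fixed) (trans (sym za≡b) (big _ a<b za≡b)))) (<⇒≢ (s≤s⁻¹ (<-≤-trans l<r r≤K)))
  where
  r≤K : r ≤ suc K
  r≤K = Path-r≤ p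
  fixed : applyLR (map ceil i) (suc l) ≡ suc l
  fixed = applyLR-fixes (All.map (λ { (inj₁ x<l) → >⇒≢ (m<n⇒m<1+n x<l) , >⇒≢ (s≤s x<l) ; (inj₂ r≤x) → <⇒≢ (<-≤-trans l<r r≤x) , <⇒≢ (m<n⇒m<1+n (<-≤-trans l<r r≤x)) }) (Path-outside p))
  big : ∀ a {b} → a < b → act z a ≡ b → act z a ≡ suc K
  big a {b} a<b e with a ≟ 1 | a ≟ suc K
  ... | yes refl | _ = e₁
  ... | no _ | yes refl = contradiction (subst (suc K <_) (trans (sym e) e₂) a<b) (≤⇒≯ (s≤s z≤n))
  ... | no p | no q = contradiction (trans (sym (e₃ p q)) e) (<⇒≢ a<b)
long-unprimed ((_ , false) ∷ i) lt 1≤l l<r (U∷ p) (_ , m) = refl ∷ long-unprimed i lt 1≤l (m<n⇒m<1+n l<r) p m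
long-unprimed ((_ , false) ∷ i) lt 1≤l l<r (D∷ p) (_ , m) = refl ∷ long-unprimed i lt (Path-l≥ p) (<-trans (n<1+n _) l<r) p m

module Target {z : List ℕ} {k : ℕ} (long : LongTransposition (suc k) (act z)) where

  target-z-eq : act z ≗ w⁻¹∘w-ups id (suc k)
  target-z-eq = LongTransposition-≗ long (w⁻¹∘w-ups-id k)

  demazure⇒long : ∀ vs → demazure (reverse vs ++ vs) ≈ₚ z → LongTransposition (suc k) (w⁻¹∘w vs)
  demazure⇒long vs e = trans (eq 1) (proj₁ long) , trans (eq _) (proj₁ (proj₂ long)) , λ p q → trans (eq _) (proj₂ (proj₂ long) p q)
    where
    eq : w⁻¹∘w vs ≗ act z
    eq x = trans (sym (act-demazure (reverse vs ++ vs) x)) (e x)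

  target-short : Shortest z (suc k)
  target-short vs _ e = ≤-trans (≤-reflexive (sym (length-applyUpTo suc (suc k))))
    (Unique⊆⇒length≤ {ys = vs} (Full-Unique (Full-ups k)) (λ x∈ → w⁻¹∘w-letters (demazure⇒long vs e) (All.lookup (ups-range (suc k)) x∈)))

  target-gapped : ∀ {J} → Gapped J noPrime (suc k)
  target-gapped _ _ ()

  target-InRO : ∀ {v} → Class id noPrime (suc k) v → InRO z v
  target-InRO = class-InRO id-Mono target-z-eq target-short (λ {g} → target-gapped {id} {g})

  target-Class : ∀ {i} → InRO z i → Class id noPrime (suc k) i
  target-Class {i} ((_ , dem , shortest) , marked) = finish i path marked
    where
    ws = map ceil i
    long′ = demazure⇒long ws dem
    -- The word 1 2 ... K is itself admissible, so minimality of the given word bounds its length by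
    -- K; together with the presence of all K letters this makes it a permutation of them.
    ws≤ : length ws ≤ suc k
    ws≤ with target-InRO (class false (Full-ups k))
    ... | (red , dem′ , _) , _ = ≤-trans (shortest _ red dem′)
      (≤-reflexive (trans (length-map ceil (word id noPrime false (ups (suc k)))) (trans (length-map _ (ups (suc k))) (length-applyUpTo suc (suc k)))))
    perm : ups (suc k) ↭ ws
    perm with Unique⊆⇒↭ (Full-Unique (Full-ups k)) (λ x∈ → w⁻¹∘w-letters long′ (All.lookup (ups-range (suc k)) x∈))
    ... | [] , p = ↭-sym (↭-trans p (↭-reflexive (++-identityʳ _)))
    ... | y ∷ zs , p = contradiction (≤-trans (≤-reflexive (sym (trans (↭-length p) (trans (length-++ (ups (suc k))) (cong (_+ suc (length zs)) (length-applyUpTo suc (suc k))))))) ws≤) (m+1+n≰m (suc k))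
    ins = All-resp-↭ perm (ups-range (suc k))
    unique = Unique-resp-↭ perm (Full-Unique (Full-ups k))
    path : ∃[ a ] ∃[ s ] ws ≡ a ∷ s × Path a (suc a) s 1 (suc (suc k))
    path = subst (λ r → ∃[ a ] ∃[ s ] ws ≡ a ∷ s × Path a (suc a) s 1 r) (+-comm (suc k) 1)
      (NoValley⇒Path k 1 ws unique
        (subst (λ r → All (In 1 r) ws) (+-comm 1 (suc k)) ins)
        (λ {x} (p , q) → w⁻¹∘w-letters long′ (p , subst (x <_) (+-comm (suc k) 1) q))
        (NoValley-long long′ unique ins))
    finish : ∀ i → (∃[ a ] ∃[ s ] map ceil i ≡ a ∷ s × Path a (suc a) s 1 (suc (suc k))) → MarkedOK z i → Class id noPrime (suc k) i
    finish ((a , p₀) ∷ i) (_ , _ , refl , path) (_ , m) = subst (Class id noPrime (suc k)) eq (class p₀ (full path))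
      where
      unprimed = long-unprimed i long (Path-l≥ path) (n<1+n a) path m
      tail : ∀ i → All (λ x → x ≢ a) (map ceil i) → All (λ x → primed x ≡ false) i → map (letter id noPrime p₀ a) (map ceil i) ≡ i
      tail [] _ _ = refl
      tail ((x , _) ∷ i) (ne ∷ nes) (refl ∷ us) = cong₂ _∷_ (cong (x ,_) (prime-noPrime ne)) (tail i nes us)
      eq : word id noPrime p₀ (a ∷ map ceil i) ≡ (a , p₀) ∷ i
      eq = cong₂ _∷_ (cong (a ,_) (prime-start a))
        (tail i (All.map (λ { (inj₁ lt) → <⇒≢ lt ; (inj₂ gt) → >⇒≢ gt }) (Path-outside path)) unprimed)

-- The pairing rule and the operators e_i and f_i on two consecutive factors.

MonoL : (ℕ → PL) → Set
MonoL L = ∀ {m n} → m < n → ceil (L m) < ceil (L n)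

AllAbove : List ℕ → List ℕ → Set
AllAbove u v = All (λ b → All (_< b) v) u

elemℕ-false : ∀ {m cs} → All (m ≢_) cs → elemℕ m cs ≡ false
elemℕ-false [] = refl
elemℕ-false (ne ∷ nes) rewrite ≡ᵇ-false ne = elemℕ-false nes

filterᵇ-none : ∀ {A : Set} (f : A → Bool) xs → (∀ x → f x ≡ false) → filterᵇ f xs ≡ []
filterᵇ-none f [] h = refl
filterᵇ-none f (x ∷ xs) h rewrite h x = filterᵇ-none f xs h

<∧≤-false : ∀ x c → (x <ᵇ c) ∧ (c ≤ᵇ x + 0) ≡ false
<∧≤-false x c with x <? c
... | yes lt rewrite +-identityʳ x | ≤ᵇ-false lt | <ᵇ-true lt = refl
... | no ge rewrite <ᵇ-false (≮⇒≥ ge) = refl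

≤∧<-false : ∀ y b → (y ≤ᵇ b) ∧ (b <ᵇ y) ≡ false
≤∧<-false y b with b <? y
... | yes lt rewrite ≤ᵇ-false lt = refl
... | no ge rewrite <ᵇ-false (≮⇒≥ ge) | ≤ᵇ-true (≮⇒≥ ge) = refl

-- As letters never repeat, the moved letter always fits into the other factor
-- unchanged (q = 0), so that no primes are swapped.
eOp-eval : ∀ i a {ps uu w x} → pairing (at i a) (at (suc i) a) ≡ mkP ps uu w → maxL w ≡ just x →
  All (ceil x ≢_) (map ceil (at i a)) →
  eOp (suc i) a ≡ just (upd i (insertDec x (at i a)) (upd (suc i) (removeC (ceil x) (at (suc i) a)) a))
eOp-eval i a {ps} {x = x} e₁ e₂ ne rewrite e₁ | e₂ | elemℕ-false ne
  | filterᵇ-none (λ bc → (ceil x <ᵇ ceil (proj₂ bc)) ∧ (ceil (proj₂ bc) ≤ᵇ ceil x + 0)) ps (λ bc → <∧≤-false (ceil x) (ceil (proj₂ bc)))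
  | +-identityʳ (ceil x) = refl

eOp-none : ∀ i a {ps uu} → pairing (at i a) (at (suc i) a) ≡ mkP ps uu [] → eOp (suc i) a ≡ nothing
eOp-none i a e rewrite e = refl

fOp-eval : ∀ i a {ps w vv y} → pairing (at i a) (at (suc i) a) ≡ mkP ps w vv → minL w ≡ just y →
  All (ceil y ≢_) (map ceil (at (suc i) a)) →
  fOp (suc i) a ≡ just (upd i (removeC (ceil y) (at i a)) (upd (suc i) (insertDec y (at (suc i) a)) a))
fOp-eval i a {ps} {y = y} e₁ e₂ ne rewrite e₁ | e₂ | elemℕ-false ne
  | filterᵇ-none (λ bc → (ceil y ≤ᵇ ceil (proj₁ bc)) ∧ (ceil (proj₁ bc) <ᵇ ceil y)) ps (λ bc → ≤∧<-false (ceil y) (ceil (proj₁ bc))) = refl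

fOp-none : ∀ i a {ps vv} → pairing (at i a) (at (suc i) a) ≡ mkP ps [] vv → fOp (suc i) a ≡ nothing
fOp-none i a e rewrite e = refl

takeFirst-nothing : ∀ {c} u → All (λ b → c ≤ ceil b) u → takeFirst c u ≡ nothing
takeFirst-nothing [] [] = refl
takeFirst-nothing (b ∷ u) (le ∷ a) rewrite <ᵇ-false le | takeFirst-nothing u a = refl

pairGo-unpaired : ∀ u w → All (λ c → All (λ b → ceil c ≤ ceil b) u) w → pairGo u w ≡ mkP [] u w
pairGo-unpaired u [] [] = refl
pairGo-unpaired u (c ∷ w) (a ∷ as) rewrite takeFirst-nothing u a | pairGo-unpaired u w as = refl

pairGo-last : ∀ b u w c → ceil b < ceil c → All (λ c → All (λ b → ceil c ≤ ceil b) (b ∷ u)) w →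
  pairGo (b ∷ u) (w ∷ʳ c) ≡ mkP [ (b , c) ] u w
pairGo-last b u [] c lt [] rewrite <ᵇ-true lt = refl
pairGo-last b u (x ∷ w) c lt ((le ∷ a) ∷ as) rewrite <ᵇ-false le | takeFirst-nothing u a | pairGo-last b u w c lt as = refl

AllAbove-swap : ∀ {L} → MonoL L → ∀ u v → AllAbove u v → All (λ c → All (λ b → ceil c ≤ ceil b) (map L u)) (map L v)
AllAbove-swap mono u v above = map⁺ (All.tabulate λ c∈ → map⁺ (All.map (λ a → <⇒≤ (mono (All.lookup a c∈))) above))

pairing-low : ∀ {L} → MonoL L → ∀ u v → AllAbove u v → pairing (map L u) (map L v) ≡ mkP [] (map L u) (map L (reverse v))
pairing-low {L} mono u v above = trans
  (pairGo-unpaired (map L u) (reverse (map L v)) (All-reverse (map L v) (AllAbove-swap mono u v above)))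
  (cong (mkP [] (map L u)) (sym (reverse-map L v)))

-- The second factor is tried from its smallest letter up. So c comes last, finds the whole first
-- factor free and takes its largest letter b.
pairing-high : ∀ {L} → MonoL L → ∀ b u c v → b < c → AllAbove (b ∷ u) v →
  pairing (map L (b ∷ u)) (map L (c ∷ v)) ≡ mkP [ (L b , L c) ] (map L u) (map L (reverse v))
pairing-high {L} mono b u c v b<c above = trans
  (cong (pairGo (map L (b ∷ u))) (unfold-reverse (L c) (map L v)))
  (trans (pairGo-last (L b) (map L u) (reverse (map L v)) (L c) (mono b<c) (All-reverse (map L v) (AllAbove-swap mono (b ∷ u) v above)))
    (cong (mkP [ (L b , L c) ] (map L u)) (sym (reverse-map L v))))

maxL-last : ∀ w x → All (λ y → key y < key x) w → maxL (w ∷ʳ x) ≡ just x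
maxL-last [] x [] = refl
maxL-last (y ∷ w) x (lt ∷ a) rewrite maxL-last w x a | <ᵇ-false (<⇒≤ lt) = refl

minL-last : ∀ w x → All (λ y → key x < key y) w → minL (w ∷ʳ x) ≡ just x
minL-last [] x [] = refl
minL-last (y ∷ w) x (lt ∷ a) rewrite minL-last w x a | <ᵇ-false (<⇒≤ lt) = refl

MonoL-key : ∀ {L} → MonoL L → ∀ {m n} → m < n → key (L m) < key (L n)
MonoL-key {L} mono {m} {n} lt = key-mono {L m} {L n} (mono lt)

maxL-reverse : ∀ {L} → MonoL L → ∀ x v → All (_< x) v → maxL (map L (reverse (x ∷ v))) ≡ just (L x)
maxL-reverse {L} mono x v a = trans
  (cong maxL (trans (cong (map L) (unfold-reverse x v)) (map-++ L (reverse v) [ x ])))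
  (maxL-last (map L (reverse v)) (L x) (map⁺ (All-reverse v (All.map (MonoL-key {L} mono) a))))

minL-map : ∀ {L} → MonoL L → ∀ u y → All (y <_) u → minL (map L (u ∷ʳ y)) ≡ just (L y)
minL-map {L} mono u y a = trans (cong minL (map-++ L u [ y ]))
  (minL-last (map L u) (L y) (map⁺ (All.map (MonoL-key {L} mono) a)))

insertDec-last : ∀ x u → All (λ y → key x < key y) u → insertDec x u ≡ u ∷ʳ x
insertDec-last x [] [] = refl
insertDec-last x (y ∷ u) (lt ∷ a) rewrite <ᵇ-false (<⇒≤ lt) | insertDec-last x u a = refl

insertDec-map-last : ∀ {L} → MonoL L → ∀ x u → All (x <_) u → insertDec (L x) (map L u) ≡ map L (u ∷ʳ x)
insertDec-map-last {L} mono x u a = trans (insertDec-last (L x) (map L u) (map⁺ (All.map (MonoL-key {L} mono) a)))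
  (sym (map-++ L u [ x ]))

insertDec-map-first : ∀ {L} → MonoL L → ∀ y v → All (_< y) v → insertDec (L y) (map L v) ≡ map L (y ∷ v)
insertDec-map-first mono y [] _ = refl
insertDec-map-first {L} mono y (c ∷ v) (lt ∷ _) rewrite <ᵇ-true (MonoL-key {L} mono lt) = refl

removeC-none : ∀ {m} v → All (λ y → ceil y ≢ m) v → removeC m v ≡ v
removeC-none [] [] = refl
removeC-none (y ∷ v) (ne ∷ a) rewrite ≡ᵇ-false ne = cong (y ∷_) (removeC-none v a)

removeC-mid : ∀ u x v → All (λ y → ceil y ≢ ceil x) u → All (λ y → ceil y ≢ ceil x) v → removeC (ceil x) (u ++ x ∷ v) ≡ u ++ v
removeC-mid [] x v [] a rewrite ≡ᵇ-true (ceil x) = removeC-none v a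
removeC-mid (y ∷ u) x v (ne ∷ b) a rewrite ≡ᵇ-false ne = cong (y ∷_) (removeC-mid u x v b a)

MonoL-≢ : ∀ {L} → MonoL L → ∀ {m n} → m ≢ n → ceil (L m) ≢ ceil (L n)
MonoL-≢ mono {m} {n} ne e with <-cmp m n
... | tri< lt _ _ = <⇒≢ (mono lt) e
... | tri≈ _ m≡n _ = ne m≡n
... | tri> _ _ gt = >⇒≢ (mono gt) e

removeC-map : ∀ {L} → MonoL L → ∀ u x v → All (_≢ x) u → All (_≢ x) v → removeC (ceil (L x)) (map L (u ++ x ∷ v)) ≡ map L (u ++ v)
removeC-map {L} mono u x v a b = trans (cong (removeC (ceil (L x))) (map-++ L u (x ∷ v)))
  (trans (removeC-mid (map L u) (L x) (map L v) (map⁺ (All.map (MonoL-≢ {L} mono) a)) (map⁺ (All.map (MonoL-≢ {L} mono) b)))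
    (sym (map-++ L u v)))

at-++ : ∀ (p : Elem) {u s} → at (length p) (p ++ u ∷ s) ≡ u
at-++ [] = refl
at-++ (_ ∷ p) = at-++ p

at-++-suc : ∀ (p : Elem) {u v s} → at (suc (length p)) (p ++ u ∷ v ∷ s) ≡ v
at-++-suc [] = refl
at-++-suc (_ ∷ p) = at-++-suc p

upd-++ : ∀ (p : Elem) {u v s u′ v′} → upd (length p) u′ (upd (suc (length p)) v′ (p ++ u ∷ v ∷ s)) ≡ p ++ u′ ∷ v′ ∷ s
upd-++ [] = refl
upd-++ (x ∷ p) = cong (x ∷_) (upd-++ p)

-- The only relative positions of consecutive factors of a rank word; `local` shows that there are
-- no others.
data Local : List ℕ → List ℕ → Set where
  emptyU : ∀ {v} → Local [] v
  emptyV : ∀ {b u} → Local (b ∷ u) []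
  low    : ∀ {b u c v} → AllAbove (b ∷ u) (c ∷ v) → Local (b ∷ u) (c ∷ v)
  high   : ∀ {b u c v} → All (_< c) (b ∷ u) → AllAbove (b ∷ u) v → Local (b ∷ u) (c ∷ v)

-- In `third` the maximum c is paired, so the second letter moves; in the other cases nothing is
-- paired and the maximum moves. A moved letter is below all of u and is appended at its end.
data EMove : List ℕ → List ℕ → List ℕ → List ℕ → Set where
  first  : ∀ {c v} → EMove [] (c ∷ v) [ c ] v
  second : ∀ {b u c v} → AllAbove (b ∷ u) (c ∷ v) → EMove (b ∷ u) (c ∷ v) (b ∷ u ∷ʳ c) v
  third  : ∀ {b u c x v} → All (_< c) (b ∷ u) → AllAbove (b ∷ u) (x ∷ v) → EMove (b ∷ u) (c ∷ x ∷ v) (b ∷ u ∷ʳ x) (c ∷ v)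

data FMove : List ℕ → List ℕ → List ℕ → List ℕ → Set where
  lowF  : ∀ {u y v} → AllAbove (u ∷ʳ y) v → FMove (u ∷ʳ y) v u (y ∷ v)
  highF : ∀ {b u y c v} → All (_< c) (b ∷ u ∷ʳ y) → AllAbove (b ∷ u ∷ʳ y) v → FMove (b ∷ u ∷ʳ y) (c ∷ v) (b ∷ u) (c ∷ y ∷ v)

real : (ℕ → PL) → List (List ℕ) → Elem
real L = map (map L)

Dec : List ℕ → Set
Dec = Linked _>_

Dec⇒All : ∀ {x v} → Dec (x ∷ v) → All (_< x) v
Dec⇒All l with Linked⇒AllPairs (λ p q → <-trans q p) l
... | a ∷ _ = a

Dec-tail : ∀ {x v} → Dec (x ∷ v) → Dec v
Dec-tail [-] = []
Dec-tail (_ ∷ l) = l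

Dec-∷ : ∀ {x v} → All (_< x) v → Dec v → Dec (x ∷ v)
Dec-∷ [] _ = [-]
Dec-∷ (lt ∷ _) l = lt ∷ l

Dec-∷ʳ : ∀ {x} u → All (x <_) u → Dec u → Dec (u ∷ʳ x)
Dec-∷ʳ [] _ _ = [-]
Dec-∷ʳ (y ∷ []) (lt ∷ _) _ = lt ∷ [-]
Dec-∷ʳ (y ∷ z ∷ u) (_ ∷ a) (r ∷ l) = r ∷ Dec-∷ʳ (z ∷ u) a l

Dec-init : ∀ u {y} → Dec (u ∷ʳ y) → Dec u × All (y <_) u
Dec-init [] _ = [] , []
Dec-init (x ∷ []) (r ∷ _) = [-] , r ∷ []
Dec-init (x ∷ z ∷ u) (r ∷ l) with Dec-init (z ∷ u) l
... | l′ , lt ∷ a = r ∷ l′ , <-trans lt r ∷ lt ∷ a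

AllAbove⇒< : ∀ {u x v} → AllAbove u (x ∷ v) → All (x <_) u
AllAbove⇒< = All.map λ { (lt ∷ _) → lt }

eMove-eval : ∀ {L} → MonoL L → ∀ p {u v u′ v′} s → Dec v → EMove u v u′ v′ →
  eOp (suc (length p)) (real L (p ++ u ∷ v ∷ s)) ≡ just (real L (p ++ u′ ∷ v′ ∷ s))
eMove-eval {L} mono p {u} {v} {u′} {v′} s dec mv = go mv
  where
  P = real L p
  S = real L s
  eq : ∀ u v → real L (p ++ u ∷ v ∷ s) ≡ P ++ map L u ∷ map L v ∷ S
  eq u v = map-++ (map L) p (u ∷ v ∷ s)
  eval : ∀ {u v u′ v′ ps uu w x} → pairing (map L u) (map L v) ≡ mkP ps uu w → maxL w ≡ just (L x) → All (x ≢_) u →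
    insertDec (L x) (map L u) ≡ map L u′ → removeC (ceil (L x)) (map L v) ≡ map L v′ →
    eOp (suc (length p)) (real L (p ++ u ∷ v ∷ s)) ≡ just (real L (p ++ u′ ∷ v′ ∷ s))
  eval {u} {v} {u′} {v′} {ps} {uu} {w} {x} e₁ e₂ ne e₃ e₄ = begin
    eOp (suc (length p)) (real L (p ++ u ∷ v ∷ s))   ≡⟨ cong₂ (λ n A → eOp (suc n) A) (sym (length-map (map L) p)) (eq u v) ⟩
    eOp (suc i) A                                    ≡⟨ eOp-eval i A (trans (cong₂ pairing a₁ a₂) e₁) e₂ (subst (All _) (cong (map ceil) (sym a₁)) (map⁺ (map⁺ (All.map (MonoL-≢ {L} mono) ne)))) ⟩
    just (upd i (insertDec (L x) (at i A)) (upd (suc i) (removeC (ceil (L x)) (at (suc i) A)) A))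
      ≡⟨ cong just (cong₂ (λ U V → upd i U (upd (suc i) V A)) (trans (cong (insertDec (L x)) a₁) e₃) (trans (cong (removeC (ceil (L x))) a₂) e₄)) ⟩
    just (upd i (map L u′) (upd (suc i) (map L v′) A)) ≡⟨ cong just (upd-++ P) ⟩
    just (P ++ map L u′ ∷ map L v′ ∷ S)              ≡⟨ cong just (eq u′ v′) ⟨
    just (real L (p ++ u′ ∷ v′ ∷ s))                 ∎
    where
    open ≡-Reasoning
    i = length P
    A = P ++ map L u ∷ map L v ∷ S
    a₁ : at i A ≡ map L u
    a₁ = at-++ P
    a₂ : at (suc i) A ≡ map L v
    a₂ = at-++-suc P
  go : ∀ {u′ v′} → EMove u v u′ v′ → eOp (suc (length p)) (real L (p ++ u ∷ v ∷ s)) ≡ just (real L (p ++ u′ ∷ v′ ∷ s))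
  go (first {c} {v}) = eval (pairing-low {L} mono [] (c ∷ v) []) (maxL-reverse {L} mono c v (Dec⇒All dec)) [] refl
    (removeC-map {L} mono [] c v [] (All.map <⇒≢ (Dec⇒All dec)))
  go (second {b} {u} {c} {v} above) = eval (pairing-low {L} mono (b ∷ u) (c ∷ v) above) (maxL-reverse {L} mono c v (Dec⇒All dec))
    (All.map <⇒≢ (AllAbove⇒< above)) (insertDec-map-last {L} mono c (b ∷ u) (AllAbove⇒< above))
    (removeC-map {L} mono [] c v [] (All.map <⇒≢ (Dec⇒All dec)))
  go (third {b} {u} {c} {x} {v} (b<c ∷ _) above) = eval (pairing-high {L} mono b u c (x ∷ v) b<c above)
    (maxL-reverse {L} mono x v (Dec⇒All (Dec-tail dec)))
    (All.map <⇒≢ (AllAbove⇒< above)) (insertDec-map-last {L} mono x (b ∷ u) (AllAbove⇒< above))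
    (removeC-map {L} mono [ c ] x v (>⇒≢ (All.lookup (Dec⇒All dec) (here refl)) ∷ []) (All.map <⇒≢ (Dec⇒All (Dec-tail dec))))

fMove-eval : ∀ {L} → MonoL L → ∀ p {u v u′ v′} s → Dec u → FMove u v u′ v′ →
  fOp (suc (length p)) (real L (p ++ u ∷ v ∷ s)) ≡ just (real L (p ++ u′ ∷ v′ ∷ s))
fMove-eval {L} mono p {u} {v} s dec mv = go mv
  where
  P = real L p
  S = real L s
  eq : ∀ u v → real L (p ++ u ∷ v ∷ s) ≡ P ++ map L u ∷ map L v ∷ S
  eq u v = map-++ (map L) p (u ∷ v ∷ s)
  eval : ∀ {u v u′ v′ ps w vv y} → pairing (map L u) (map L v) ≡ mkP ps w vv → minL w ≡ just (L y) → All (y ≢_) v →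
    removeC (ceil (L y)) (map L u) ≡ map L u′ → insertDec (L y) (map L v) ≡ map L v′ →
    fOp (suc (length p)) (real L (p ++ u ∷ v ∷ s)) ≡ just (real L (p ++ u′ ∷ v′ ∷ s))
  eval {u} {v} {u′} {v′} {ps} {w} {vv} {y} e₁ e₂ ne e₃ e₄ = begin
    fOp (suc (length p)) (real L (p ++ u ∷ v ∷ s))   ≡⟨ cong₂ (λ n A → fOp (suc n) A) (sym (length-map (map L) p)) (eq u v) ⟩
    fOp (suc i) A                                    ≡⟨ fOp-eval i A (trans (cong₂ pairing a₁ a₂) e₁) e₂ (subst (All _) (cong (map ceil) (sym a₂)) (map⁺ (map⁺ (All.map (MonoL-≢ {L} mono) ne)))) ⟩
    just (upd i (removeC (ceil (L y)) (at i A)) (upd (suc i) (insertDec (L y) (at (suc i) A)) A))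
      ≡⟨ cong just (cong₂ (λ U V → upd i U (upd (suc i) V A)) (trans (cong (removeC (ceil (L y))) a₁) e₃) (trans (cong (insertDec (L y)) a₂) e₄)) ⟩
    just (upd i (map L u′) (upd (suc i) (map L v′) A)) ≡⟨ cong just (upd-++ P) ⟩
    just (P ++ map L u′ ∷ map L v′ ∷ S)              ≡⟨ cong just (eq u′ v′) ⟨
    just (real L (p ++ u′ ∷ v′ ∷ s))                 ∎
    where
    open ≡-Reasoning
    i = length P
    A = P ++ map L u ∷ map L v ∷ S
    a₁ : at i A ≡ map L u
    a₁ = at-++ P
    a₂ : at (suc i) A ≡ map L v
    a₂ = at-++-suc P
  remove-last : ∀ u y → All (y <_) u → removeC (ceil (L y)) (map L (u ∷ʳ y)) ≡ map L u
  remove-last u y a = trans (removeC-map {L} mono u y [] (All.map >⇒≢ a) []) (cong (map L) (++-identityʳ u))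
  go : ∀ {u′ v′} → FMove u v u′ v′ → fOp (suc (length p)) (real L (p ++ u ∷ v ∷ s)) ≡ just (real L (p ++ u′ ∷ v′ ∷ s))
  go (lowF {u} {y} {v} above) = eval (pairing-low {L} mono (u ∷ʳ y) v above) (minL-map {L} mono u y (proj₂ (Dec-init u dec)))
    (All.map >⇒≢ v<y) (remove-last u y (proj₂ (Dec-init u dec))) (insertDec-map-first {L} mono y v v<y)
    where v<y = proj₂ (∷ʳ⁻ {xs = u} above)
  go (highF {b} {u} {y} {c} {v} b<c above) = eval (pairing-high {L} mono b (u ∷ʳ y) c v (All.lookup b<c (here refl)) above)
    (minL-map {L} mono u y (proj₂ (Dec-init u (Dec-tail dec))))
    (<⇒≢ y<c ∷ All.map >⇒≢ v<y) (remove-last (b ∷ u) y (proj₂ (Dec-init (b ∷ u) dec))) insert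
    where
    y<c : y < c
    y<c = proj₂ (∷ʳ⁻ {xs = b ∷ u} b<c)
    v<y = proj₂ (∷ʳ⁻ {xs = b ∷ u} above)
    insert : insertDec (L y) (map L (c ∷ v)) ≡ map L (c ∷ y ∷ v)
    insert rewrite <ᵇ-false (<⇒≤ (MonoL-key {L} mono y<c)) = cong (L c ∷_) (insertDec-map-first {L} mono y v v<y)

-- Codes: factorizations up to the choice of `J` and `P`.

Code : Set
Code = Bool × List (List ℕ)

realize : (ℕ → ℕ) → (ℕ → Bool) → Code → Elem
realize J P (p₀ , α) = real (letter J P p₀ (hd (concat α))) α

record Valid (n K : ℕ) (c : Code) : Set where
  constructor valid
  field
    factors : length (proj₂ c) ≡ n
    dec     : All Dec (proj₂ c)
    reading : Full K (concat (proj₂ c))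

concat-mid : ∀ (p : List (List ℕ)) u v s → concat (p ++ u ∷ v ∷ s) ≡ concat p ++ (u ++ v) ++ concat s
concat-mid p u v s = trans (sym (concat-++ p (u ∷ v ∷ s))) (cong (concat p ++_) (sym (++-assoc u v (concat s))))

-- If the first letter of v extends the interval downwards, the decreasing rest stays below it. If
-- it extends the interval upwards, the rest can no longer use the upper end and falls below all of
-- u.
local : ∀ {K} p u v s → Full K (p ++ (u ++ v) ++ s) → Dec v → Local u v
local p [] v s f dv = emptyU
local p (b ∷ u) [] s f dv = emptyV
local {K} p (b ∷ u) (c ∷ v) s f dv with Full⇒Path f
... | a , path with Path-++⁻ p path
...   | l₁ , r₁ , q₁ , path₁ with Path-++⁻ (b ∷ u) (subst (λ w → Path l₁ r₁ w 1 (suc K)) (cong (b ∷_) (++-assoc u (c ∷ v) s)) path₁)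
...     | l₂ , r₂ , q₂ , path₂ = go path₂
  where
  range : All (In l₂ r₂) (b ∷ u)
  range = Path-range (Path-≤ ≤-refl q₁) q₂
  go : ∀ {l r} → Path l₂ r₂ (c ∷ v ++ s) l r → Local (b ∷ u) (c ∷ v)
  go (D∷ _) = low (All.map (λ (l≤x , _) → l≤x ∷ All.map (λ y<c → <-trans y<c l≤x) (Dec⇒All dv)) range)
  go (U∷ q) = high (All.map proj₂ range)
    (All.map (λ (l≤x , _) → All.zipWith (λ { (inj₁ y<l , _) → <-≤-trans y<l l≤x ; (inj₂ c<y , y<c) → contradiction y<c (<⇒≯ c<y) })
      (++⁻ˡ v (Path-outside q) , Dec⇒All dv)) range)

-- The effect of e_i and f_i on the word that is read. The letter b kept in front preserves the
-- start of the word, on which the primes depend.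
data Rearrange : List ℕ → List ℕ → Set where
  same : ∀ {w} → Rearrange w w
  swap : ∀ b u {x y s} → Commuting x y → Rearrange (b ∷ u ++ x ∷ y ∷ s) (b ∷ u ++ y ∷ x ∷ s)

Path-Rearrange : ∀ {l r w w′ l′ r′} → l ≤ r → Rearrange w w′ → Path l r w l′ r′ → Path l r w′ l′ r′
Path-Rearrange l≤r same q = q
Path-Rearrange l≤r (swap b u c) q with Path-++⁻ (b ∷ u) q
... | l₁ , r₁ , q₁ , q₂ with Path-range l≤r q₁
...   | (l₁≤b , b<r₁) ∷ _ = Path-++⁺ q₁ (Path-swap (≤-<-trans l₁≤b b<r₁) c q₂)

Full-Rearrange : ∀ {k} p {w w′} s → Rearrange w w′ → Full (suc k) (p ++ w ++ s) → Full (suc k) (p ++ w′ ++ s)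
Full-Rearrange {k} p {w} {w′} s r f with Full⇒Path f
... | a , path with Path-++⁻ p path
...   | l₁ , r₁ , q₁ , path₁ with Path-++⁻ w path₁
...     | l₂ , r₂ , q₂ , q₃ = nonempty (Path-++⁺ q₁ (Path-++⁺ (Path-Rearrange (Path-≤ ≤-refl q₁) r q₂) q₃))
  where
  nonempty : ∀ {w} → Path a a w 1 (suc (suc k)) → Full (suc k) w
  nonempty {_ ∷ _} q = Path⇒Full q

hd-Rearrange : ∀ p {w w′} s → Rearrange w w′ → hd (p ++ w ++ s) ≡ hd (p ++ w′ ++ s)
hd-Rearrange [] s same = refl
hd-Rearrange [] s (swap _ _ _) = refl
hd-Rearrange (_ ∷ _) s _ = refl

EMove-Rearrange : ∀ {u v u′ v′} → EMove u v u′ v′ → Rearrange (u ++ v) (u′ ++ v′)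
EMove-Rearrange first = same
EMove-Rearrange (second {b} {u} {c} {v} _) = subst (Rearrange _) (cong (b ∷_) (sym (++-assoc u [ c ] v))) same
EMove-Rearrange (third {b} {u} {c} {x} {v} (b<c ∷ _) ((x<b ∷ _) ∷ _)) =
  subst (Rearrange _) (cong (b ∷_) (sym (++-assoc u [ x ] (c ∷ v)))) (swap b u (inj₂ (≤-<-trans x<b b<c)))

FMove-Rearrange : ∀ {u v u′ v′} → Dec u → FMove u v u′ v′ → Rearrange (u ++ v) (u′ ++ v′)
FMove-Rearrange _ (lowF {u} {y} {v} _) = subst (λ w → Rearrange w (u ++ y ∷ v)) (sym (++-assoc u [ y ] v)) same
FMove-Rearrange dec (highF {b} {u} {y} {c} {v} (b<c ∷ _) _) =
  subst (λ w → Rearrange (b ∷ w) (b ∷ u ++ c ∷ y ∷ v)) (sym (++-assoc u [ y ] (c ∷ v)))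
    (swap b u (inj₁ (≤-<-trans (All.lookup (Dec⇒All dec) (∈-++⁺ʳ u (here refl))) b<c)))

EMove-Dec : ∀ {u v u′ v′} → Dec u → Dec v → EMove u v u′ v′ → Dec u′ × Dec v′
EMove-Dec du dv first = [-] , Dec-tail dv
EMove-Dec du dv (second {b} {u} above) = Dec-∷ʳ (b ∷ u) (AllAbove⇒< above) du , Dec-tail dv
EMove-Dec du dv (third {b} {u} _ above) with Dec⇒All dv
... | _ ∷ v<c = Dec-∷ʳ (b ∷ u) (AllAbove⇒< above) du , Dec-∷ v<c (Dec-tail (Dec-tail dv))

FMove-Dec : ∀ {u v u′ v′} → Dec u → Dec v → FMove u v u′ v′ → Dec u′ × Dec v′
FMove-Dec du dv (lowF {u} above) = proj₁ (Dec-init u du) , Dec-∷ (proj₂ (∷ʳ⁻ {xs = u} above)) dv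
FMove-Dec du dv (highF {b} {u} b<c above) =
  proj₁ (Dec-init (b ∷ u) du) ,
  Dec-∷ (proj₂ (∷ʳ⁻ {xs = b ∷ u} b<c) ∷ Dec⇒All dv) (Dec-∷ (proj₂ (∷ʳ⁻ {xs = b ∷ u} above)) (Dec-tail dv))

eMove? : ∀ {u v} → Local u v →
  ((L : ℕ → PL) → MonoL L → ∃[ ps ] ∃[ w ] pairing (map L u) (map L v) ≡ mkP ps w []) ⊎ (∃[ u′ ] ∃[ v′ ] EMove u v u′ v′)
eMove? (emptyU {[]}) = inj₁ λ L mono → _ , _ , pairing-low {L} mono [] [] []
eMove? (emptyU {c ∷ v}) = inj₂ (_ , _ , first)
eMove? (emptyV {b} {u}) = inj₁ λ L mono → _ , _ , pairing-low {L} mono (b ∷ u) [] (All.tabulate λ _ → [])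
eMove? (low above) = inj₂ (_ , _ , second above)
eMove? (high {b} {u} {c} {[]} (b<c ∷ _) above) = inj₁ λ L mono → _ , _ , pairing-high {L} mono b u c [] b<c above
eMove? (high {v = _ ∷ _} lt above) = inj₂ (_ , _ , third lt above)

fLow : ∀ b u {v} → AllAbove (b ∷ u) v → ∃[ u′ ] ∃[ v′ ] FMove (b ∷ u) v u′ v′
fLow b u above with reverseView u
... | [] = _ , _ , lowF {[]} above
... | w ∶ _ ∶ʳ y = _ , _ , lowF {b ∷ w} above

fMove? : ∀ {u v} → Local u v →
  ((L : ℕ → PL) → MonoL L → ∃[ ps ] ∃[ w ] pairing (map L u) (map L v) ≡ mkP ps [] w) ⊎ (∃[ u′ ] ∃[ v′ ] FMove u v u′ v′)
fMove? (emptyU {v}) = inj₁ λ L mono → _ , _ , pairing-low {L} mono [] v []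
fMove? (emptyV {b} {u}) = inj₂ (fLow b u (All.tabulate λ _ → []))
fMove? (low {b} {u} above) = inj₂ (fLow b u above)
fMove? (high {b} {u} {c} {v} lt@(b<c ∷ _) above) with reverseView u
... | [] = inj₁ λ L mono → _ , _ , pairing-high {L} mono b [] c v b<c above
... | w ∶ _ ∶ʳ y = inj₂ (_ , _ , highF {b} {w} lt above)

module Operators (n k : ℕ) where

  -- The resulting code is chosen before `J` and `P`, so one and the same move describes the
  -- operator on the side of T and on the side of w_λ.
  data Outcome (O : Elem → Maybe Elem) (c : Code) : Set where
    fails : (∀ {J} P → Mono J → O (realize J P c) ≡ nothing) → Outcome O c
    moves : ∀ c′ → Valid n (suc k) c′ → (∀ {J} P → Mono J → O (realize J P c) ≡ just (realize J P c′)) → Outcome O c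

  Uniform : (Elem → Maybe Elem) → Set
  Uniform O = ∀ c → Valid n (suc k) c → Outcome O c

  data Split (i : ℕ) : List (List ℕ) → Set where
    split : ∀ p u v s → length p ≡ i → Split i (p ++ u ∷ v ∷ s)

  split-at : ∀ i α → suc i < length α → Split i α
  split-at zero (u ∷ v ∷ s) _ = split [] u v s refl
  split-at zero (u ∷ []) (s≤s ())
  split-at (suc i) (x ∷ α) (s≤s lt) with split-at i α lt
  ... | split p u v s e = split (x ∷ p) u v s (cong suc e)

  valid-local : ∀ {p₀} p u v s → Valid n (suc k) (p₀ , p ++ u ∷ v ∷ s) → Dec u × Dec v × Local u v
  valid-local p u v s (valid _ dec f) with ++⁻ʳ p dec
  ... | du ∷ dv ∷ _ = du , dv , local (concat p) u v (concat s) (subst (Full (suc k)) (concat-mid p u v s) f) dv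

  Rearrange-Valid : ∀ {p₀} p {u v u′ v′} s → Rearrange (u ++ v) (u′ ++ v′) → Dec u′ × Dec v′ →
    Valid n (suc k) (p₀ , p ++ u ∷ v ∷ s) → Valid n (suc k) (p₀ , p ++ u′ ∷ v′ ∷ s)
  Rearrange-Valid p {u} {v} {u′} {v′} s r (du , dv) (valid len dec f) = valid
    (trans (length-++ p) (trans (sym (length-++ p)) len))
    (++⁺ (++⁻ˡ p dec) (du ∷ dv ∷ tails (++⁻ʳ p dec)))
    (subst (Full (suc k)) (sym (concat-mid p u′ v′ s))
      (Full-Rearrange (concat p) (concat s) r (subst (Full (suc k)) (concat-mid p u v s) f)))
    where
    tails : ∀ {x y s} → All Dec (x ∷ y ∷ s) → All Dec s
    tails (_ ∷ _ ∷ d) = d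

  Rearrange-hd : ∀ p {u v u′ v′} s → Rearrange (u ++ v) (u′ ++ v′) → hd (concat (p ++ u ∷ v ∷ s)) ≡ hd (concat (p ++ u′ ∷ v′ ∷ s))
  Rearrange-hd p {u} {v} {u′} {v′} s r = trans (cong hd (concat-mid p u v s))
    (trans (hd-Rearrange (concat p) (concat s) r) (cong hd (sym (concat-mid p u′ v′ s))))

  real-++ : ∀ L p u v s → real L (p ++ u ∷ v ∷ s) ≡ real L p ++ map L u ∷ map L v ∷ real L s
  real-++ L p u v s = map-++ (map L) p (u ∷ v ∷ s)

  EMove-realize : ∀ {p₀ J} P → Mono J → ∀ p {u v u′ v′} s → Dec v → EMove u v u′ v′ →
    eOp (suc (length p)) (realize J P (p₀ , p ++ u ∷ v ∷ s)) ≡ just (realize J P (p₀ , p ++ u′ ∷ v′ ∷ s))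
  EMove-realize {p₀} {J} P mono p {u} {v} {u′} {v′} s dv mv =
    trans (eMove-eval {letter J P p₀ (hd (concat (p ++ u ∷ v ∷ s)))} mono p s dv mv)
      (cong (λ h → just (real (letter J P p₀ h) (p ++ u′ ∷ v′ ∷ s))) (Rearrange-hd p s (EMove-Rearrange mv)))

  eOp-realize-none : ∀ {p₀ J} P → Mono J → ∀ p {u v} s →
    ((L : ℕ → PL) → MonoL L → ∃[ ps ] ∃[ w ] pairing (map L u) (map L v) ≡ mkP ps w []) →
    eOp (suc (length p)) (realize J P (p₀ , p ++ u ∷ v ∷ s)) ≡ nothing
  eOp-realize-none {p₀} {J} P mono p {u} {v} s h = trans
    (cong₂ (λ i A → eOp (suc i) A) (sym (length-map (map L) p)) (real-++ L p u v s))
    (eOp-none (length (real L p)) _ (trans (cong₂ pairing (at-++ (real L p)) (at-++-suc (real L p))) (proj₂ (proj₂ (h L mono)))))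
    where L = letter J P p₀ (hd (concat (p ++ u ∷ v ∷ s)))

  fOp-realize-none : ∀ {p₀ J} P → Mono J → ∀ p {u v} s →
    ((L : ℕ → PL) → MonoL L → ∃[ ps ] ∃[ w ] pairing (map L u) (map L v) ≡ mkP ps [] w) →
    fOp (suc (length p)) (realize J P (p₀ , p ++ u ∷ v ∷ s)) ≡ nothing
  fOp-realize-none {p₀} {J} P mono p {u} {v} s h = trans
    (cong₂ (λ i A → fOp (suc i) A) (sym (length-map (map L) p)) (real-++ L p u v s))
    (fOp-none (length (real L p)) _ (trans (cong₂ pairing (at-++ (real L p)) (at-++-suc (real L p))) (proj₂ (proj₂ (h L mono)))))
    where L = letter J P p₀ (hd (concat (p ++ u ∷ v ∷ s)))

  eOp-uniform : ∀ i → suc i < n → Uniform (eOp (suc i))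
  eOp-uniform i i<n (p₀ , α) V with split-at i α (subst (suc i <_) (sym (Valid.factors V)) i<n)
  ... | split p u v s refl with valid-local p u v s V
  ...   | du , dv , loc with eMove? loc
  ...     | inj₁ h = fails λ P mono → eOp-realize-none P mono p s h
  ...     | inj₂ (u′ , v′ , mv) = moves _ (Rearrange-Valid p s (EMove-Rearrange mv) (EMove-Dec du dv mv) V) (λ P mono → EMove-realize P mono p s dv mv)

  fOp-uniform : ∀ i → suc i < n → Uniform (fOp (suc i))
  fOp-uniform i i<n (p₀ , α) V with split-at i α (subst (suc i <_) (sym (Valid.factors V)) i<n)
  ... | split p u v s refl with valid-local p u v s V
  ...   | du , dv , loc with fMove? loc
  ...     | inj₁ h = fails λ P mono → fOp-realize-none P mono p s h
  ...     | inj₂ (u′ , v′ , mv) = moves _ (Rearrange-Valid p s (FMove-Rearrange du mv) (FMove-Dec du dv mv) V)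
    λ {J} P mono → trans (fMove-eval {letter J P p₀ (hd (concat (p ++ u ∷ v ∷ s)))} mono p s du mv)
      (cong (λ h → just (real (letter J P p₀ h) (p ++ u′ ∷ v′ ∷ s))) (Rearrange-hd p s (FMove-Rearrange du mv)))

  fails-uniform : Uniform (λ _ → nothing)
  fails-uniform _ _ = fails λ _ _ → refl

  just-uniform : Uniform just
  just-uniform c V = moves c V λ _ _ → refl

  >>=-uniform : ∀ {g f} → Uniform g → Uniform f → Uniform (g ⊙ f)
  >>=-uniform {g} {f} ug uf c V with uf c V
  ... | fails h = fails λ P mono → cong (_>>= g) (h P mono)
  ... | moves c′ V′ h with ug c′ V′
  ...   | fails h′ = fails λ P mono → trans (cong (_>>= g) (h P mono)) (h′ P mono)
  ...   | moves c″ V″ h′ = moves c″ V″ λ P mono → trans (cong (_>>= g) (h P mono)) (h′ P mono)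

  iterM-uniform : ∀ m {f} → Uniform f → Uniform (iterM m f)
  iterM-uniform zero uf = just-uniform
  iterM-uniform (suc m) uf = >>=-uniform (iterM-uniform m uf) uf

  at-real : ∀ L i α → length (at i (real L α)) ≡ length (at i (real un α))
  at-real L i [] = refl
  at-real L zero (u ∷ α) = trans (length-map L u) (sym (length-map un u))
  at-real L (suc i) (_ ∷ α) = at-real L i α

  Outcome-cong : ∀ {O O′ c} → (∀ J P → O (realize J P c) ≡ O′ (realize J P c)) → Outcome O′ c → Outcome O c
  Outcome-cong eq (fails h) = fails λ {J} P mono → trans (eq J P) (h P mono)
  Outcome-cong eq (moves c′ V′ h) = moves c′ V′ λ {J} P mono → trans (eq J P) (h P mono)

  σ-uniform : ∀ i → suc i < n → Uniform (σ (suc i))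
  -- The letters `un` serve as a reference: the branch of σ and its number of steps depend only on
  -- the lengths of the factors, which all realizations share.
  σ-uniform i i<n c@(p₀ , α) V with length (at (suc i) (real un α)) ≤ᵇ length (at i (real un α)) in e
  ... | true = Outcome-cong eq (iterM-uniform (u ∸ v) (fOp-uniform i i<n) c V)
    where
    u v : ℕ
    u = length (at i (real un α))
    v = length (at (suc i) (real un α))
    eq : ∀ J P → σ (suc i) (realize J P c) ≡ iterM (u ∸ v) (fOp (suc i)) (realize J P c)
    eq J P rewrite at-real (letter J P p₀ (hd (concat α))) i α | at-real (letter J P p₀ (hd (concat α))) (suc i) α | e = refl
  ... | false = Outcome-cong eq (iterM-uniform (v ∸ u) (eOp-uniform i i<n) c V)
    where
    u v : ℕ
    u = length (at i (real un α))
    v = length (at (suc i) (real un α))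
    eq : ∀ J P → σ (suc i) (realize J P c) ≡ iterM (v ∸ u) (eOp (suc i)) (realize J P c)
    eq J P rewrite at-real (letter J P p₀ (hd (concat α))) i α | at-real (letter J P p₀ (hd (concat α))) (suc i) α | e = refl

-- Operators on the first two factors and their conjugates.

real-cong : ∀ {L L′ : ℕ → PL} s → All (λ m → L m ≡ L′ m) (concat s) → real L s ≡ real L′ s
real-cong s a = map-cong-local (All.map map-cong-local (AllP.concat⁻ {xss = s} a))

Path-down : ∀ {l r u l′ r′} → All (_< r) u → Path l r u l′ r′ → r′ ≡ r × (∀ r″ → Path l r″ u l′ r″)
Path-down [] [] = refl , λ r″ → []
Path-down (lt ∷ _) (U∷ q) = contradiction lt (n≮n _)
Path-down (_ ∷ a) (D∷ q) with Path-down a q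
... | e , f = e , λ r″ → D∷ f r″

-- The descending first factor never reads an upper neighbour, so c can only be b + 1. If c is read
-- first instead, b is its lower neighbour and the reading of u is unaffected.
Full-raise : ∀ {k b} u {c w} → All (_< b) u → b < c → Full k (b ∷ u ++ c ∷ w) → c ≡ suc b × Full k (c ∷ b ∷ u ++ w)
Full-raise {k} {b} u {c} {w} u<b b<c (full q) with Path-++⁻ u q
... | l , r , q₁ , q₂ with Path-down (All.map m<n⇒m<1+n u<b) q₁
...   | refl , f = go q₂
  where
  go : Path l (suc b) (c ∷ w) 1 (suc k) → c ≡ suc b × Full k (c ∷ b ∷ u ++ w)
  go (U∷ q₃) = (refl , full (D∷ Path-++⁺ (f (suc (suc b))) q₃))
  go (D∷ _) = contradiction b<c (≤⇒≯ (<⇒≤ (Path-l≥ q₁)))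

Full-lower : ∀ {k b c} u {w} → All (_< b) u → b < c → Full k (c ∷ b ∷ u ++ w) → c ≡ suc b × Full k (b ∷ u ++ c ∷ w)
Full-lower u u<b b<c (full (U∷ _)) = contradiction b<c (<⇒≯ (n<1+n _))
Full-lower {b = b} u u<b b<c (full (D∷ q)) with Path-++⁻ u q
... | l , r , q₁ , q₂ with Path-down (All.map (m<n⇒m<1+n ∘ m<n⇒m<1+n) u<b) q₁
...   | refl , f = refl , full (Path-++⁺ (f (suc b)) (U∷ q₂))

Full-others : ∀ {k a s} → Full k (a ∷ s) → All (λ m → m < a ⊎ a < m) s
Full-others (full q) = Path-outside q

realize-toggle : ∀ {k} J P p₀ q b u s → Full k (b ∷ u ++ concat s) →
  realize J P (p₀ , (b ∷ u) ∷ s) ≡ ((J b , p₀) ∷ map (letter J P q b) u) ∷ real (letter J P q b) s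
realize-toggle J P p₀ q b u s f = cong₂ _∷_ (cong₂ _∷_ (cong (J b ,_) (prime-start b)) (map-cong-local (++⁻ˡ u tails))) (real-cong s (++⁻ʳ u tails))
  where
  tail : ∀ {m} → m < b ⊎ b < m → letter J P p₀ b m ≡ letter J P q b m
  tail (inj₁ lt) = cong (_ ,_) (trans (prime-below lt) (sym (prime-below lt)))
  tail (inj₂ lt) = cong (_ ,_) (trans (prime-above lt) (sym (prime-above lt)))
  tails : All (λ m → letter J P p₀ b m ≡ letter J P q b m) (u ++ concat s)
  tails = All.map tail (Full-others f)

eBar1-eval : ∀ {x y p q u v s} → x < y →
  eBar1 (((x , p) ∷ u) ∷ ((y , q) ∷ v) ∷ s) ≡ just (((y , p) ∷ (x , q) ∷ u) ∷ v ∷ s)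
eBar1-eval lt rewrite ≤ᵇ-false lt = refl

fBar1-eval : ∀ {x y p q u v s} → All (λ c → ceil c < y) v →
  fBar1 (((y , p) ∷ (x , q) ∷ u) ∷ v ∷ s) ≡ just (((x , p) ∷ u) ∷ ((y , q) ∷ v) ∷ s)
fBar1-eval [] = refl
fBar1-eval (lt ∷ _) rewrite <ᵇ-true lt = refl

module FirstFactors (n k : ℕ) where
  open Operators n k

  -- The free bit `p₀` belongs to whichever letter comes first, and `P b` to the other end of the
  -- gap b. Moving the start across this gap is therefore exactly the prime swap in e and f with
  -- index 1̄.
  realize-raised : ∀ {J P p₀} b u v s → Full (suc k) (b ∷ u ++ suc b ∷ v ++ concat s) → Full (suc k) (suc b ∷ b ∷ u ++ v ++ concat s) →
    (realize J P (p₀ , (b ∷ u) ∷ (suc b ∷ v) ∷ s) ≡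
      ((J b , p₀) ∷ map (letter J P p₀ b) u) ∷ ((J (suc b) , P b) ∷ map (letter J P p₀ b) v) ∷ real (letter J P p₀ b) s) ×
    (realize J P (p₀ , (suc b ∷ b ∷ u) ∷ v ∷ s) ≡
      ((J (suc b) , p₀) ∷ (J b , P b) ∷ map (letter J P p₀ b) u) ∷ map (letter J P p₀ b) v ∷ real (letter J P p₀ b) s)
  realize-raised {J} {P} {p₀} b u v s f f′ =
    cong₂ _∷_ (cong₂ _∷_ (cong (_ ,_) (prime-start b)) refl) (cong₂ _∷_ (cong₂ _∷_ (cong (_ ,_) (prime-above (n<1+n b))) refl) refl) ,
    cong₂ _∷_ (cong₂ _∷_ (cong (_ ,_) (prime-start (suc b))) (cong₂ _∷_ (cong (_ ,_) (prime-below (n<1+n b))) (map-cong-local (++⁻ˡ u others))))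
      (cong₂ _∷_ (map-cong-local (++⁻ˡ v (++⁻ʳ u others))) (real-cong s (++⁻ʳ v (++⁻ʳ u others))))
    where
    others : All (λ m → letter J P p₀ (suc b) m ≡ letter J P p₀ b m) (u ++ v ++ concat s)
    others = All.map (letter-moved-start {J}) (proj₂ (proj₂ (Full-first f′)))

  ePrime1-uniform : Uniform ePrime1
  ePrime1-uniform (p₀ , [] ∷ s) V = fails λ _ _ → refl
  ePrime1-uniform (p₀ , []) V = fails λ _ _ → refl
  ePrime1-uniform (false , (b ∷ u) ∷ s) (valid len dec f) = fails λ {J} P mono → cong ePrime1 (realize-toggle J P false false b u s f)
  ePrime1-uniform (true , (b ∷ u) ∷ s) (valid len dec f) = moves (false , (b ∷ u) ∷ s) (valid len dec f)
    λ {J} P mono → trans (cong ePrime1 (realize-toggle J P true false b u s f)) (cong just (sym (realize-toggle J P false false b u s f)))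

  fPrime1-uniform : Uniform fPrime1
  fPrime1-uniform (p₀ , [] ∷ s) V = fails λ _ _ → refl
  fPrime1-uniform (p₀ , []) V = fails λ _ _ → refl
  fPrime1-uniform (true , (b ∷ u) ∷ s) (valid len dec f) = fails λ {J} P mono → cong fPrime1 (realize-toggle J P true true b u s f)
  fPrime1-uniform (false , (b ∷ u) ∷ s) (valid len dec f) = moves (true , (b ∷ u) ∷ s) (valid len dec f)
    λ {J} P mono → trans (cong fPrime1 (realize-toggle J P false true b u s f)) (cong just (sym (realize-toggle J P true true b u s f)))

  eBar1-uniform : Uniform eBar1
  eBar1-uniform (p₀ , []) V = fails λ _ _ → refl
  eBar1-uniform (p₀ , u ∷ []) V = fails λ _ _ → refl
  eBar1-uniform (p₀ , u ∷ [] ∷ s) V = fails λ _ _ → refl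
  eBar1-uniform (p₀ , [] ∷ (c ∷ v) ∷ s) (valid len (_ ∷ dv ∷ ds) f) =
    moves (p₀ , [ c ] ∷ v ∷ s) (valid len ([-] ∷ Dec-tail dv ∷ ds) f) λ _ _ → refl
  eBar1-uniform (p₀ , (b ∷ u) ∷ (c ∷ v) ∷ s) V@(valid len (du ∷ dv ∷ ds) f) with valid-local [] (b ∷ u) (c ∷ v) s V
  ... | _ , _ , low ((c<b ∷ _) ∷ _) = fails λ P mono → go P mono
    where
    go : ∀ {J} P → Mono J → eBar1 (realize J P (p₀ , (b ∷ u) ∷ (c ∷ v) ∷ s)) ≡ nothing
    go P mono rewrite ≤ᵇ-true (<⇒≤ (mono c<b)) = refl
  ... | _ , _ , high (b<c ∷ _) _ with Full-raise u (Dec⇒All du) b<c f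
  ...   | refl , f′ = moves (p₀ , (suc b ∷ b ∷ u) ∷ v ∷ s) (valid len (Dec-∷ (n<1+n b ∷ All.map m<n⇒m<1+n (Dec⇒All du)) du ∷ Dec-tail dv ∷ ds) f′) λ P mono → go P mono
    where
    go : ∀ {J} P → Mono J → eBar1 (realize J P (p₀ , (b ∷ u) ∷ (suc b ∷ v) ∷ s)) ≡ just (realize J P (p₀ , (suc b ∷ b ∷ u) ∷ v ∷ s))
    go {J} P mono with realize-raised {J} {P} {p₀} b u v s f f′
    ... | e₁ , e₂ = trans (cong eBar1 e₁) (trans (eBar1-eval (mono (n<1+n b))) (cong just (sym e₂)))

  fBar1-moves : ∀ p₀ b u v s → Valid n (suc k) (p₀ , (b ∷ u) ∷ v ∷ s) → All (_< b) v → Outcome fBar1 (p₀ , (b ∷ u) ∷ v ∷ s)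
  fBar1-moves p₀ b [] v s (valid len (_ ∷ dv ∷ ds) f) v<b = moves (p₀ , [] ∷ (b ∷ v) ∷ s) (valid len ([] ∷ Dec-∷ v<b dv ∷ ds) f)
    λ P mono → go v P mono v<b
    where
    go : ∀ v {J} P → Mono J → All (_< b) v → fBar1 (realize J P (p₀ , [ b ] ∷ v ∷ s)) ≡ just (realize J P (p₀ , [] ∷ (b ∷ v) ∷ s))
    go [] P mono _ = refl
    go (c ∷ v) P mono (c<b ∷ _) rewrite <ᵇ-true (mono c<b) = refl
  fBar1-moves p₀ c (b ∷ u) v s (valid len (du ∷ dv ∷ ds) f) v<c with Full-lower u (Dec⇒All (Dec-tail du)) (All.lookup (Dec⇒All du) (here refl)) f
  ... | refl , f′ = moves (p₀ , (b ∷ u) ∷ (suc b ∷ v) ∷ s) (valid len (Dec-tail du ∷ Dec-∷ v<c dv ∷ ds) f′) λ P mono → go v P mono f f′ v<c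
    where
    go : ∀ v {J} P → Mono J → Full (suc k) (suc b ∷ b ∷ u ++ v ++ concat s) → Full (suc k) (b ∷ u ++ suc b ∷ v ++ concat s) → All (_< suc b) v →
      fBar1 (realize J P (p₀ , (suc b ∷ b ∷ u) ∷ v ∷ s)) ≡ just (realize J P (p₀ , (b ∷ u) ∷ (suc b ∷ v) ∷ s))
    go v {J} P mono f f′ v<c with realize-raised {J} {P} {p₀} b u v s f′ f
    ... | e₁ , e₂ = trans (cong fBar1 e₂) (trans (fBar1-eval (map⁺ (All.map mono v<c))) (cong just (sym e₁)))

  fBar1-uniform : 1 < n → Uniform fBar1
  fBar1-uniform _ (p₀ , []) V = fails λ _ _ → refl
  fBar1-uniform _ (p₀ , [] ∷ s) V = fails λ _ _ → refl
  -- With a single factor the moved letter would have nowhere to go and would be lost; 1 < n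
  -- excludes this.
  fBar1-uniform (s≤s ()) (p₀ , (b ∷ u) ∷ []) (valid refl _ _)
  fBar1-uniform _ (p₀ , (b ∷ u) ∷ v ∷ s) V with valid-local [] (b ∷ u) v s V
  ... | _ , _ , high {c = c} {v} (b<c ∷ _) _ = fails λ P mono → go P mono
    where
    go : ∀ {J} P → Mono J → fBar1 (realize J P (p₀ , (b ∷ u) ∷ (c ∷ v) ∷ s)) ≡ nothing
    go P mono rewrite <ᵇ-false (<⇒≤ (mono b<c)) = refl
  ... | _ , _ , emptyV = fBar1-moves p₀ b u [] s V []
  ... | _ , _ , low {c = c} {v} (v<b ∷ _) = fBar1-moves p₀ b u (c ∷ v) s V v<b

  σWord-uniform : ∀ js → All (λ j → 1 ≤ j × j < n) js → Uniform (σWord js)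
  σWord-uniform [] [] = just-uniform
  σWord-uniform (zero ∷ js) ((() , _) ∷ _)
  σWord-uniform (suc j ∷ js) ((_ , j<n) ∷ a) = >>=-uniform (σ-uniform j j<n) (σWord-uniform js a)

  eBar-uniform : ∀ i → i < n → Uniform (eBar i)
  eBar-uniform zero _ = fails-uniform
  eBar-uniform (suc zero) _ = eBar1-uniform
  eBar-uniform (suc (suc i)) i<n =
    let below = <-trans (n<1+n _) i<n in
    >>=-uniform (σ-uniform i below) (>>=-uniform (σ-uniform (suc i) i<n)
      (>>=-uniform (eBar-uniform (suc i) below) (>>=-uniform (σ-uniform (suc i) i<n) (σ-uniform i below))))

  fBar-uniform : ∀ i → i < n → Uniform (fBar i)
  fBar-uniform zero _ = fails-uniform
  fBar-uniform (suc zero) 1<n = fBar1-uniform 1<n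
  fBar-uniform (suc (suc i)) i<n =
    let below = <-trans (n<1+n _) i<n in
    >>=-uniform (σ-uniform i below) (>>=-uniform (σ-uniform (suc i) i<n)
      (>>=-uniform (fBar-uniform (suc i) below) (>>=-uniform (σ-uniform (suc i) i<n) (σ-uniform i below))))

  ePrime-uniform : ∀ i → i ≤ n → Uniform (ePrime i)
  ePrime-uniform zero _ = fails-uniform
  ePrime-uniform (suc zero) _ = ePrime1-uniform
  ePrime-uniform (suc (suc i)) i<n =
    >>=-uniform (σ-uniform i i<n) (>>=-uniform (ePrime-uniform (suc i) (<⇒≤ i<n)) (σ-uniform i i<n))

  fPrime-uniform : ∀ i → i ≤ n → Uniform (fPrime i)
  fPrime-uniform zero _ = fails-uniform
  fPrime-uniform (suc zero) _ = fPrime1-uniform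
  fPrime-uniform (suc (suc i)) i<n =
    >>=-uniform (σ-uniform i i<n) (>>=-uniform (fPrime-uniform (suc i) (<⇒≤ i<n)) (σ-uniform i i<n))

  w0word-range : ∀ m → All (λ j → 1 ≤ j × j < m) (w0word m)
  w0word-range zero = []
  w0word-range (suc m) = ++⁺ (All.map (λ (p , q) → p , m<n⇒m<1+n q) (w0word-range m)) (downFrom-range m)
    where
    downFrom-range : ∀ m → All (λ j → 1 ≤ j × j < suc m) (downFrom m)
    downFrom-range zero = []
    downFrom-range (suc m) = (s≤s z≤n , ≤-refl) ∷ All.map (λ (p , q) → p , m<n⇒m<1+n q) (downFrom-range m)

  conjugate-uniform : ∀ {O} → Uniform O → Uniform (σWord (w0word n) ⊙ O ⊙ σWord (w0word n))
  conjugate-uniform u = >>=-uniform (σWord-uniform _ (w0word-range n)) (>>=-uniform u (σWord-uniform _ (w0word-range n)))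

  complement< : ∀ {i} → 1 ≤ i → i < n → n ∸ i < n
  complement< 1≤i i<n = ∸-monoʳ-< 1≤i (<⇒≤ i<n)

  applyOp-uniform : ∀ o → ValidOp n o → Uniform (applyOp n o)
  applyOp-uniform (eI (suc i)) (_ , i<n) = eOp-uniform i i<n
  applyOp-uniform (fI (suc i)) (_ , i<n) = fOp-uniform i i<n
  applyOp-uniform (eB i) (_ , i<n) = eBar-uniform i i<n
  applyOp-uniform (fB i) (_ , i<n) = fBar-uniform i i<n
  applyOp-uniform (eU i) (1≤i , i<n) = conjugate-uniform (fBar-uniform (n ∸ i) (complement< 1≤i i<n))
  applyOp-uniform (fU i) (1≤i , i<n) = conjugate-uniform (eBar-uniform (n ∸ i) (complement< 1≤i i<n))
  applyOp-uniform (eP i) (_ , i≤n) = ePrime-uniform i i≤n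
  applyOp-uniform (fP i) (_ , i≤n) = fPrime-uniform i i≤n

-- Boundedness of codes and the effect of one Demazure operator.

Placed : (ℕ → ℕ → Set) → ℕ → List (List ℕ) → Set
Placed Q j [] = ⊤
Placed Q j (u ∷ α) = All (Q j) u × Placed Q (suc j) α

Placed-++⁻ : ∀ {Q j} p {s} → Placed Q j (p ++ s) → Placed Q j p × Placed Q (j + length p) s
Placed-++⁻ {Q} {j} [] {s} h = tt , subst (λ i → Placed Q i s) (sym (+-identityʳ j)) h
Placed-++⁻ {Q} {j} (u ∷ p) {s} (a , h) with Placed-++⁻ p h
... | h₁ , h₂ = (a , h₁) , subst (λ i → Placed Q i s) (sym (+-suc j (length p))) h₂

Placed-++⁺ : ∀ {Q j} p {s} → Placed Q j p → Placed Q (j + length p) s → Placed Q j (p ++ s)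
Placed-++⁺ {Q} {j} [] {s} _ h = subst (λ i → Placed Q i s) (+-identityʳ j) h
Placed-++⁺ {Q} {j} (u ∷ p) {s} (a , h₁) h₂ = a , Placed-++⁺ p h₁ (subst (λ i → Placed Q i s) (+-suc j (length p)) h₂)

Placed-map : ∀ {Q Q′ : ℕ → ℕ → Set} {R : ℕ → Set} {j} α → (∀ {i m} → j ≤ i → i < j + length α → R m → Q i m → Q′ i m) →
  All R (concat α) → Placed Q j α → Placed Q′ j α
Placed-map [] f _ _ = tt
Placed-map {j = j} (u ∷ α) f r (a , h) =
  All.zipWith (λ (r , q) → f ≤-refl (≤-trans (s≤s (m≤m+n j (length α))) (≤-reflexive (sym (+-suc j (length α))))) r q) (++⁻ˡ u r , a) ,
  Placed-map α (λ {i} j<i i< → f (<⇒≤ j<i) (subst (i <_) (sym (+-suc j (length α))) i<)) (++⁻ʳ u r) h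

Bounds : (ℕ → ℕ) → List (List ℕ) → Set
Bounds J = Placed (λ i m → i ≤ J m) 1

Bounded⇔Bounds : ∀ {J P} c → Bounded (realize J P c) ⇔ Bounds J (proj₂ c)
Bounded⇔Bounds {J} {P} (p₀ , α) = mk⇔ (to 1 α) (from 1 α)
  where
  L = letter J P p₀ (hd (concat α))
  to : ∀ j α → BoundedFrom j (real L α) → Placed (λ i m → i ≤ J m) j α
  to j [] _ = tt
  to j (u ∷ α) (a , h) = map⁻ a , to (suc j) α h
  from : ∀ j α → Placed (λ i m → i ≤ J m) j α → BoundedFrom j (real L α)
  from j [] _ = tt
  from j (u ∷ α) (a , h) = map⁺ a , from (suc j) α h

-- `A` and `B` stand for the bounds of the factors i and i + 1. Undoing the move returns a letter to
-- factor i + 1, hence the demand that `B` hold on `u′` as well.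
EMove-pull : ∀ {u v u′ v′} {A B : ℕ → Set} → EMove u v u′ v′ → All A u′ → All B u′ → All B v′ → All A u × All B v
EMove-pull first a (b ∷ []) bs = [] , b ∷ bs
EMove-pull (second {b} {u} _) a bu bs = proj₁ (∷ʳ⁻ {xs = b ∷ u} a) , proj₂ (∷ʳ⁻ {xs = b ∷ u} bu) ∷ bs
EMove-pull (third {b} {u} _ _) a bu (c ∷ bs) = proj₁ (∷ʳ⁻ {xs = b ∷ u} a) , c ∷ proj₂ (∷ʳ⁻ {xs = b ∷ u} bu) ∷ bs

EMove-push : ∀ {u v u′ v′} {A B : ℕ → Set} → EMove u v u′ v′ → All A u → All A v → All B v → All A u′ × All B v′
EMove-push first a (a′ ∷ _) (_ ∷ b) = a′ ∷ [] , b
EMove-push (second _) a (a′ ∷ _) (_ ∷ b) = ∷ʳ⁺ a a′ , b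
EMove-push (third _ _) a (_ ∷ a′ ∷ _) (b ∷ _ ∷ bs) = ∷ʳ⁺ a a′ , b ∷ bs

EMove-length : ∀ {u v u′ v′} → EMove u v u′ v′ → length v ≡ suc (length v′)
EMove-length first = refl
EMove-length (second _) = refl
EMove-length (third _ _) = refl

-- When v is nonempty, the operator fails only if the single letter of v is paired, and then that
-- letter exceeds all of u; a letter g below u cannot be it.
EMove-exists : ∀ {u v g} → Local u v → g ∈ v → All (g ≤_) u → ∃[ u′ ] ∃[ v′ ] EMove u v u′ v′
EMove-exists {v = _ ∷ _} emptyU _ _ = _ , _ , first
EMove-exists (low above) _ _ = _ , _ , second above
EMove-exists (high {v = []} (b<c ∷ _) _) (here refl) (c≤b ∷ _) = contradiction c≤b (<⇒≱ b<c)
EMove-exists (high {v = _ ∷ _} lt above) _ _ = _ , _ , third lt above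

sw-raise : ∀ {i x j} → x ≢ suc i → j ≤ x → j ≤ sw i x
sw-raise {i} {x} ne le with swView i x
... | at₀ rewrite sw-at₀ i = m≤n⇒m≤1+n le
... | at₁ = contradiction refl ne
... | off p q rewrite sw-off p q = le

sw-lower : ∀ {i x j} → x ≢ suc i → j ≢ suc i ⊎ x ≢ i → j ≤ sw i x → j ≤ x
sw-lower {i} {x} ne ne′ le with swView i x
... | at₁ = contradiction refl ne
... | off p q rewrite sw-off p q = le
sw-lower {i} ne (inj₁ j≢) le | at₀ rewrite sw-at₀ i = s≤s⁻¹ (≤∧≢⇒< le j≢)
sw-lower ne (inj₂ x≢) le | at₀ = contradiction refl x≢

-- J″ moves the unique rank g with J′ g = i to i + 1. Applying e_i to a
-- factorization bounded by J″ eventually moves g, which is then minimal in the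
-- factors i and i + 1, out of factor i + 1, and the result is bounded by J′.
module DemazureStep (n k i₀ : ℕ) (i<n : suc i₀ < n) (J′ J″ : ℕ → ℕ)
  (J′-reflects : ∀ {a b} → In 1 (suc (suc k)) a → In 1 (suc (suc k)) b → J′ a ≤ J′ b → a ≤ b)
  (J′-avoids : ∀ {m} → In 1 (suc (suc k)) m → J′ m ≢ suc (suc i₀))
  (J″-eq : ∀ {m} → In 1 (suc (suc k)) m → J″ m ≡ sw (suc i₀) (J′ m)) where

  open Operators n k

  i = suc i₀

  raise : ∀ {j m} → In 1 (suc (suc k)) m → j ≤ J′ m → j ≤ J″ m
  raise {j} r le = subst (j ≤_) (sym (J″-eq r)) (sw-raise (J′-avoids r) le)

  lower : ∀ {j m} → In 1 (suc (suc k)) m → j ≢ suc i ⊎ J′ m ≢ i → j ≤ J″ m → j ≤ J′ m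
  lower {j} r ne le = sw-lower (J′-avoids r) ne (subst (j ≤_) (J″-eq r) le)

  push-up : ∀ {m} → In 1 (suc (suc k)) m → i ≤ J″ m → suc i ≤ J″ m
  push-up {m} r le = ≤∧≢⇒< le λ e → J′-avoids r (sw-inj i (trans (sym (J″-eq r)) (trans (sym e) (sym (sw-at₁ i)))))

  ranges : ∀ {p₀} p u v s → Valid n (suc k) (p₀ , p ++ u ∷ v ∷ s) →
    All (In 1 (suc (suc k))) (concat p) × All (In 1 (suc (suc k))) u × All (In 1 (suc (suc k))) v × All (In 1 (suc (suc k))) (concat s)
  ranges p u v s V with ++⁻ (concat p) (subst (All _) (sym (concat-++ p (u ∷ v ∷ s))) (Full-range (Valid.reading V)))
  ... | rp , r = rp , ++⁻ˡ u r , ++⁻ˡ v (++⁻ʳ u r) , ++⁻ʳ v (++⁻ʳ u r)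

  module _ (P : ℕ → Bool) {J : ℕ → ℕ} (mono : Mono J) where

    -- The values of J″ avoid i, so a letter that J″ allows in factor i is allowed in factor i + 1
    -- too. Going back along e_i therefore keeps the bound by J″.
    unplace : ∀ {X : Elem → Set} → (∀ {c} → Valid n (suc k) c → X (realize J P c) → Bounds J′ (proj₂ c)) →
      ∀ t {c d} → Valid n (suc k) c → iterM t (eOp i) (realize J P c) ≡ just d → X d → Bounds J″ (proj₂ c)
    unplace X⇒ zero {_ , α} V refl x = Placed-map α (λ _ _ → raise) (Full-range (Valid.reading V)) (X⇒ V x)
    unplace {X} X⇒ (suc t) {p₀ , α} {d} V e x with split-at i₀ α (subst (i <_) (sym (Valid.factors V)) i<n)
    ... | split p u v s refl with valid-local p u v s V
    ...   | du , dv , loc with eMove? loc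
    ...     | inj₁ h = contradiction (trans (sym e) (cong (_>>= iterM t (eOp i)) (eOp-realize-none P mono p s h))) λ ()
    ...     | inj₂ (u′ , v′ , mv) with Rearrange-Valid p s (EMove-Rearrange mv) (EMove-Dec du dv mv) V
    ...       | V′ with Placed-++⁻ p (unplace X⇒ t V′ (trans (sym (cong (_>>= iterM t (eOp i)) (EMove-realize P mono p s dv mv))) e) x) | ranges p u′ v′ s V′
    ...         | bp , bu , bv , bs | _ , ru , rv , _ =
      let bu′ , bv′ = EMove-pull mv bu (All.zipWith (λ (r , b) → push-up r b) (ru , bu)) bv in
      Placed-++⁺ p bp (bu′ , bv′ , bs)

    place : ∀ t {p₀} p u v s → length v ≤ t → length p ≡ i₀ → Valid n (suc k) (p₀ , p ++ u ∷ v ∷ s) → Bounds J″ (p ++ u ∷ v ∷ s) →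
      ∃[ t′ ] ∃[ c ] Valid n (suc k) c × iterM t′ (eOp i) (realize J P (p₀ , p ++ u ∷ v ∷ s)) ≡ just (realize J P c) × Bounds J′ (proj₂ c)
    place t {p₀} p u v s len refl V b with Placed-++⁻ p b | ranges p u v s V
    ... | bp , bu , bv , bs | rp , ru , rv , rs with any? (λ m → J′ m ≟ i) v
    -- The bounds by J″ and J′ differ only for the rank g in factor i + 1, so nothing is left to do
    -- once g is not there.
    ...   | no none = 0 , _ , V , refl , Placed-++⁺ p
      (Placed-map p (λ _ lt r → lower r (inj₁ (<⇒≢ (m<n⇒m<1+n lt)))) rp bp)
      (All.zipWith (λ (r , b) → lower r (inj₁ (<⇒≢ (n<1+n _))) b) (ru , bu) ,
       All.tabulate (λ m∈ → lower (All.lookup rv m∈) (inj₂ λ e → none (lose m∈ e)) (All.lookup bv m∈)) ,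
       Placed-map s (λ le _ r → lower r (inj₁ (>⇒≢ le))) rs bs)
    ...   | yes some with find some | valid-local p u v s V
    ...     | g , g∈ , e | du , dv , loc
      -- Letters in factor i have J′-value at least i = J′ g, so g is below all of them and e_i
      -- applies; each move shortens factor i + 1.
      with EMove-exists loc g∈ (All.zipWith (λ { (r , b) → J′-reflects (All.lookup rv g∈) r (≤-trans (≤-reflexive e) (lower r (inj₁ (<⇒≢ (n<1+n _))) b)) }) (ru , bu))
    ...       | u′ , v′ , mv with t | ≤-trans (≤-reflexive (sym (EMove-length mv))) len
    ...         | suc t | s≤s len′ with EMove-push mv bu (All.map (≤-trans (n≤1+n i)) bv) bv
    ...           | bu′ , bv′ with place t p u′ v′ s len′ refl (Rearrange-Valid p s (EMove-Rearrange mv) (EMove-Dec du dv mv) V) (Placed-++⁺ p bp (bu′ , bv′ , bs))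
    ...             | t′ , c , V′ , e′ , b′ = suc t′ , c , V′ , trans (cong (_>>= iterM t′ (eOp i)) (EMove-realize P mono p s dv mv)) e′ , b′

-- Growth of a sum of images under adjacent transpositions.

sw-mono-avoiding : ∀ {i x y} → x < y → x ≢ suc i → y ≢ suc i → sw i x < sw i y
sw-mono-avoiding {i} {x} {y} x<y x≢ y≢ with swView i x | swView i y
... | at₁ | _ = contradiction refl x≢
... | _ | at₁ = contradiction refl y≢
... | at₀ | at₀ = contradiction x<y (n≮n i)
... | at₀ | off p q rewrite sw-at₀ i | sw-off p q = ≤∧≢⇒< x<y (q ∘ sym)
... | off p q | at₀ rewrite sw-off p q | sw-at₀ i = m<n⇒m<1+n x<y
... | off p q | off p′ q′ rewrite sw-off p q | sw-off p′ q′ = x<y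

sum-≤ : ∀ {A : Set} {f g : A → ℕ} {xs} → All (λ x → f x ≤ g x) xs → sum (map f xs) ≤ sum (map g xs)
sum-≤ [] = z≤n
sum-≤ (le ∷ a) = +-mono-≤ le (sum-≤ a)

sw-sum-∉ : ∀ {i} xs → i ∉ xs → sum (map (sw i) xs) ≤ sum xs
sw-sum-∉ {i} xs i∉ = subst (sum (map (sw i) xs) ≤_) (cong sum (map-id xs)) (sum-≤ {g = id} (All.tabulate (λ x∈ → le x∈)))
  where
  le : ∀ {x} → x ∈ xs → sw i x ≤ x
  le {x} x∈ with swView i x
  ... | at₀ = contradiction x∈ i∉
  ... | at₁ rewrite sw-at₁ i = n≤1+n i
  ... | off p q rewrite sw-off p q = ≤-refl

sw-sum-∈ : ∀ {i xs zs} → xs ↭ i ∷ zs → sum (map (sw i) xs) ≡ suc (i + sum (map (sw i) zs))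
sw-sum-∈ {i} {zs = zs} p = trans (sum-↭ (↭P.map⁺ (sw i) p)) (cong (_+ sum (map (sw i) zs)) (sw-at₀ i))

-- The sum grows only when i moves to a free i + 1. If both numbers occur they change places, and if
-- only i + 1 occurs the sum drops.
sw-sum : ∀ i xs → Unique xs →
  (i ∈ xs × suc i ∉ xs × sum (map (sw i) xs) ≡ suc (sum xs)) ⊎ sum (map (sw i) xs) ≤ sum xs
sw-sum i xs u with _∈?_ _≟_ i xs
... | no i∉ = inj₂ (sw-sum-∉ xs i∉)
... | yes i∈ with ∈-remove i∈
...   | zs , p with Unique-resp-↭ p u | _∈?_ _≟_ (suc i) xs
...     | i∉ ∷ _ | no si∉ = inj₁ (i∈ , si∉ , trans (sw-sum-∈ p) (cong suc (trans (cong (λ l → i + sum l) fixed) (sym (sum-↭ p)))))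
  where
  fixed : map (sw i) zs ≡ zs
  fixed = map-id-local (All.tabulate λ z∈ →
    sw-off (λ e → All.lookup i∉ z∈ (sym e)) (λ { refl → si∉ (∈-resp-↭ (↭-sym p) (there z∈)) }))
...     | i∉ ∷ u′ | yes si∈ = inj₂ (≤-trans (≤-reflexive (sw-sum-∈ p)) (≤-trans (≤-reflexive (sym (+-suc i _)))
  (≤-trans (+-monoʳ-≤ i (drop (tail (∈-resp-↭ p si∈)))) (≤-reflexive (sym (sum-↭ p))))))
  where
  tail : suc i ∈ i ∷ zs → suc i ∈ zs
  tail (there si∈) = si∈
  tail (here e) = contradiction e 1+n≢n
  drop : suc i ∈ zs → suc (sum (map (sw i) zs)) ≤ sum zs
  drop si∈ with ∈-remove si∈
  ... | ws , q = ≤-trans (≤-reflexive (cong suc (trans (sum-↭ (↭P.map⁺ (sw i) q)) (cong (_+ sum (map (sw i) ws)) (sw-at₁ i)))))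
    (≤-trans (s≤s (+-monoʳ-≤ i (sw-sum-∉ ws λ i∈ → All.lookup i∉ (∈-resp-↭ (↭-sym q) (there i∈)) refl))) (≤-reflexive (sym (sum-↭ q))))

-- Words along which the sum grows at every letter: exactly one image moves, from i to a free i + 1.
-- This is the hypothesis that a Demazure step needs at each letter.
data Tight (K : ℕ) : List ℕ → Set where
  []   : Tight K []
  step : ∀ {i us} → 1 ≤ i → (∃[ g ] In 1 (suc K) g × act us g ≡ i) → (∀ {m} → In 1 (suc K) m → act us m ≢ suc i) →
         Tight K us → Tight K (i ∷ us)

Tight-mono : ∀ {K us} → Tight K us → ∀ {a b} → In 1 (suc K) a → In 1 (suc K) b → a < b → act us a < act us b
Tight-mono [] _ _ lt = lt
Tight-mono (step _ _ avoids t) ra rb lt = sw-mono-avoiding (Tight-mono t ra rb lt) (avoids ra) (avoids rb)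

Tight-grows : ∀ {K i us} → Tight K (i ∷ us) → ∀ {m} → In 1 (suc K) m → act us m ≤ act (i ∷ us) m
Tight-grows (step _ _ avoids _) r = sw-raise (avoids r) ≤-refl

-- The composition α and the hook that it sorts to.

insert-↭ : ∀ le x ys → insertBy le x ys ↭ x ∷ ys
insert-↭ le x [] = ↭-refl
insert-↭ le x (y ∷ ys) with le x y
... | true = ↭-refl
... | false = ↭-trans (↭-prep y (insert-↭ le x ys)) (↭.swap y x ↭-refl)

sortDesc-↭ : ∀ xs → sortDesc xs ↭ xs
sortDesc-↭ [] = ↭-refl
sortDesc-↭ (x ∷ xs) = ↭-trans (insert-↭ _ x (sortDesc xs)) (↭-prep x (sortDesc-↭ xs))

sortDesc-sorted : ∀ xs → AllPairs (λ x y → y ≤ x) (sortDesc xs)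
sortDesc-sorted [] = []
sortDesc-sorted (x ∷ xs) = insert (sortDesc xs) (sortDesc-sorted xs)
  where
  insert : ∀ ys → AllPairs (λ x y → y ≤ x) ys → AllPairs (λ x y → y ≤ x) (insertBy (λ x y → y ≤ᵇ x) x ys)
  insert [] [] = [] ∷ []
  insert (y ∷ ys) (a ∷ ps) with y ≤? x
  ... | yes le rewrite ≤ᵇ-true le = (le ∷ All.map (λ z≤y → ≤-trans z≤y le) a) ∷ a ∷ ps
  ... | no gt rewrite ≤ᵇ-false (≰⇒> gt) = All-resp-↭ (↭-sym (insert-↭ _ x ys)) (<⇒≤ (≰⇒> gt) ∷ a) ∷ insert ys ps

-- The number of zeros in the list of α depends on `J`; comparing only the other entries determines
-- the sorted list up to final zeros, which `entry` does not see.
nonzero : List ℕ → List ℕ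
nonzero [] = []
nonzero (zero ∷ xs) = nonzero xs
nonzero (suc x ∷ xs) = suc x ∷ nonzero xs

nonzero-↭ : ∀ {xs ys} → xs ↭ ys → nonzero xs ↭ nonzero ys
nonzero-↭ ↭.refl = ↭-refl
nonzero-↭ (↭.prep zero p) = nonzero-↭ p
nonzero-↭ (↭.prep (suc x) p) = ↭-prep (suc x) (nonzero-↭ p)
nonzero-↭ (↭.swap zero zero p) = nonzero-↭ p
nonzero-↭ (↭.swap zero (suc y) p) = ↭-prep (suc y) (nonzero-↭ p)
nonzero-↭ (↭.swap (suc x) zero p) = ↭-prep (suc x) (nonzero-↭ p)
nonzero-↭ (↭.swap (suc x) (suc y) p) = ↭.swap (suc x) (suc y) (nonzero-↭ p)
nonzero-↭ (↭.trans p q) = ↭-trans (nonzero-↭ p) (nonzero-↭ q)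

All-nonzero : ∀ {Q : ℕ → Set} xs → All Q xs → All Q (nonzero xs)
All-nonzero [] [] = []
All-nonzero (zero ∷ xs) (_ ∷ a) = All-nonzero xs a
All-nonzero (suc x ∷ xs) (q ∷ a) = q ∷ All-nonzero xs a

entry-0 : ∀ xs → entry xs 0 ≡ 0
entry-0 [] = refl
entry-0 (_ ∷ _) = refl

entry-addC : ∀ xs ys j → entry (addC xs ys) j ≡ entry xs j + entry ys j
entry-addC [] ys j = refl
entry-addC (x ∷ xs) [] j = sym (+-identityʳ _)
entry-addC (x ∷ xs) (y ∷ ys) zero = refl
entry-addC (x ∷ xs) (y ∷ ys) (suc zero) = refl
entry-addC (x ∷ xs) (y ∷ ys) (suc (suc j)) = entry-addC xs ys (suc j)

entry-scaledE : ∀ c {i} → 1 ≤ i → entry (scaledE c i) i ≡ c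
entry-scaledE c {suc zero} _ = refl
entry-scaledE c {suc (suc i)} _ = entry-scaledE c {suc i} (s≤s z≤n)

entry-scaledE-other : ∀ c i {j} → 1 ≤ i → j ≢ i → entry (scaledE c i) j ≡ 0
entry-scaledE-other c i {zero} _ _ = entry-0 (scaledE c i)
entry-scaledE-other c (suc zero) {suc zero} _ ne = contradiction refl ne
entry-scaledE-other c (suc zero) {suc (suc j)} _ _ = refl
entry-scaledE-other c (suc (suc i)) {suc zero} _ _ = refl
entry-scaledE-other c (suc (suc i)) {suc (suc j)} _ ne = entry-scaledE-other c (suc i) (s≤s z≤n) (ne ∘ cong suc)

addC-identityʳ : ∀ xs → addC xs [] ≡ xs
addC-identityʳ [] = refl
addC-identityʳ (_ ∷ _) = refl

nonzero-addC : ∀ c {i} ys → 1 ≤ i → entry ys i ≡ 0 → nonzero (addC (scaledE (suc c) i) ys) ↭ suc c ∷ nonzero ys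
nonzero-addC c {suc zero} [] _ _ = ↭-refl
nonzero-addC c {suc zero} (zero ∷ ys) _ _ = ↭-reflexive (cong (λ d → suc d ∷ nonzero ys) (+-identityʳ c))
nonzero-addC c {suc (suc i)} [] _ _ = subst (λ l → nonzero l ↭ [ suc c ]) (addC-identityʳ (scaledE (suc c) (suc i))) (nonzero-addC c {suc i} [] (s≤s z≤n) refl)
nonzero-addC c {suc (suc i)} (zero ∷ ys) _ e = nonzero-addC c {suc i} ys (s≤s z≤n) e
nonzero-addC c {suc (suc i)} (suc y ∷ ys) _ e =
  ↭-trans (↭-prep (suc y) (nonzero-addC c {suc i} ys (s≤s z≤n) e)) (↭.swap (suc y) (suc c) ↭-refl)

indicator : List ℕ → List ℕ
indicator is = foldr addC [] (map (scaledE 1) is)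

entry-indicator-∉ : ∀ {j} is → All (1 ≤_) is → j ∉ is → entry (indicator is) j ≡ 0
entry-indicator-∉ [] _ _ = refl
entry-indicator-∉ {j} (i ∷ is) (1≤i ∷ a) j∉ = trans (entry-addC (scaledE 1 i) (indicator is) j)
  (cong₂ _+_ (entry-scaledE-other 1 i 1≤i (j∉ ∘ here)) (entry-indicator-∉ is a (j∉ ∘ there)))

entry-indicator-∈ : ∀ {j} is → All (1 ≤_) is → Unique is → j ∈ is → entry (indicator is) j ≡ 1
entry-indicator-∈ {j} (i ∷ is) (1≤i ∷ a) (i∉ ∷ u) (here refl) = trans (entry-addC (scaledE 1 i) (indicator is) j)
  (cong₂ _+_ (entry-scaledE 1 1≤i) (entry-indicator-∉ is a (λ j∈ → All.lookup i∉ j∈ refl)))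
entry-indicator-∈ {j} (i ∷ is) (1≤i ∷ a) (i∉ ∷ u) (there j∈) = trans (entry-addC (scaledE 1 i) (indicator is) j)
  (cong₂ _+_ (entry-scaledE-other 1 i 1≤i (λ e → All.lookup i∉ j∈ (sym e))) (entry-indicator-∈ is a u j∈))

nonzero-indicator : ∀ is → All (1 ≤_) is → Unique is → nonzero (indicator is) ↭ replicate (length is) 1
nonzero-indicator [] _ _ = ↭-refl
nonzero-indicator (i ∷ is) (1≤i ∷ a) (i∉ ∷ u) = ↭-trans
  (nonzero-addC 0 (indicator is) 1≤i (entry-indicator-∉ is a (λ i∈ → All.lookup i∉ i∈ refl)))
  (↭-prep 1 (nonzero-indicator is a u))

zeros : ∀ {l} → All (_≤ 0) l → ∀ i → entry l i ≡ 0
zeros [] i = refl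
zeros (le ∷ a) zero = refl
zeros (z≤n ∷ a) (suc zero) = refl
zeros (le ∷ a) (suc (suc i)) = zeros a (suc i)

nonzero-zeros : ∀ {l} → All (_≤ 0) l → nonzero l ≡ []
nonzero-zeros [] = refl
nonzero-zeros (z≤n ∷ a) = nonzero-zeros a

sorted-ones : ∀ l k → AllPairs (λ x y → y ≤ x) l → nonzero l ↭ replicate k 1 →
  (∀ {i} → 1 ≤ i → i ≤ k → entry l i ≡ 1) × (∀ {i} → k < i → entry l i ≡ 0)
sorted-ones [] zero _ _ = (λ 1≤i i≤0 → contradiction (≤-trans 1≤i i≤0) λ ()) , (λ _ → refl)
sorted-ones [] (suc k) _ p = contradiction (↭-length p) λ ()
sorted-ones (zero ∷ l) zero (a ∷ _) p = (λ 1≤i i≤0 → contradiction (≤-trans 1≤i i≤0) λ ()) , λ {i} _ → zeros (z≤n ∷ a) i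
sorted-ones (zero ∷ l) (suc k) (a ∷ _) p = contradiction (trans (sym (↭-length p)) (cong length (nonzero-zeros a))) λ ()
sorted-ones (suc x ∷ l) zero _ p = contradiction (↭-length p) λ ()
sorted-ones (suc x ∷ l) (suc k) (_ ∷ s) p with All.lookup (AllP.replicate⁺ {P = _≡ 1} (suc k) refl) (∈-resp-↭ p (here refl))
... | refl with sorted-ones l k s (drop-∷ p)
...   | ones , rest = (λ { {suc zero} _ _ → refl ; {suc (suc i)} _ (s≤s le) → ones (s≤s z≤n) le }) ,
  (λ { {suc (suc i)} (s≤s lt) → rest lt ; {suc zero} (s≤s ()) })

sorted-hook : ∀ l k → AllPairs (λ x y → y ≤ x) l → nonzero l ↭ suc k ∷ replicate k 1 → Hook l (suc k)
sorted-hook [] k _ p = contradiction (↭-length p) λ ()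
sorted-hook (zero ∷ l) k (a ∷ _) p = contradiction (trans (sym (↭-length p)) (cong length (nonzero-zeros a))) λ ()
sorted-hook (suc x ∷ l) k (a ∷ s) p with ≤-antisym x≤k k≤x
  where
  x≤k : suc x ≤ suc k
  x≤k with ∈-resp-↭ p (here refl)
  ... | here refl = ≤-refl
  ... | there x∈ with All.lookup (AllP.replicate⁺ {P = _≡ 1} k refl) x∈
  ...   | refl = s≤s z≤n
  k≤x : suc k ≤ suc x
  k≤x with ∈-resp-↭ (↭-sym p) (here refl)
  ... | here refl = ≤-refl
  ... | there k∈ = All.lookup (All-nonzero l a) k∈
... | refl with sorted-ones l k s (drop-∷ p)
...   | ones , rest = refl , (λ { {suc (suc i)} _ (s≤s le) → ones (s≤s z≤n) le ; {suc zero} (s≤s ()) _ }) , (λ { {suc (suc i)} (s≤s lt) _ → rest lt ; {suc zero} _ (s≤s ()) })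

-- Images of 1, ..., K and a comparison word for u(α).

Image : ℕ → List ℕ → List ℕ
Image K us = map (act us) (ups K)

ups-Unique : ∀ K → Unique (ups K)
ups-Unique zero = []
ups-Unique (suc K) = Full-Unique (Full-ups K)

∈-ups : ∀ {K m} → In 1 (suc K) m → m ∈ ups K
∈-ups {K} {suc m} (_ , s≤s m<K) = ∈-applyUpTo⁺ suc m<K

ups-∈ : ∀ {K m} → m ∈ ups K → In 1 (suc K) m
ups-∈ {K} m∈ = All.lookup (ups-range K) m∈

Image-sum : ∀ K us → sum (Image K us) ≤ length us + sum (ups K)
Image-sum K [] = ≤-reflexive (cong sum (map-id (ups K)))
Image-sum K (i ∷ us) with sw-sum i (Image K us) (UniqueP.map⁺ (act-inj us) (ups-Unique K))
... | inj₁ (_ , _ , e) = ≤-trans (≤-reflexive (trans (cong sum (map-∘ (ups K))) e)) (s≤s (Image-sum K us))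
... | inj₂ le = ≤-trans (≤-reflexive (cong sum (map-∘ (ups K)))) (≤-trans le (m≤n⇒m≤1+n (Image-sum K us)))

-- Each letter raises the sum of the images of 1, ..., K by at most 1.
Image-tight : ∀ K {us} → Word us → length us + sum (ups K) ≤ sum (Image K us) → Tight K us
Image-tight K [] _ = []
Image-tight K {i ∷ us} (1≤i ∷ wd) le with sw-sum i (Image K us) (UniqueP.map⁺ (act-inj us) (ups-Unique K))
... | inj₂ le′ = contradiction (≤-trans le (≤-trans (≤-reflexive (cong sum (map-∘ (ups K)))) (≤-trans le′ (Image-sum K us)))) 1+n≰n
... | inj₁ (i∈ , si∉ , e) with ∈-map⁻ (act us) i∈
...   | g , g∈ , e′ = step 1≤i (g , ups-∈ g∈ , sym e′)
  (λ r e″ → si∉ (subst (_∈ Image K us) e″ (∈-map⁺ (act us) (∈-ups r))))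
  (Image-tight K wd (s≤s⁻¹ (≤-trans le (≤-reflexive (trans (cong sum (map-∘ (ups K))) e)))))

climb : ℕ → ℕ → List ℕ
climb a zero = []
climb a (suc d) = d + a ∷ climb a d

act-climb : ∀ a d → act (climb a d) a ≡ d + a
act-climb a zero = refl
act-climb a (suc d) rewrite act-climb a d = sw-at₀ (d + a)

climb-range : ∀ a d → All (In a (d + a)) (climb a d)
climb-range a zero = []
climb-range a (suc d) = (m≤n+m a d , ≤-refl) ∷ All.map (λ (p , q) → p , m<n⇒m<1+n q) (climb-range a d)

length-climb : ∀ a d → length (climb a d) ≡ d
length-climb a zero = refl
length-climb a (suc d) = cong suc (length-climb a d)

act-fixes-below : ∀ {w x} → All (x <_) w → act w x ≡ x
act-fixes-below [] = refl
act-fixes-below {i ∷ w} (lt ∷ a) rewrite act-fixes-below a = sw-below lt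

act-fixes-above : ∀ {w x} → All (λ i → suc i < x) w → act w x ≡ x
act-fixes-above [] = refl
act-fixes-above {i ∷ w} (lt ∷ a) rewrite act-fixes-above a = sw-above lt

-- The comparison word: its length is the sum of the differences J m - m, the least that the growth
-- of the sum permits. The rightmost part acts first, so the largest rank climbs first and never
-- meets the smaller ones.
climbs : (ℕ → ℕ) → ℕ → List ℕ
climbs J zero = []
climbs J (suc K) = climbs J K ++ climb (suc K) (J (suc K) ∸ suc K)

module _ {J : ℕ → ℕ} (mono : Mono J) where

  climb-top : ∀ K → (J (suc K) ∸ suc K) + suc K ≡ J (suc K)
  climb-top K = m∸n+n≡m (Mono-≥id mono (suc K))

  climbs-range : ∀ K → All (λ i → 1 ≤ i × i < J K) (climbs J K)
  climbs-range zero = []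
  climbs-range (suc K) = ++⁺ (All.map (λ (p , q) → p , <-trans q (mono (n<1+n K))) (climbs-range K))
    (All.map (λ (p , q) → ≤-trans (s≤s z≤n) p , <-≤-trans q (≤-reflexive (climb-top K))) (climb-range (suc K) _))

  act-climbs : ∀ K {m} → In 1 (suc K) m → act (climbs J K) m ≡ J m
  act-climbs zero (1≤m , m<1) = contradiction m<1 (≤⇒≯ 1≤m)
  act-climbs (suc K) {m} (1≤m , s≤s m≤K) with m ≟ suc K
  ... | yes refl = trans (act-++ (climbs J K) _ m) (trans (cong (act (climbs J K)) (trans (act-climb m _) (climb-top K)))
    (act-fixes-above (All.map (λ (_ , lt) → ≤-<-trans lt (mono (n<1+n K))) (climbs-range K))))
  ... | no ne = trans (act-++ (climbs J K) _ m) (trans (cong (act (climbs J K)) (act-fixes-below (All.map (λ (le , _) → <-≤-trans m<K le) (climb-range (suc K) (J (suc K) ∸ suc K)))))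
    (act-climbs K (1≤m , m<K)))
    where m<K = ≤∧≢⇒< m≤K ne

  length-climbs : ∀ K → length (climbs J K) + sum (ups K) ≡ sum (map J (ups K))
  length-climbs zero = refl
  length-climbs (suc K) = begin
    length (climbs J K ++ c) + sum (ups (suc K))                    ≡⟨ cong₂ _+_ (length-++ (climbs J K)) sum-ups ⟩
    (length (climbs J K) + length c) + (sum (map id (ups K)) + suc K) ≡⟨ cong (λ l → (length (climbs J K) + length c) + (sum l + suc K)) (map-id (ups K)) ⟩
    (length (climbs J K) + length c) + (sum (ups K) + suc K)        ≡⟨ interchange (length (climbs J K)) (length c) (sum (ups K)) (suc K) ⟩
    (length (climbs J K) + sum (ups K)) + (length c + suc K)        ≡⟨ cong₂ _+_ (length-climbs K) (trans (cong (_+ suc K) (length-climb (suc K) _)) (climb-top K)) ⟩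
    sum (map J (ups K)) + J (suc K)                                 ≡⟨ sum-map-ups J ⟨
    sum (map J (ups (suc K)))                                       ∎
    where
    open ≡-Reasoning
    c = climb (suc K) (J (suc K) ∸ suc K)
    sum-map-ups : ∀ f → sum (map f (ups (suc K))) ≡ sum (map f (ups K)) + f (suc K)
    sum-map-ups f = trans (cong sum (map-ups-∷ʳ f K)) (trans (sum-++ (map f (ups K)) [ f (suc K) ]) (cong (sum (map f (ups K)) +_) (+-identityʳ (f (suc K)))))
    sum-ups : sum (ups (suc K)) ≡ sum (map id (ups K)) + suc K
    sum-ups = trans (cong sum (sym (map-id (ups (suc K))))) (sum-map-ups id)
    interchange : ∀ a b c d → (a + b) + (c + d) ≡ (a + c) + (b + d)
    interchange = solve-∀

increasing-↭ : ∀ {xs ys} → AllPairs _<_ xs → AllPairs _<_ ys → xs ↭ ys → xs ≡ ys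
increasing-↭ {[]} {[]} _ _ _ = refl
increasing-↭ {[]} {y ∷ ys} _ _ p = contradiction (↭-length p) λ ()
increasing-↭ {x ∷ xs} {[]} _ _ p = contradiction (↭-length p) λ ()
increasing-↭ {x ∷ xs} {y ∷ ys} (a ∷ s) (b ∷ t) p with ≤-antisym (least a (∈-resp-↭ (↭-sym p) (here refl))) (least b (∈-resp-↭ p (here refl)))
  where
  least : ∀ {x xs z} → All (x <_) xs → z ∈ x ∷ xs → x ≤ z
  least a (here refl) = ≤-refl
  least a (there z∈) = <⇒≤ (All.lookup a z∈)
... | refl = cong (x ∷_) (increasing-↭ s t (drop-∷ p))

map-≡⇒ : ∀ {A B : Set} {f g : A → B} xs → map f xs ≡ map g xs → ∀ {x} → x ∈ xs → f x ≡ g x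
map-≡⇒ (x ∷ xs) e (here refl) = proj₁ (∷-injective e)
map-≡⇒ (x ∷ xs) e (there x∈) = map-≡⇒ xs (proj₂ (∷-injective e)) x∈

ups-increasing : ∀ {K} (f : ℕ → ℕ) → (∀ {a b} → In 1 (suc K) a → In 1 (suc K) b → a < b → f a < f b) → AllPairs _<_ (map f (ups K))
ups-increasing {K} f h = subst (AllPairs _<_) (sym (map-applyUpTo suc f K))
  (AllPairsP.applyUpTo⁺₁ (f ∘ suc) K λ i<j j<K → h (s≤s z≤n , s≤s (<-trans i<j j<K)) (s≤s z≤n , s≤s j<K) (s≤s i<j))

alphaO-sorted : ∀ T {i is} → sortAsc (map ceil T) ≡ i ∷ is → alphaO T ≡ addC (scaledE (length T) i) (indicator is)
alphaO-sorted T e rewrite e = refl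

In? : ∀ l r x → Nullary.Dec (In l r x)
In? l r x = l ≤? x ×-dec x <? r

module Composition {J : ℕ → ℕ} (mono : Mono J) (k : ℕ) where

  js is α : List ℕ
  js = map J (ups (suc k))
  is = map J (applyUpTo (suc ∘ suc) k)
  α = addC (scaledE (suc k) (J 1)) (indicator is)

  js-Unique : Unique js
  js-Unique = UniqueP.map⁺ (Mono-inj mono) (ups-Unique (suc k))

  js-positive : All (1 ≤_) js
  js-positive = map⁺ (All.map (λ (p , _) → ≤-trans p (Mono-≥id mono _)) (ups-range (suc k)))

  α-entry : ∀ j → entry α j ≡ entry (scaledE (suc k) (J 1)) j + entry (indicator is) j
  α-entry = entry-addC (scaledE (suc k) (J 1)) (indicator is)

  α-hook : Hook (lam α) (suc k)
  α-hook with js-Unique | js-positive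
  ... | j∉ ∷ u | 1≤j ∷ pos = sorted-hook (lam α) k (sortDesc-sorted α)
    (↭-trans (nonzero-↭ (sortDesc-↭ α))
      (↭-trans (nonzero-addC k (indicator is) 1≤j (entry-indicator-∉ is pos (λ j∈ → All.lookup j∉ j∈ refl)))
        (↭-prep (suc k) (subst (λ m → nonzero (indicator is) ↭ replicate m 1)
          (trans (length-map J (applyUpTo (suc ∘ suc) k)) (length-applyUpTo (suc ∘ suc) k)) (nonzero-indicator is pos u)))))

  λ-off : ∀ {m} → ¬ In 1 (suc (suc k)) m → entry (lam α) m ≡ 0
  λ-off {zero} _ = entry-0 (lam α)
  λ-off {suc zero} out = contradiction (s≤s z≤n , s≤s (s≤s z≤n)) out
  λ-off {m@(suc (suc _))} out = proj₂ (proj₂ α-hook) (≰⇒> λ le → out (s≤s z≤n , s≤s le)) (s≤s (s≤s z≤n))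

  λ-on : ∀ {m} → In 1 (suc (suc k)) m → entry (lam α) m ≢ 0
  λ-on {suc zero} _ e = contradiction (trans (sym (proj₁ α-hook)) e) λ ()
  λ-on {suc (suc m)} (_ , s≤s le) e = contradiction (trans (sym (proj₁ (proj₂ α-hook) (s≤s (s≤s z≤n)) le)) e) λ ()

  α-off : ∀ {j} → j ∉ js → entry α j ≡ 0
  α-off {j} j∉ with js-positive
  ... | 1≤j ∷ pos = trans (α-entry j) (cong₂ _+_ (entry-scaledE-other (suc k) (J 1) 1≤j (j∉ ∘ here)) (entry-indicator-∉ is pos (j∉ ∘ there)))

  α-on : ∀ {m} → In 1 (suc (suc k)) m → entry α (J m) ≡ entry (lam α) m
  α-on {suc zero} _ with js-Unique | js-positive
  ... | j∉ ∷ _ | 1≤j ∷ pos = trans (α-entry (J 1)) (trans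
    (cong₂ _+_ (entry-scaledE (suc k) 1≤j) (entry-indicator-∉ is pos (λ j∈ → All.lookup j∉ j∈ refl)))
    (trans (+-identityʳ (suc k)) (sym (proj₁ α-hook))))
  α-on {m@(suc (suc m′))} (_ , s≤s m≤k) with js-Unique | js-positive
  ... | _ ∷ u | 1≤j ∷ pos = trans (α-entry (J m)) (trans
    (cong₂ _+_ (entry-scaledE-other (suc k) (J 1) 1≤j (λ e → >⇒≢ (s≤s (s≤s z≤n)) (Mono-inj mono {m} {1} e)))
      (entry-indicator-∈ is pos u (∈-map⁺ J (∈-applyUpTo⁺ (suc ∘ suc) (s≤s⁻¹ m≤k)))))
    (sym (proj₁ (proj₂ α-hook) (s≤s (s≤s z≤n)) m≤k)))

  vs : List ℕ
  vs = climbs J (suc k)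

  vs-permutes : IsPermuteTo α vs
  vs-permutes j _ = subst (λ i → entry α i ≡ entry (lam α) x) (act-applyLR vs j) (go x)
    where
    x = applyLR vs j
    go : ∀ x → entry α (act vs x) ≡ entry (lam α) x
    go x with In? 1 (suc (suc k)) x
    ... | yes r = trans (cong (entry α) (act-climbs mono (suc k) r)) (α-on r)
    ... | no out = trans (α-off outside) (sym (λ-off out))
      where
      outside : act vs x ∉ js
      outside x∈ with ∈-map⁻ J x∈
      ... | m , m∈ , e = out (subst (In 1 (suc (suc k))) (act-inj vs (trans (act-climbs mono (suc k) (ups-∈ m∈)) (sym e))) (ups-∈ m∈))

  -- The permutation takes the support of λ, which is 1, ..., K, to the support of α, which consists
  -- of the entries of T.
  Image-↭ : ∀ {us} → IsPermuteTo α us → Image (suc k) us ↭ js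
  Image-↭ {us} perm with Unique⊆⇒↭ js-Unique sub
    where
    sub : ∀ {j} → j ∈ js → j ∈ Image (suc k) us
    sub {j} j∈ with ∈-map⁻ J j∈
    ... | m , m∈ , refl = subst (_∈ Image (suc k) us) (act-applyLR us (J m)) (∈-map⁺ (act us) (∈-ups inside))
      where
      inside : In 1 (suc (suc k)) (applyLR us (J m))
      inside with In? 1 (suc (suc k)) (applyLR us (J m))
      ... | yes r = r
      ... | no out = contradiction (trans (sym (α-on (ups-∈ m∈))) (trans (perm (J m) (All.lookup js-positive (∈-map⁺ J m∈))) (λ-off out))) (λ-on (ups-∈ m∈))
  ... | [] , p = ↭-trans p (↭-reflexive (++-identityʳ js))
  ... | y ∷ zs , p = contradiction (sym (trans (sym (length-map (act us) (ups (suc k)))) (trans (↭-length p)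
    (trans (length-++ js) (cong (_+ suc (length zs)) (length-map J (ups (suc k)))))))) (m+1+n≢m _)

  -- Minimality against the comparison word leaves just enough letters to raise the sum from that of
  -- 1, ..., K to that of the entries, so every letter must raise it.
  u-tight : ∀ {us} → IsReducedWordOfU α us → Tight (suc k) us
  u-tight {us} (wd , perm , minimal) = Image-tight (suc k) wd
    (≤-trans (+-monoˡ-≤ (sum (ups (suc k))) (minimal vs (All.map proj₁ (climbs-range mono (suc k))) vs-permutes))
      (≤-reflexive (trans (length-climbs mono (suc k)) (sym (sum-↭ (Image-↭ {us} perm))))))

  -- α alone does not distinguish the ranks 2, ..., K. A tight word preserves the order of 1, ...,
  -- K, so the set of images determines each image.
  u-act : ∀ {us} → IsReducedWordOfU α us → ∀ {m} → In 1 (suc (suc k)) m → act us m ≡ J m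
  u-act {us} red r = map-≡⇒ (ups (suc k)) (increasing-↭ (ups-increasing (act us) (Tight-mono (u-tight {us} red)))
    (ups-increasing J (λ _ _ → mono)) (Image-↭ {us} (proj₁ (proj₂ red)))) (∈-ups r)

-- Codes of factorizations and the isomorphism.

split-factors : ∀ (L : ℕ → PL) a w → map L w ≡ concat a → ∃[ α ] concat α ≡ w × real L α ≡ a
split-factors L [] [] e = [] , refl , refl
split-factors L (f ∷ a) w e with map-split L w f e
... | u , v , refl , e₁ , e₂ with split-factors L a v e₂
...   | α , refl , e₃ = u ∷ α , refl , cong₂ _∷_ e₁ e₃

Unique-++ʳ : ∀ {A : Set} (p : List A) {s} → Unique (p ++ s) → Unique s
Unique-++ʳ [] u = u
Unique-++ʳ (_ ∷ p) (_ ∷ u) = Unique-++ʳ p u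

Dec⇒StrictlyDecreasing : ∀ {L} → MonoL L → ∀ {w} → Dec w → StrictlyDecreasing (map L w)
Dec⇒StrictlyDecreasing mono [] = []
Dec⇒StrictlyDecreasing mono [-] = [-]
Dec⇒StrictlyDecreasing {L} mono (lt ∷ l) = MonoL-key {L} mono lt ∷ Dec⇒StrictlyDecreasing {L} mono l

StrictlyDecreasing⇒Dec : ∀ {J} {L : ℕ → PL} → Mono J → (∀ m → ceil (L m) ≡ J m) → ∀ w → Unique w → StrictlyDecreasing (map L w) → Dec w
StrictlyDecreasing⇒Dec mono e [] _ _ = []
StrictlyDecreasing⇒Dec mono e (x ∷ []) _ _ = [-]
StrictlyDecreasing⇒Dec {J} {L} mono e (x ∷ y ∷ w) ((x≢y ∷ _) ∷ u) (lt ∷ l) =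
  Mono-reflect mono (subst₂ _<_ (e y) (e x) (key-reflect {L y} {L x} lt λ e′ → x≢y (Mono-inj mono (trans (sym (e x)) (trans (sym e′) (e y))))))
  ∷ StrictlyDecreasing⇒Dec {J} {L} mono e (y ∷ w) u l

class⇒code : ∀ {J P n K a} → Mono J → length a ≡ n → All StrictlyDecreasing a → Class J P K (concat a) →
  ∃[ c ] Valid n K c × realize J P c ≡ a
class⇒code {J} {P} {n} {K} {a} mono len dec cl = go cl refl
  where
  decs : ∀ {L} → (∀ m → ceil (L m) ≡ J m) → ∀ α → Unique (concat α) → All StrictlyDecreasing (real L α) → All Dec α
  decs e [] _ _ = []
  decs {L} e (u ∷ α) un (d ∷ ds) = StrictlyDecreasing⇒Dec {J} {L} mono e u (Unique-++ˡ u un) d ∷ decs {L} e α (Unique-++ʳ u un) ds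
  go : ∀ {v} → Class J P K v → v ≡ concat a → ∃[ c ] Valid n K c × realize J P c ≡ a
  go (class p₀ {w} f) e with split-factors (letter J P p₀ (hd w)) a w e
  ... | α , refl , refl = (p₀ , α) , valid (trans (sym (length-map _ α)) len)
    (decs {letter J P p₀ (hd (concat α))} (λ _ → refl) α (Full-Unique f) dec) f , refl

code⇒class : ∀ {J P n K} c → Valid n K c → Class J P K (concat (realize J P c))
code⇒class {J} {P} {K = K} (p₀ , α) V = subst (Class J P K) (sym (concat-map α)) (class p₀ (Valid.reading V))

code⇒RF : ∀ {J P n K z} → Mono J → (∀ {v} → Class J P K v → InRO z v) → ∀ c → Valid n K c → RF n z (realize J P c)
code⇒RF {J} {P} mono inRO c@(p₀ , α) V = trans (length-map _ α) (Valid.factors V) ,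
  map⁺ (All.map (Dec⇒StrictlyDecreasing {letter J P p₀ (hd (concat α))} mono) (Valid.dec V)) , inRO (code⇒class c V)

searchRank : (ℕ → ℕ) → ℕ → ℕ → ℕ
searchRank J x zero = 0
searchRank J x (suc m) = if J (suc m) ≡ᵇ x then suc m else searchRank J x m

rank : (ℕ → ℕ) → ℕ → ℕ
rank J x = searchRank J x x

-- An increasing `J` has m ≤ J m, so the search for a preimage of x may start at x.
rank-inverse : ∀ {J} → Mono J → ∀ m → rank J (J m) ≡ m
rank-inverse {J} mono m = go (J m) (Mono-≥id mono m)
  where
  go : ∀ f → m ≤ f → searchRank J (J m) f ≡ m
  go zero z≤n = refl
  go (suc f) m≤f with m ≟ suc f
  ... | yes refl rewrite ≡ᵇ-true (J m) = refl
  ... | no ne rewrite ≡ᵇ-false {J (suc f)} {J m} (λ e → ne (sym (Mono-inj mono e))) = go f (s≤s⁻¹ (≤∧≢⇒< m≤f ne))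

firstPrimed : List PL → Bool
firstPrimed [] = false
firstPrimed (x ∷ _) = primed x

code : (ℕ → ℕ) → Elem → Code
code J a = firstPrimed (concat a) , map (map (rank J ∘ ceil)) a

code-realize : ∀ {J P n k} → Mono J → ∀ c → Valid n (suc k) c → code J (realize J P c) ≡ c
code-realize {J} {P} mono (p₀ , α) (valid _ _ f) = cong₂ _,_
  (trans (cong firstPrimed (concat-map α)) (first≡ f))
  (trans (sym (map-∘ α)) (trans (map-cong (λ u → trans (sym (map-∘ u)) (trans (map-cong (rank-inverse mono) u) (map-id u))) α) (map-id α)))
  where
  first≡ : ∀ {w k} → Full k w → firstPrimed (word J P p₀ w) ≡ p₀
  first≡ (full {a} _) = prime-start a

BRFα-RF : ∀ {n wl} us {b} → BRFα n wl us b → RF n wl b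
BRFα-RF [] = proj₁
BRFα-RF (_ ∷ _) = proj₁

module Demazure {wl : List ℕ} (n k : ℕ) (long : LongTransposition (suc k) (act wl)) where
  open Target {wl} {k} long

  RF⇒code : ∀ {b} → RF n wl b → ∃[ c ] Valid n (suc k) c × realize id noPrime c ≡ b
  RF⇒code (len , dec , inRO) = class⇒code id-Mono len dec (target-Class inRO)

  Tight-bound : ∀ {i us} → Tight (suc k) (i ∷ us) → (∀ {m} → In 1 (suc (suc k)) m → act (i ∷ us) m ≤ n) → i < n
  Tight-bound {i} (step _ (g , r , refl) _ _) below = ≤-trans (≤-reflexive (sym (sw-at₀ i))) (below r)

  -- Induction along the word: the empty word is ordinary boundedness for J = id, and each letter is
  -- one Demazure step. As images only grow, the bound by n for the whole word passes to its tails
  -- and keeps each letter i below n.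
  BRFα⇔Bounds : ∀ {us} → Tight (suc k) us → (∀ {m} → In 1 (suc (suc k)) m → act us m ≤ n) → ∀ c → Valid n (suc k) c →
    BRFα n wl us (realize id noPrime c) ⇔ Bounds (act us) (proj₂ c)
  BRFα⇔Bounds [] below c V = mk⇔ (λ (_ , b) → Equivalence.to (Bounded⇔Bounds c) b)
    (λ b → code⇒RF id-Mono target-InRO c V , Equivalence.from (Bounded⇔Bounds c) b)
  BRFα⇔Bounds {suc i₀ ∷ us} t@(step _ _ avoids t′) below c V = mk⇔ to from
    where
    below′ : ∀ {m} → In 1 (suc (suc k)) m → act us m ≤ n
    below′ r = ≤-trans (Tight-grows t r) (below r)
    open DemazureStep n k i₀ (Tight-bound t below) (act us) (act (suc i₀ ∷ us))
      (λ ra rb le → ≮⇒≥ λ b<a → <⇒≱ (Tight-mono t′ rb ra b<a) le) avoids (λ _ → refl)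
    to : BRFα n wl (suc i₀ ∷ us) (realize id noPrime c) → Bounds (act (suc i₀ ∷ us)) (proj₂ c)
    to (_ , t″ , d , e , x) = unplace noPrime id-Mono {BRFα n wl us} (λ {c} V → Equivalence.to (BRFα⇔Bounds t′ below′ c V)) t″ V e x
    from : Bounds (act (suc i₀ ∷ us)) (proj₂ c) → BRFα n wl (suc i₀ ∷ us) (realize id noPrime c)
    from b with Operators.split-at n k i₀ (proj₂ c) (subst (suc i₀ <_) (sym (Valid.factors V)) (Tight-bound t below))
    ... | Operators.split p u v s refl with place noPrime id-Mono (length v) p u v s ≤-refl refl V b
    ...   | t″ , c′ , V′ , e , b′ = code⇒RF id-Mono target-InRO c V , t″ , _ , e , Equivalence.from (BRFα⇔Bounds t′ below′ c′ V′) b′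

theorem5p37 : (n : ℕ) → 2 ≤ n →
  (z : List ℕ) → Involution z → NoDescAbove n z →
  (T : List PL) → OReducedRow z T →
  (us : List ℕ) → IsReducedWordOfU (alphaO T) us →
  (wl : List ℕ) → IsWLambda (lam (alphaO T)) wl →
  CrystalIso n (BRFT n z T) (BRFα n wl us)
theorem5p37 n _ z inv nd T@(t ∷ ts) rowT us red wl isWL = record
  { φ = φ
  ; maps = maps
  ; inj = inj
  ; surj = surj
  ; wt-pres = λ b _ → trans (sym (map-∘ _)) (trans (sym (map-∘ b)) (map-cong (λ u → trans (length-map _ (map (rank J ∘ ceil) u)) (length-map _ u)) b))
  ; comm→ = comm→
  ; comm← = comm←
  }
  where
  k = length ts
  R = row inv rowT
  open Row R
  open Composition mono k
  α-eq : alphaO T ≡ α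
  α-eq = alphaO-sorted T entries
  red′ : IsReducedWordOfU α us
  red′ = subst (λ a → IsReducedWordOfU a us) α-eq red
  long : LongTransposition (suc k) (act wl)
  long = wλ-hook {lam α} (s≤s z≤n) α-hook (subst (λ a → IsWLambda (lam a) wl) α-eq isWL)
  open Demazure {wl} n k long
  open Operators n k
  open FirstFactors n k using (applyOp-uniform)

  X Y : Elem → Set
  X = BRFT n z T
  Y = BRFα n wl us

  -- Entries are replaced by their ranks and the prescribed primes are forgotten; the bit of the
  -- first letter is kept. The bound stays in terms of `J`.
  φ : Elem → Elem
  φ a = realize id noPrime (code J a)

  φ-realize : ∀ {c} → Valid n (suc k) c → φ (realize J P c) ≡ realize id noPrime c
  φ-realize {c} V = cong (realize id noPrime) (code-realize mono c V)

  X⇒ : ∀ {a} → X a → ∃[ c ] Valid n (suc k) c × realize J P c ≡ a × Bounds J (proj₂ c)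
  X⇒ ((len , dec , _) , eqv , bounded) with class⇒code mono len dec (class-~O mono eqv inClass)
  ... | c , V , refl = c , V , refl , Equivalence.to (Bounded⇔Bounds c) bounded

  X⇐ : ∀ c → Valid n (suc k) c → Bounds J (proj₂ c) → X (realize J P c)
  X⇐ c V b = code⇒RF mono (class-InRO mono z-eq short gapped) c V , class-connected mono (code⇒class c V) inClass , Equivalence.from (Bounded⇔Bounds c) b

  J≤n : ∀ {m} → In 1 (suc (suc k)) m → act us m ≤ n
  J≤n r = ≤-trans (≤-reflexive (u-act red′ r)) (≤-trans (Mono-≤ mono (s≤s⁻¹ (proj₂ r))) (row-bound nd R))

  Bounds-us : ∀ c → Valid n (suc k) c → Bounds J (proj₂ c) ⇔ Bounds (act us) (proj₂ c)
  Bounds-us (_ , β) V = mk⇔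
    (Placed-map β (λ _ _ r le → subst (_ ≤_) (sym (u-act red′ r)) le) (Full-range (Valid.reading V)))
    (Placed-map β (λ _ _ r le → subst (_ ≤_) (u-act red′ r) le) (Full-range (Valid.reading V)))

  Y⇔ : ∀ c → Valid n (suc k) c → Y (realize id noPrime c) ⇔ Bounds (act us) (proj₂ c)
  Y⇔ = BRFα⇔Bounds (u-tight red′) J≤n

  Y⇒ : ∀ {c} → Valid n (suc k) c → Y (realize id noPrime c) → Bounds J (proj₂ c)
  Y⇒ {c} V y = Equivalence.from (Bounds-us c V) (Equivalence.to (Y⇔ c V) y)

  maps : ∀ b → X b → Y (φ b)
  maps b x with X⇒ x
  ... | c , V , refl , bd = subst Y (sym (φ-realize V)) (Equivalence.from (Y⇔ c V) (Equivalence.to (Bounds-us c V) bd))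

  inj : ∀ b c → X b → X c → φ b ≡ φ c → b ≡ c
  inj b b′ x x′ e with X⇒ x | X⇒ x′
  ... | c , V , refl , _ | c′ , V′ , refl , _ = cong (realize J P)
    (trans (sym (code-realize {id} {noPrime} id-Mono c V))
      (trans (cong (code id) (trans (sym (φ-realize V)) (trans e (φ-realize V′)))) (code-realize {id} {noPrime} id-Mono c′ V′)))

  surj : ∀ d → Y d → Σ Elem (λ b → X b × φ b ≡ d)
  surj d y with RF⇒code (BRFα-RF us y)
  ... | c , V , refl = realize J P c , X⇐ c V (Y⇒ V y) , φ-realize V

  comm→ : ∀ o → ValidOp n o → ∀ b → X b → ∀ c → applyOp n o b ≡ just c → X c → applyOp n o (φ b) ≡ just (φ c)
  comm→ o vo b x d e _ with X⇒ x
  -- One outcome on the code decides both sides: read with `J` and `P` it must agree with the given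
  -- result, and read with `id` and `noPrime` it yields the image.
  ... | c , V , refl , _ with applyOp-uniform o vo c V
  ...   | fails h = contradiction (trans (sym e) (h P mono)) λ ()
  ...   | moves c′ V′ h with just-injective (trans (sym e) (h P mono))
  ...     | refl = trans (cong (applyOp n o) (φ-realize V)) (trans (h noPrime id-Mono) (cong just (sym (φ-realize V′))))

  comm← : ∀ o → ValidOp n o → ∀ b → X b → ∀ d → applyOp n o (φ b) ≡ just d → Y d →
    Σ Elem (λ c → applyOp n o b ≡ just c × X c × φ c ≡ d)
  comm← o vo b x d e y with X⇒ x
  ... | c , V , refl , _ with applyOp-uniform o vo c V | trans (cong (applyOp n o) (sym (φ-realize V))) e
  ...   | fails h | e′ = contradiction (trans (sym e′) (h noPrime id-Mono)) λ ()
  ...   | moves c′ V′ h | e′ with just-injective (trans (sym e′) (h noPrime id-Mono))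
  ...     | refl = realize J P c′ , h P mono , X⇐ c′ V′ (Y⇒ V′ y) , φ-realize V′
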